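{- There is a deterministic two-player communication protocol that computes a minimum $s$-$t$ cut of an undirected unweighted graph $G=(V,E)$ on $n$ vertices whose edges are split between the players. The protocol uses $\widetilde{O}(n\,\nu^{4/7})$ bits of communication, where $\nu$ denotes the value of the minimum $s$-$t$ cut of $G$, and always succeeds.
   Context: Two-party communication model: $G=(V,E)$ has designated terminals $s,t\in V$; Alice privately holds $G_A=(V,E_A)$ and Bob privately holds $G_B=(V,E_B)$ with $E=E_A\cup E_B$; the vertex set $V$ is known to both. The players exchange messages and must both output the answer; cost is total bits communicated (local computation is free). An $s$-$t$ cut is a partition $(S,T)$ of $V$ with $s\in S,t\in T$; its value is $|E_G(S,T)|$, the number of edges of $G$ crossing it; a minimum $s$-$t$ cut minimizes this. $\widetilde{O}$ hides polylogarithmic factors in $n$. -}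

module Defs where

open import Data.Nat using (ℕ; zero; suc; _+_; _*_; _<_; _≤_; _<ᵇ_; _⊓_)
open import Data.Bool using (Bool; true; false; _∧_; _∨_; not; if_then_else_; T)
open import Data.Fin using (Fin; toℕ) renaming (zero to fzero; suc to fsuc)
open import Data.List using (List; []; _∷_; [_]; map; _++_; foldr; allFin)
open import Data.Nat.ListAction using (sum)
open import Relation.Binary.PropositionalEquality using (_≡_)
open import Data.Product using (_×_)

Graph : ℕ → Set
Graph n = Fin n → Fin n → Bool

SimpleGraph : ∀ {n} → Graph n → Set
SimpleGraph {n} E = ((u v : Fin n) → E u v ≡ E v u) × ((u : Fin n) → E u u ≡ false)

_∪ᴳ_ : ∀ {n} → Graph n → Graph n → Graph n
(EA ∪ᴳ EB) u v = EA u v ∨ EB u v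

VSet : ℕ → Set
VSet n = Fin n → Bool

IsCut : ∀ {n} → Fin n → Fin n → VSet n → Set
IsCut s t S = (S s ≡ true) × (S t ≡ false)

isCutᵇ : ∀ {n} → Fin n → Fin n → VSet n → Bool
isCutᵇ s t S = S s ∧ not (S t)

differ : Bool → Bool → Bool
differ true  b = not b
differ false b = b

cutValue : ∀ {n} → Graph n → VSet n → ℕ
cutValue {n} G S =
  sum (map (λ u → sum (map (λ v →
         if (toℕ u <ᵇ toℕ v) ∧ G u v ∧ differ (S u) (S v) then 1 else 0)
       (allFin n))) (allFin n))

IsMinCut : ∀ {n} → Fin n → Fin n → Graph n → VSet n → Set
IsMinCut {n} s t G S = IsCut s t S × ((S' : VSet n) → IsCut s t S' → cutValue G S ≤ cutValue G S')

extend : ∀ {n} → Bool → VSet n → VSet (suc n)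
extend b f fzero    = b
extend b f (fsuc i) = f i

allSubsets : (n : ℕ) → List (VSet n)
allSubsets zero    = [ (λ ()) ]
allSubsets (suc n) = map (extend true) (allSubsets n) ++ map (extend false) (allSubsets n)

-- ν: the value of a minimum s-t cut (minimum of cutValue over all s-t cuts;
-- the default n*n exceeds every cut value, so it never affects the minimum
-- when an s-t cut exists, i.e. when s ≢ t).
minCutValue : ∀ {n} → Fin n → Fin n → Graph n → ℕ
minCutValue {n} s t G =
  foldr (λ S m → if isCutᵇ s t S then cutValue G S ⊓ m else m) (n * n) (allSubsets n)

-- Deterministic two-party communication protocol (protocol tree):
-- at an internal node the owner (Alice, who sees X, or Bob, who sees Y)
-- sends one bit computed from its private input; leaves carry the common output.
data Protocol (X Y O : Set) : Set where
  leaf  : O → Protocol X Y O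
  alice : (X → Bool) → Protocol X Y O → Protocol X Y O → Protocol X Y O
  bob   : (Y → Bool) → Protocol X Y O → Protocol X Y O → Protocol X Y O

run : ∀ {X Y O} → Protocol X Y O → X → Y → O
run (leaf o)      x y = o
run (alice f p q) x y = if f x then run p x y else run q x y
run (bob g p q)   x y = if g y then run p x y else run q x y

cost : ∀ {X Y O} → Protocol X Y O → X → Y → ℕ
cost (leaf o)      x y = 0
cost (alice f p q) x y = suc (if f x then cost p x y else cost q x y)
cost (bob g p q)   x y = suc (if g y then cost p x y else cost q x y)

{-# OPTIONS --safe #-}
-- The players maintain a public subgraph K of the graph G. In a round each player splits the edges it still hides
-- into O(log n) levels of clusters that are expanders up to a factor Γ = O(log n), and announces only the
-- clusters and the degrees. Replacing every cluster by a star with these degrees as capacities gives, together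
-- with K, a public network whose minimum s-t cut V lies between ν and O(Γ ν). In a maximum flow of it every star
-- is a single-commodity demand inside a cluster, which the owner of the cluster can route along its own edges
-- with congestion Γ; the edges used are revealed. Hence K gains at least the fraction 1 / 2Γ of what each cut
-- still lacks to ν, and after polylogarithmically many rounds every cut of K has value at least ν. (An edge
-- held by both players only costs a factor 2.) A search that reveals at most n more edges
-- then finds a minimum cut of K that no hidden edge crosses.
-- Routing V units acyclically through C vertices of a simple graph uses O(|C| √V) edges (Karger–Levine),
-- so a round costs n √ν up to logarithms, which is better than required:
-- the seventh power is bounded through σ^7 ≤ (σ²)^4 with σ² = O(ν polylog n).
-- Acyclic flows are obtained as capacities that are minimal for the cut condition: every arc then leaves a
-- tight set, and by submodularity the vertices can be ordered so that all prefixes are tight.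
module Submission where

open import Defs
open import Data.Nat using (ℕ; _+_; _*_; _^_; _≤_)
open import Data.Nat.Logarithm using (⌊log₂_⌋)
open import Data.Fin using (Fin)
open import Data.Product using (Σ; _×_)
open import Relation.Binary.PropositionalEquality using (_≢_)

open import Data.Bool using (Bool; true; false; _∧_; _∨_; not; if_then_else_)
open import Data.Bool.Properties using (∧-identityʳ; ∧-comm; ∨-comm; ∨-idem; not-involutive)
open import Data.Empty using (⊥; ⊥-elim)
open import Data.Fin using (zero; suc; _≟_; toℕ; fromℕ<; _↑ˡ_; _↑ʳ_; splitAt; combine; remQuot)
open import Data.Fin.Properties using (toℕ<n; fromℕ<-toℕ; toℕ-injective; splitAt-↑ˡ; splitAt-↑ʳ; ↑ˡ-injective; remQuot-combine)
open import Data.List using ([]; _∷_; map; foldr; allFin; tabulate)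
open import Data.List.Properties using (map-tabulate)
open import Data.Nat using (zero; suc; _∸_; _<_; z≤n; s≤s; _≡ᵇ_; _<ᵇ_; _≤?_; _<?_; _⊓_; NonZero; >-nonZero)
import Data.Nat.ListAction as List
open import Data.Nat.Logarithm using (⌊log₂⌋-mono-≤; ⌊log₂[2*b]⌋≡1+⌊log₂b⌋; ⌊log₂[2^n]⌋≡n)
open import Data.Nat.Properties hiding (_≟_)
open import Data.Nat.Tactic.RingSolver using (solve-∀)
open import Data.Product using (∃; _,_; proj₁; proj₂)
open import Data.Sum using (_⊎_; inj₁; inj₂; [_,_]′)
open import Data.Unit using (tt)
open import Function using (_∘_)
open import Relation.Binary.PropositionalEquality using (_≡_; _≗_; refl; sym; trans; cong; cong₂; subst; module ≡-Reasoning)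
open import Relation.Nullary using (yes; no; does)
open import Relation.Nullary.Decidable using (dec-true; dec-false)
open import Algebra.Properties.Semiring.Sum +-*-semiring
  using (sum; sum-cong-≗; ∑-distrib-+; ∑-comm; *-distribˡ-sum; sum-replicate-zero)

-- A protocol is a fixed tree and `ν` is unknown to the players, so nothing in it depends on `ν`:
-- the number of rounds is a function of `n`, arcs are sent one by one with a stop bit so that the
-- cost follows their actual number, and the integer `σ` with `σ * σ` about `Γ * ν` exists only in
-- the analysis. Progress is measured on all cuts at once, by the deficit `ν ∸ cut ⟪ K ⟫ S`. With
-- `c = 2 * Γ₀` a round multiplies every deficit by at most `c / (1 + c)`, so `c` rounds halve it
-- (Bernoulli), and `2 * b + 1` halvings, where `n ≤ 2 ^ b`, make it vanish because it starts at
-- `ν ≤ n * n`. Local computation is free, so clusters, minimal capacities and cheapest cuts all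
-- come from exhaustive search. Flows are handled through their cut condition; conservation is read
-- off from consecutive tight prefixes. The final search rests on uncrossing: a smallest cheapest
-- cut of `K` around a subset of a minimum cut stays inside that minimum cut, so a hidden arc
-- leaving it can only point to a further vertex of the minimum cut.

⟦_⟧ : Bool → ℕ
⟦ true ⟧  = 1
⟦ false ⟧ = 0

⟦⟧≤1 : ∀ b → ⟦ b ⟧ ≤ 1
⟦⟧≤1 true  = ≤-refl
⟦⟧≤1 false = z≤n

⟦⟧*≤ : ∀ b x → ⟦ b ⟧ * x ≤ x
⟦⟧*≤ true  x = ≤-reflexive (*-identityˡ x)
⟦⟧*≤ false x = z≤n

⟦⟧-mono : ∀ {a b} → (a ≡ true → b ≡ true) → ⟦ a ⟧ ≤ ⟦ b ⟧
⟦⟧-mono {true}  h rewrite h refl = ≤-refl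
⟦⟧-mono {false} h = z≤n

∧-true : ∀ {a b} → a ∧ b ≡ true → a ≡ true × b ≡ true
∧-true {true} e = refl , e

not-true : ∀ {a} → not a ≡ true → a ≡ false
not-true {false} _ = refl

≢true : ∀ {a} → a ≢ true → a ≡ false
≢true {true}  h = ⊥-elim (h refl)
≢true {false} _ = refl

true≢false : ∀ {a} → a ≡ true → a ≡ false → ⊥
true≢false refl ()

-- Opaque so that sums unify by their summands.
opaque
  ∑ : ∀ {n} → (Fin n → ℕ) → ℕ
  ∑ = sum

  ∑-cong : ∀ {n} {f g : Fin n → ℕ} → f ≗ g → ∑ f ≡ ∑ g
  ∑-cong = sum-cong-≗

  ∑-+ : ∀ {n} (f g : Fin n → ℕ) → ∑ (λ i → f i + g i) ≡ ∑ f + ∑ g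
  ∑-+ = ∑-distrib-+

  ∑-*ˡ : ∀ {n} c (f : Fin n → ℕ) → ∑ (λ i → c * f i) ≡ c * ∑ f
  ∑-*ˡ c f = sym (*-distribˡ-sum c f)

  ∑-suc : ∀ {n} (f : Fin (suc n) → ℕ) → ∑ f ≡ f zero + ∑ (f ∘ suc)
  ∑-suc f = refl

  ∑-swap : ∀ {m n} (f : Fin m → Fin n → ℕ) → ∑ (λ i → ∑ (f i)) ≡ ∑ (λ j → ∑ λ i → f i j)
  ∑-swap = ∑-comm

  ∑-mono : ∀ {n} {f g : Fin n → ℕ} → (∀ i → f i ≤ g i) → ∑ f ≤ ∑ g
  ∑-mono {zero}  h = z≤n
  ∑-mono {suc n} h = +-mono-≤ (h zero) (∑-mono (h ∘ suc))

  term≤∑ : ∀ {n} (f : Fin n → ℕ) i → f i ≤ ∑ f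
  term≤∑ f zero    = m≤m+n _ _
  term≤∑ f (suc i) = ≤-trans (term≤∑ (f ∘ suc) i) (m≤n+m _ _)

  ∑-zero : ∀ {n} {f : Fin n → ℕ} → (∀ i → f i ≡ 0) → ∑ f ≡ 0
  ∑-zero {n} h = trans (sum-cong-≗ h) (sum-replicate-zero n)

  ∑-≤ : ∀ {n} (f : Fin n → ℕ) {c} → (∀ i → f i ≤ c) → ∑ f ≤ n * c
  ∑-≤ {zero}  f h = z≤n
  ∑-≤ {suc n} f h = +-mono-≤ (h zero) (∑-≤ (f ∘ suc) (h ∘ suc))

  ∑-single : ∀ {n} (j : Fin n) (f : Fin n → ℕ) → ∑ (λ i → ⟦ does (i ≟ j) ⟧ * f i) ≡ f j
  ∑-single zero    f = trans (cong₂ _+_ (+-identityʳ (f zero)) (∑-zero {f = λ i → ⟦ does (suc i ≟ zero) ⟧ * f (suc i)} λ _ → refl)) (+-identityʳ _)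
  ∑-single (suc j) f = ∑-single j (f ∘ suc)

  ∑-++ : ∀ m {n} (f : Fin (m + n) → ℕ) → ∑ f ≡ ∑ (λ i → f (i ↑ˡ n)) + ∑ (λ j → f (m ↑ʳ j))
  ∑-++ zero    f = refl
  ∑-++ (suc m) f = trans (cong (f zero +_) (∑-++ m (f ∘ suc))) (sym (+-assoc (f zero) _ _))

  ∑-combine : ∀ m {n} (f : Fin (m * n) → ℕ) → ∑ f ≡ ∑ (λ i → ∑ λ j → f (combine {m} {n} i j))
  ∑-combine zero        f = refl
  ∑-combine (suc m) {n} f = trans (∑-++ n f) (cong (∑ (λ j → f (j ↑ˡ (m * n))) +_) (∑-combine m (λ j → f (n ↑ʳ j))))

∑₂ : ∀ {m n} → (Fin m → Fin n → ℕ) → ℕ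
∑₂ f = ∑ λ u → ∑ (f u)

∑₂-cong : ∀ {m n} {f g : Fin m → Fin n → ℕ} → (∀ u v → f u v ≡ g u v) → ∑₂ f ≡ ∑₂ g
∑₂-cong h = ∑-cong λ u → ∑-cong (h u)

∑₂-mono : ∀ {m n} {f g : Fin m → Fin n → ℕ} → (∀ u v → f u v ≤ g u v) → ∑₂ f ≤ ∑₂ g
∑₂-mono h = ∑-mono λ u → ∑-mono (h u)

∑₂-+ : ∀ {m n} (f g : Fin m → Fin n → ℕ) → ∑₂ (λ u v → f u v + g u v) ≡ ∑₂ f + ∑₂ g
∑₂-+ f g = trans (∑-cong λ u → ∑-+ (f u) (g u)) (∑-+ (∑ ∘ f) (∑ ∘ g))

∑₂-*ˡ : ∀ {m n} c (f : Fin m → Fin n → ℕ) → ∑₂ (λ u v → c * f u v) ≡ c * ∑₂ f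
∑₂-*ˡ c f = trans (∑-cong λ u → ∑-*ˡ c (f u)) (∑-*ˡ c (∑ ∘ f))

∑₂-swap : ∀ {m n} (f : Fin m → Fin n → ℕ) → ∑₂ f ≡ ∑₂ (λ v u → f u v)
∑₂-swap f = ∑-swap f

∑-∑₂ : ∀ {k m n} (f : Fin k → Fin m → Fin n → ℕ) → ∑ (λ z → ∑₂ (f z)) ≡ ∑₂ (λ u v → ∑ λ z → f z u v)
∑-∑₂ f = trans (∑-swap λ z u → ∑ (f z u)) (∑-cong λ u → ∑-swap λ z v → f z u v)

term≤∑₂ : ∀ {m n} (f : Fin m → Fin n → ℕ) u v → f u v ≤ ∑₂ f
term≤∑₂ f u v = ≤-trans (term≤∑ (f u) v) (term≤∑ (∑ ∘ f) u)

-- Masses and directed cuts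

infixr 7 _∩_
infixr 6 _∪_

_∩_ _∪_ : ∀ {n} → VSet n → VSet n → VSet n
(S ∩ T) v = S v ∧ T v
(S ∪ T) v = S v ∨ T v

∁ : ∀ {n} → VSet n → VSet n
∁ S v = not (S v)

full : ∀ {n} → VSet n
full _ = true

mass : ∀ {n} → (Fin n → ℕ) → VSet n → ℕ
mass p S = ∑ λ v → ⟦ S v ⟧ * p v

size : ∀ {n} → VSet n → ℕ
size = mass λ _ → 1

-- Directed: only arcs leaving `S` count, as flows require. On a symmetric graph this is the
-- undirected cut value, see `cutValue-≡`.
cut : ∀ {n} → (Fin n → Fin n → ℕ) → VSet n → ℕ
cut r S = ∑₂ λ u v → ⟦ S u ∧ not (S v) ⟧ * r u v

mass-cong : ∀ {n} (p : Fin n → ℕ) {S T : VSet n} → S ≗ T → mass p S ≡ mass p T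
mass-cong p h = ∑-cong λ v → cong (λ b → ⟦ b ⟧ * p v) (h v)

cut-cong : ∀ {n} (r : Fin n → Fin n → ℕ) {S T : VSet n} → S ≗ T → cut r S ≡ cut r T
cut-cong r h = ∑₂-cong λ u v → cong₂ (λ a b → ⟦ a ∧ not b ⟧ * r u v) (h u) (h v)

mass-full : ∀ {n} (p : Fin n → ℕ) → mass p full ≡ ∑ p
mass-full p = ∑-cong λ v → *-identityˡ (p v)

mass≤∑ : ∀ {n} (p : Fin n → ℕ) S → mass p S ≤ ∑ p
mass≤∑ p S = ∑-mono λ v → ⟦⟧*≤ (S v) (p v)

mass-mono : ∀ {n} {p q : Fin n → ℕ} → (∀ v → p v ≤ q v) → ∀ S → mass p S ≤ mass q S
mass-mono h S = ∑-mono λ v → *-monoʳ-≤ ⟦ S v ⟧ (h v)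

mass-⊆ : ∀ {n} (p : Fin n → ℕ) {S T : VSet n} → (∀ v → S v ≡ true → T v ≡ true) → mass p S ≤ mass p T
mass-⊆ p h = ∑-mono λ v → *-monoˡ-≤ (p v) (⟦⟧-mono (h v))

cut-mono : ∀ {n} {r r' : Fin n → Fin n → ℕ} → (∀ u v → r u v ≤ r' u v) → ∀ S → cut r S ≤ cut r' S
cut-mono h S = ∑₂-mono λ u v → *-monoʳ-≤ ⟦ S u ∧ not (S v) ⟧ (h u v)

cut-+ : ∀ {n} (r r' : Fin n → Fin n → ℕ) S → cut (λ u v → r u v + r' u v) S ≡ cut r S + cut r' S
cut-+ r r' S = trans (∑₂-cong λ u v → *-distribˡ-+ ⟦ S u ∧ not (S v) ⟧ (r u v) (r' u v)) (∑₂-+ _ _)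

mass-∁ : ∀ {n} (p : Fin n → ℕ) S → mass p S + mass p (∁ S) ≡ ∑ p
mass-∁ p S = trans (sym (∑-+ _ _)) (∑-cong λ v → aux (S v) (p v))
  where
  aux : ∀ b x → ⟦ b ⟧ * x + ⟦ not b ⟧ * x ≡ x
  aux true  x = trans (+-identityʳ _) (+-identityʳ x)
  aux false x = +-identityʳ x

mass-∩∪ : ∀ {n} (p : Fin n → ℕ) S T → mass p S + mass p T ≡ mass p (S ∩ T) + mass p (S ∪ T)
mass-∩∪ p S T = trans (sym (∑-+ _ _)) (trans (∑-cong λ v → aux (S v) (T v) (p v)) (∑-+ _ _))
  where
  aux : ∀ a b x → ⟦ a ⟧ * x + ⟦ b ⟧ * x ≡ ⟦ a ∧ b ⟧ * x + ⟦ a ∨ b ⟧ * x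
  aux true  true  x = refl
  aux true  false x = +-comm (x + 0) 0
  aux false b     x = refl

≡true⇒T : ∀ {b} → b ≡ true → Data.Bool.T b
≡true⇒T refl = tt

T⇒≡true : ∀ {b} → Data.Bool.T b → b ≡ true
T⇒≡true {true} _ = refl

every : (Bool → Bool) → Bool
every P = P true ∧ P false

every-sound : ∀ (P : Bool → Bool) → every P ≡ true → ∀ b → P b ≡ true
every-sound P h true  = proj₁ (∧-true h)
every-sound P h false = proj₂ (∧-true {P true} h)

-- Here `a`, `b` tell whether the tail and the head lie in `S`, and `c`, `d` whether they lie in
-- `T`. The arc joins `S` minus `T` to `T` minus `S`, in either direction; these are the arcs that
-- submodularity loses.
crossing : Bool → Bool → Bool → Bool → Bool
crossing a b c d = (a ∧ not c ∧ d ∧ not b) ∨ (c ∧ not a ∧ b ∧ not d)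

-- A truth table: for closed `f` and `g` the hypothesis evaluates all sixteen cases, so `refl`
-- proves it.
agree₄ : (f g : Bool → Bool → Bool → Bool → ℕ) →
  (every λ a → every λ b → every λ c → every λ d → f a b c d ≡ᵇ g a b c d) ≡ true →
  ∀ a b c d → f a b c d ≡ g a b c d
agree₄ f g h a b c d = ≡ᵇ⇒≡ _ _ (≡true⇒T
  (every-sound (λ d → f a b c d ≡ᵇ g a b c d)
  (every-sound (λ c → every λ d → f a b c d ≡ᵇ g a b c d)
  (every-sound (λ b → every λ c → every λ d → f a b c d ≡ᵇ g a b c d)
  (every-sound (λ a → every λ b → every λ c → every λ d → f a b c d ≡ᵇ g a b c d) h a) b) c) d))

cut-bool : ∀ a b c d → ⟦ a ∧ not b ⟧ + ⟦ c ∧ not d ⟧ ≡ ⟦ (a ∧ c) ∧ not (b ∧ d) ⟧ + ⟦ (a ∨ c) ∧ not (b ∨ d) ⟧ + ⟦ crossing a b c d ⟧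
cut-bool = agree₄ _ (λ a b c d → ⟦ (a ∧ c) ∧ not (b ∧ d) ⟧ + ⟦ (a ∨ c) ∧ not (b ∨ d) ⟧ + ⟦ crossing a b c d ⟧) refl

cross : ∀ {n} → (Fin n → Fin n → ℕ) → VSet n → VSet n → ℕ
cross r S T = ∑₂ λ u v → ⟦ crossing (S u) (S v) (T u) (T v) ⟧ * r u v

-- Submodularity with its exact defect. The equality is what makes `cross` vanish as soon as both
-- sides are forced to be tight.
cut-∩∪ : ∀ {n} (r : Fin n → Fin n → ℕ) S T → cut r S + cut r T ≡ cut r (S ∩ T) + cut r (S ∪ T) + cross r S T
cut-∩∪ r S T = trans (sym (∑₂-+ _ _)) (trans (∑₂-cong pointwise)
    (trans (∑₂-+ _ _) (cong (_+ cross r S T) (∑₂-+ _ _))))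
  where
  pointwise : ∀ u v → ⟦ S u ∧ not (S v) ⟧ * r u v + ⟦ T u ∧ not (T v) ⟧ * r u v
    ≡ ⟦ (S ∩ T) u ∧ not ((S ∩ T) v) ⟧ * r u v + ⟦ (S ∪ T) u ∧ not ((S ∪ T) v) ⟧ * r u v + ⟦ crossing (S u) (S v) (T u) (T v) ⟧ * r u v
  pointwise u v = trans (sym (*-distribʳ-+ (r u v) ⟦ S u ∧ not (S v) ⟧ _))
    (trans (cong (_* r u v) (cut-bool (S u) (S v) (T u) (T v)))
    (trans (*-distribʳ-+ (r u v) (⟦ (S ∩ T) u ∧ not ((S ∩ T) v) ⟧ + _) _)
      (cong (_+ ⟦ crossing (S u) (S v) (T u) (T v) ⟧ * r u v) (*-distribʳ-+ (r u v) ⟦ (S ∩ T) u ∧ not ((S ∩ T) v) ⟧ _))))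

-- Exhaustive search

-- Vertex sets are functions and a search visits one representative per subset, so its predicates
-- must respect pointwise equality.
Extensional : ∀ {n} {A : Set} → (VSet n → A) → Set
Extensional {n} f = ∀ {S T : VSet n} → S ≗ T → f S ≡ f T

search : ∀ {n} (P : VSet n → Bool) → Extensional P → (∃ λ S → P S ≡ true) ⊎ (∀ S → P S ≡ false)
search {zero} P ext with P (λ ()) in eq
... | true  = inj₁ (_ , eq)
... | false = inj₂ λ S → trans (ext λ ()) eq
search {suc n} P ext with search (P ∘ extend true) (ext ∘ ext-extend) | search (P ∘ extend false) (ext ∘ ext-extend)
  where
  ext-extend : ∀ {b} {S T : VSet n} → S ≗ T → extend b S ≗ extend b T
  ext-extend h zero    = refl
  ext-extend h (suc i) = h i
... | inj₁ (S , e) | _            = inj₁ (_ , e)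
... | inj₂ _       | inj₁ (S , e) = inj₁ (_ , e)
... | inj₂ h       | inj₂ h'      = inj₂ λ S → trans (ext (split S)) (either (S zero) (S ∘ suc))
  where
  split : ∀ S → S ≗ extend (S zero) (S ∘ suc)
  split S zero    = refl
  split S (suc i) = refl
  either : ∀ b S → P (extend b S) ≡ false
  either true  = h
  either false = h'

searchFin : ∀ {n} (P : Fin n → Bool) → (∃ λ i → P i ≡ true) ⊎ (∀ i → P i ≡ false)
searchFin {zero}  P = inj₂ λ ()
searchFin {suc n} P with P zero in eq | searchFin (P ∘ suc)
... | true  | _            = inj₁ (_ , eq)
... | false | inj₁ (i , e) = inj₁ (_ , e)
... | false | inj₂ h       = inj₂ λ { zero → eq ; (suc i) → h i }

<ᵇ-intro : ∀ {m n} → m < n → (m <ᵇ n) ≡ true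
<ᵇ-intro lt = T⇒≡true (<⇒<ᵇ lt)

<ᵇ-elim : ∀ {m n} → (m <ᵇ n) ≡ true → m < n
<ᵇ-elim e = <ᵇ⇒< _ _ (≡true⇒T e)

<ᵇ-false : ∀ {m n} → (m <ᵇ n) ≡ false → n ≤ m
<ᵇ-false e = ≮⇒≥ λ lt → true≢false (<ᵇ-intro lt) e

≤⇒<ᵇ-false : ∀ {m n} → n ≤ m → (m <ᵇ n) ≡ false
≤⇒<ᵇ-false le = ≢true λ e → <⇒≱ (<ᵇ-elim e) le

argmin : ∀ {n} (P : VSet n → Bool) → Extensional P → (μ : VSet n → ℕ) → Extensional μ →
  ∀ S → P S ≡ true → ∃ λ S → P S ≡ true × (∀ T → P T ≡ true → μ S ≤ μ T)
argmin P extP μ extμ S e = descend (μ S) S e ≤-refl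
  where
  descend : ∀ k S → P S ≡ true → μ S ≤ k → ∃ λ S → P S ≡ true × (∀ T → P T ≡ true → μ S ≤ μ T)
  descend k S e h with search (λ T → P T ∧ (μ T <ᵇ μ S)) (λ eq → cong₂ (λ a b → a ∧ (b <ᵇ μ S)) (extP eq) (extμ eq))
  ... | inj₂ none = S , e , λ T eT → <ᵇ-false (subst (λ b → b ∧ (μ T <ᵇ μ S) ≡ false) eT (none T))
  descend zero    S e h | inj₁ (T , eT) = ⊥-elim (n≮0 (≤-trans (<ᵇ-elim (proj₂ (∧-true {P T} eT))) h))
  descend (suc k) S e h | inj₁ (T , eT) =
    descend k T (proj₁ (∧-true eT)) (≤-pred (≤-trans (<ᵇ-elim (proj₂ (∧-true {P T} eT))) h))

eqF : ∀ {n} → Fin n → Fin n → Bool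
eqF i j = does (i ≟ j)

eqF-refl : ∀ {n} (i : Fin n) → eqF i i ≡ true
eqF-refl i = dec-true (i ≟ i) refl

eqF-sound : ∀ {n} {i j : Fin n} → eqF i j ≡ true → i ≡ j
eqF-sound {i = i} {j} e with i ≟ j
... | yes eq = eq

findFin : ∀ {n} {A B : Fin n → Set} → (∀ i → A i ⊎ B i) → ∃ A ⊎ (∀ i → B i)
findFin {zero}  f = inj₂ λ ()
findFin {suc n} f with f zero | findFin (f ∘ suc)
... | inj₁ a | _            = inj₁ (zero , a)
... | inj₂ _ | inj₁ (i , a) = inj₁ (suc i , a)
... | inj₂ b | inj₂ g       = inj₂ λ { zero → b ; (suc i) → g i }

-- Acyclic flows from minimal capacities

unit : ∀ {n} → Fin n → Fin n → Fin n → Fin n → ℕ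
unit a b u v = ⟦ eqF u a ∧ eqF v b ⟧

∑₂-unit : ∀ {n} (a b : Fin n) (f : Fin n → Fin n → ℕ) → ∑₂ (λ u v → f u v * unit a b u v) ≡ f a b
∑₂-unit a b f = trans (∑₂-cong λ u v → aux (eqF u a) (eqF v b) (f u v))
  (trans (∑-cong λ u → ∑-*ˡ ⟦ eqF u a ⟧ (λ v → ⟦ eqF v b ⟧ * f u v))
  (trans (∑-single a (λ u → ∑ λ v → ⟦ eqF v b ⟧ * f u v)) (∑-single b (f a))))
  where
  aux : ∀ x y m → m * ⟦ x ∧ y ⟧ ≡ ⟦ x ⟧ * (⟦ y ⟧ * m)
  aux true  y m = trans (*-comm m _) (sym (+-identityʳ _))
  aux false y m = *-zeroʳ m

lower : ∀ {n} → Fin n → Fin n → (Fin n → Fin n → ℕ) → Fin n → Fin n → ℕ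
lower a b r u v = r u v ∸ unit a b u v

lower-+ : ∀ {n} (a b : Fin n) r → 0 < r a b → ∀ u v → r u v ≡ lower a b r u v + unit a b u v
lower-+ a b r pos u v = sym (m∸n+n≡m (aux (eqF u a) (eqF v b) refl refl))
  where
  aux : ∀ x y → eqF u a ≡ x → eqF v b ≡ y → ⟦ x ∧ y ⟧ ≤ r u v
  aux true  true  e e' rewrite eqF-sound {i = u} e | eqF-sound {i = v} e' = pos
  aux true  false _ _  = z≤n
  aux false _     _ _  = z≤n

cut-lower : ∀ {n} (a b : Fin n) r → 0 < r a b → ∀ S → cut r S ≡ cut (lower a b r) S + ⟦ S a ∧ not (S b) ⟧
cut-lower a b r pos S = trans (∑₂-cong λ u v → cong (⟦ S u ∧ not (S v) ⟧ *_) (lower-+ a b r pos u v))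
  (trans (cut-+ (lower a b r) (unit a b) S) (cong (cut (lower a b r) S +_) (∑₂-unit a b λ u v → ⟦ S u ∧ not (S v) ⟧)))

∑₂-lower : ∀ {n} (a b : Fin n) r → 0 < r a b → ∑₂ r ≡ ∑₂ (lower a b r) + 1
∑₂-lower a b r pos = trans (∑₂-cong (lower-+ a b r pos)) (trans (∑₂-+ _ _) (cong (∑₂ (lower a b r) +_)
  (trans (∑₂-cong λ u v → sym (*-identityˡ (unit a b u v))) (∑₂-unit a b λ _ _ → 1))))

size-< : ∀ {n} {S T : VSet n} → (∀ v → S v ≡ true → T v ≡ true) → ∀ b → S b ≡ false → T b ≡ true → size S < size T
size-< {S = S} {T} sub b sb tb = begin
  suc (size S)                                        ≡⟨ +-comm 1 (size S) ⟩
  size S + 1                                          ≡⟨ cong (size S +_) (∑-single b (λ _ → 1)) ⟨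
  size S + ∑ (λ v → ⟦ eqF v b ⟧ * 1)                  ≡⟨ ∑-+ _ _ ⟨
  ∑ (λ v → ⟦ S v ⟧ * 1 + ⟦ eqF v b ⟧ * 1)             ≤⟨ ∑-mono (λ v → one v (eqF v b) (S v) refl refl) ⟩
  size T                                              ∎
  where
  open ≤-Reasoning
  one : ∀ v e s → eqF v b ≡ e → S v ≡ s → ⟦ s ⟧ * 1 + ⟦ e ⟧ * 1 ≤ ⟦ T v ⟧ * 1
  one v true  true  e s = ⊥-elim (true≢false (subst (λ w → S w ≡ true) (eqF-sound {i = v} e) s) sb)
  one v true  false e s rewrite eqF-sound {i = v} e | tb = ≤-refl
  one v false true  e s rewrite sub v s = ≤-refl
  one v false false e s = z≤n

mass-const : ∀ {n} (C : VSet n) c → mass (λ _ → c) C ≡ size C * c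
mass-const C c = trans (∑-cong λ v → trans (*-comm ⟦ C v ⟧ c) (cong (c *_) (sym (*-identityʳ ⟦ C v ⟧)))) (trans (∑-*ˡ c _) (*-comm c (size C)))

greatest : ∀ {n} (P : VSet n) (f : Fin n → ℕ) → (∃ λ i → P i ≡ true × (∀ j → P j ≡ true → f j ≤ f i)) ⊎ (∀ i → P i ≡ false)
greatest {zero}  P f = inj₂ λ ()
greatest {suc n} P f with P zero in e | greatest (P ∘ suc) (f ∘ suc)
... | false | inj₁ (i , pi , top) = inj₁ (suc i , pi , λ { zero p → ⊥-elim (true≢false p e) ; (suc j) → top j })
... | false | inj₂ none = inj₂ λ { zero → e ; (suc i) → none i }
... | true  | inj₂ none = inj₁ (zero , e , λ { zero _ → ≤-refl ; (suc j) p → ⊥-elim (true≢false p (none j)) })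
... | true  | inj₁ (i , pi , top) with ≤-total (f zero) (f (suc i))
...   | inj₁ le = inj₁ (suc i , pi , λ { zero _ → le ; (suc j) → top j })
...   | inj₂ ge = inj₁ (zero , e , λ { zero _ → ≤-refl ; (suc j) p → ≤-trans (top j p) ge })

-- The pattern of every uncrossing argument: feasibility of two sets, whose slacks together with the
-- defect `x` sum to zero, makes both sets tight and kills the defect.
squeeze : ∀ {a b c d x} → a ≤ b → c ≤ d → a + c ≡ (b + d) + x → a ≡ b × c ≡ d × x ≡ 0
squeeze {a} {b} {c} {d} {x} h k e = ≤-antisym h b≤a , ≤-antisym k d≤c , n≤0⇒n≡0 x≤0
  where
  open ≤-Reasoning
  b≤a : b ≤ a
  b≤a = +-cancelʳ-≤ d b a (begin b + d ≤⟨ m≤m+n (b + d) x ⟩ b + d + x ≡⟨ e ⟨ a + c ≤⟨ +-monoʳ-≤ a k ⟩ a + d ∎)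
  d≤c : d ≤ c
  d≤c = +-cancelˡ-≤ b d c (begin b + d ≤⟨ m≤m+n (b + d) x ⟩ b + d + x ≡⟨ e ⟨ a + c ≤⟨ +-monoˡ-≤ c h ⟩ b + c ∎)
  x≤0 : x ≤ 0
  x≤0 = +-cancelˡ-≤ (b + d) x 0 (begin b + d + x ≡⟨ e ⟨ a + c ≤⟨ +-mono-≤ h k ⟩ b + d ≡⟨ +-identityʳ (b + d) ⟨ b + d + 0 ∎)

-- Critical capacities, tight sets and the vertex order they induce

module Supply {n : ℕ} (p q : Fin n → ℕ) where

  -- Gale's condition for routing the supply `p` to the demand `q`: supply in `S` in excess of the
  -- demand in `S` must be able to leave `S`.
  Feasible : (Fin n → Fin n → ℕ) → Set
  Feasible r = ∀ S → mass p S ≤ cut r S + mass q S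

  Tight : (Fin n → Fin n → ℕ) → VSet n → Set
  Tight r S = mass p S ≡ cut r S + mass q S

  Critical : (Fin n → Fin n → ℕ) → Set
  Critical r = ∀ u v → 0 < r u v → ∃ λ S → S u ≡ true × S v ≡ false × Tight r S

  feasible? : ∀ r → Feasible r ⊎ ∃ λ S → cut r S + mass q S < mass p S
  feasible? r with search (λ S → cut r S + mass q S <ᵇ mass p S)
                     (λ h → cong₂ _<ᵇ_ (cong₂ _+_ (cut-cong r h) (mass-cong q h)) (mass-cong p h))
  ... | inj₁ (S , e) = inj₂ (S , <ᵇ-elim e)
  ... | inj₂ none    = inj₁ λ S → <ᵇ-false (none S)

  minimise : ∀ k r → ∑₂ r ≤ k → Feasible r →
    ∃ λ r' → (∀ u v → r' u v ≤ r u v) × Feasible r' × Critical r'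
  minimise k r le feas with findFin (λ u → findFin (λ v → slack u v))
    where
    slack : ∀ u v → (0 < r u v × Feasible (lower u v r)) ⊎ (0 < r u v → ∃ λ S → S u ≡ true × S v ≡ false × Tight r S)
    slack u v with 0 <? r u v | feasible? (lower u v r)
    ... | no npos | _            = inj₂ λ pos → ⊥-elim (npos pos)
    ... | yes pos | inj₁ f       = inj₁ (pos , f)
    ... | yes pos | inj₂ (S , h) = inj₂ λ _ → S , leaves (S u ∧ not (S v)) refl
      where
      open ≤-Reasoning
      -- Lowering the arc affects the cut of the violating set `S` only if the arc leaves `S`, and
      -- then by exactly one; so `S` had no slack before.
      leaves : ∀ b → S u ∧ not (S v) ≡ b → S u ≡ true × S v ≡ false × Tight r S
      leaves false e = ⊥-elim (<⇒≱ h (≤-trans (feas S) (≤-reflexive (cong (_+ mass q S)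
        (trans (cut-lower u v r pos S) (trans (cong (λ b → cut (lower u v r) S + ⟦ b ⟧) e) (+-identityʳ _)))))))
      leaves true e = proj₁ (∧-true e) , not-true (proj₂ (∧-true {S u} e)) , ≤-antisym (feas S) (begin
        cut r S + mass q S                      ≡⟨ cong (_+ mass q S) (trans (cut-lower u v r pos S) (trans (cong (λ b → cut (lower u v r) S + ⟦ b ⟧) e) (+-comm _ 1))) ⟩
        suc (cut (lower u v r) S + mass q S)    ≤⟨ h ⟩
        mass p S                                ∎)
  ... | inj₂ critical = r , (λ _ _ → ≤-refl) , feas , critical
  minimise zero r le feas | inj₁ (u , v , pos , _) = ⊥-elim (<⇒≱ pos (≤-trans (term≤∑₂ r u v) le))
  minimise (suc k) r le feas | inj₁ (u , v , pos , f)
    with minimise k (lower u v r) (≤-pred (≤-trans (≤-reflexive (sym (trans (∑₂-lower u v r pos) (+-comm _ 1)))) le)) f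
  ... | r' , below , rest = r' , (λ x y → ≤-trans (below x y) (m∸n≤m (r x y) (unit u v x y))) , rest

  module Minimal (r : Fin n → Fin n → ℕ) (feas : Feasible r) (crit : Critical r) (balanced : ∑ p ≡ ∑ q) where

    tight-∅ : Tight r (λ _ → false)
    tight-∅ = trans (∑-zero λ _ → refl) (sym (cong₂ _+_ (∑-zero {f = λ u → ∑ λ v → 0 * r u v} λ _ → ∑-zero λ _ → refl) (∑-zero {f = λ v → 0 * q v} λ _ → refl)))

    tight-full : Tight r full
    tight-full = trans (mass-full p) (trans balanced (sym (cong₂ _+_ (∑-zero {f = λ u → ∑ λ v → 0 * r u v} λ _ → ∑-zero λ _ → refl) (mass-full q))))

    tight-cong : ∀ {S T} → S ≗ T → Tight r S → Tight r T
    tight-cong h t = trans (sym (mass-cong p h)) (trans t (cong₂ _+_ (cut-cong r h) (mass-cong q h)))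

    exchange : ∀ {a b c d x} S T → mass p S ≡ a → mass p T ≡ c → cut r S + mass q S ≡ b → cut r T + mass q T ≡ d →
      x ≡ cross r S T →
      (mass p (S ∩ T) + mass p (S ∪ T) ≡ a + c) × (cut r (S ∩ T) + mass q (S ∩ T) + (cut r (S ∪ T) + mass q (S ∪ T)) + x ≡ b + d)
    exchange S T refl refl refl refl refl = sym (mass-∩∪ p S T) ,
      trans (solve₁ (cut r (S ∩ T)) (mass q (S ∩ T)) (cut r (S ∪ T)) (mass q (S ∪ T)) (cross r S T))
        (trans (cong₂ _+_ (sym (cut-∩∪ r S T)) (sym (mass-∩∪ q S T))) (solve₂ (cut r S) (cut r T) (mass q S) (mass q T)))
      where
      solve₁ : ∀ a b c d e → a + b + (c + d) + e ≡ a + c + e + (b + d)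
      solve₁ = solve-∀
      solve₂ : ∀ a b c d → a + b + (c + d) ≡ a + c + (b + d)
      solve₂ = solve-∀

    uncross : ∀ S T → Tight r S → Tight r T → Tight r (S ∩ T) × Tight r (S ∪ T) × cross r S T ≡ 0
    uncross S T tS tT with exchange S T tS tT refl refl refl
    ... | ep , eb = squeeze (feas (S ∩ T)) (feas (S ∪ T)) (trans ep (sym eb))

    cross-zero : ∀ S T → cross r S T ≡ 0 → ∀ u v →
      S u ≡ true → S v ≡ false → T u ≡ false → T v ≡ true → r u v ≡ 0
    cross-zero S T e u v su sv tu tv = n≤0⇒n≡0 (≤-trans (≤-reflexive (trans (sym (*-identityˡ (r u v)))
        (sym (cong (λ b → ⟦ b ⟧ * r u v) crosses)))) (≤-trans (term≤∑₂ (λ u v → ⟦ crossing (S u) (S v) (T u) (T v) ⟧ * r u v) u v) (≤-reflexive e)))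
      where
      crosses : crossing (S u) (S v) (T u) (T v) ≡ true
      crosses rewrite su | sv | tu | tv = refl

    -- A positive arc leaves some tight `S` by criticality. If it also entered `T`, it would cross
    -- between `S` minus `T` and `T` minus `S`, where uncrossing leaves no capacity.
    no-entry : ∀ T → Tight r T → ∀ u v → T u ≡ false → T v ≡ true → r u v ≡ 0
    no-entry T tT u v tu tv with r u v in eq
    ... | zero  = refl
    ... | suc k with crit u v (≤-trans (s≤s z≤n) (≤-reflexive (sym eq)))
    ... | S , su , sv , tS = trans (sym eq) (cross-zero S T (proj₂ (proj₂ (uncross S T tS tT))) u v su sv tu tv)

    add : VSet n → Fin n → VSet n
    add T b v = T v ∨ eqF v b

    -- Inside T' \ T, for T' a minimal tight proper superset of T, there are no arcs,
    -- so every single vertex of T' \ T extends T to a tight set.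
    grow : ∀ T → Tight r T → ∀ x → T x ≡ false → ∃ λ b → T b ≡ false × Tight r (add T b)
    grow T tT x tx = extend-by (proj₁ new) (proj₁ (proj₂ new)) (proj₂ (proj₂ new))
      where
      P : VSet n → Bool
      P S = (mass p (S ∪ T) ≡ᵇ cut r (S ∪ T) + mass q (S ∪ T)) ∧ (size T <ᵇ size (S ∪ T))
      ∪-cong : ∀ {S S'} → S ≗ S' → (S ∪ T) ≗ (S' ∪ T)
      ∪-cong h v = cong (_∨ T v) (h v)
      P-intro : ∀ S → Tight r (S ∪ T) → size T < size (S ∪ T) → P S ≡ true
      P-intro S t lt = cong₂ _∧_ (T⇒≡true (≡⇒≡ᵇ _ _ t)) (<ᵇ-intro lt)
      best = argmin P
        (λ h → cong₂ _∧_ (cong₂ _≡ᵇ_ (mass-cong p (∪-cong h)) (cong₂ _+_ (cut-cong r (∪-cong h)) (mass-cong q (∪-cong h))))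
                         (cong (size T <ᵇ_) (mass-cong _ (∪-cong h))))
        (λ S → size (S ∪ T)) (λ h → mass-cong _ (∪-cong h)) full
        (P-intro full tight-full (size-< {S = T} {full ∪ T} (λ _ _ → refl) x tx refl))
      T' : VSet n
      T' = proj₁ best ∪ T
      P-best = ∧-true {mass p T' ≡ᵇ cut r T' + mass q T'} (proj₁ (proj₂ best))
      tT' : Tight r T'
      tT' = ≡ᵇ⇒≡ _ _ (≡true⇒T (proj₁ P-best))
      least : ∀ S → Tight r (S ∪ T) → size T < size (S ∪ T) → size T' ≤ size (S ∪ T)
      least S t lt = proj₂ (proj₂ best) S (P-intro S t lt)
      new : ∃ λ b → T b ≡ false × T' b ≡ true
      new with searchFin (λ v → not (T v) ∧ T' v)
      ... | inj₁ (b , e) = b , not-true (proj₁ (∧-true e)) , proj₂ (∧-true {not (T b)} e)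
      ... | inj₂ none = ⊥-elim (<⇒≱ (<ᵇ-elim (proj₂ P-best)) (mass-⊆ (λ _ → 1) {T'} {T} λ v e → covered v (T v) refl e))
        where
        covered : ∀ v b → T v ≡ b → T' v ≡ true → T v ≡ true
        covered v true  e _  = e
        covered v false e e' = ⊥-elim (true≢false (cong₂ (λ a b → not a ∧ b) e e') (none v))
      no-arc : ∀ u v → T' u ≡ true → T u ≡ false → T' v ≡ true → T v ≡ false → r u v ≡ 0
      no-arc u v tu' tu tv' tv with r u v in eq
      ... | zero  = refl
      ... | suc k with crit u v (≤-trans (s≤s z≤n) (≤-reflexive (sym eq)))
      -- The arc leaves a tight `S`. Then `(S ∩ T') ∪ T` is tight, contains `u` and misses `v`, so
      -- it lies strictly between `T` and `T'`, against the choice of `T'`.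
      ... | S , su , sv , tS = ⊥-elim (<⇒≱ (size-< {S = W ∪ T} {T'} inside v missing tv') (least W tW
                                  (size-< {S = T} {W ∪ T} (λ w e → trans (cong (W w ∨_) e) (∨-comm (W w) true)) u tu (cong (_∨ T u) (cong₂ _∧_ su tu')))))
        where
        W : VSet n
        W = S ∩ T'
        tW : Tight r (W ∪ T)
        tW = proj₁ (proj₂ (uncross W T (proj₁ (uncross S T' tS tT')) tT))
        missing : (W ∪ T) v ≡ false
        missing rewrite sv = tv
        inside : ∀ w → (W ∪ T) w ≡ true → T' w ≡ true
        inside w e with T w in tw
        ... | true  = ∨-comm (proj₁ best w) true
        ... | false = proj₂ (∧-true {S w} (trans (∨-comm false (S w ∧ (proj₁ best w ∨ false))) e))
      extend-by : ∀ b → T b ≡ false → T' b ≡ true → ∃ λ b → T b ≡ false × Tight r (add T b)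
      -- The sets `T` plus `b` and `T'` minus `b` meet in `T` and join to `T'`. A crossing arc would
      -- run inside `T'` minus `T`, so there is none and the tightness of `T` and `T'` passes to
      -- both.
      extend-by b tb tb' = b , tb , proj₁ (squeeze (feas X) (feas Y) (trans (sym (proj₁ sums)) (trans (cong₂ _+_ (tight-cong meet tT) (tight-cong join tT'))
          (trans (trans (sym (trans (cong (cut r (X ∩ Y) + mass q (X ∩ Y) + (cut r (X ∪ Y) + mass q (X ∪ Y)) +_) uncrossed) (+-identityʳ _))) (proj₂ sums)) (sym (+-identityʳ _))))))
        where
        X Y : VSet n
        X = add T b
        Y v = T' v ∧ not (eqF v b)
        meet : T ≗ X ∩ Y
        meet v with eqF v b in e | T v in tv
        ... | true  | true  = ⊥-elim (true≢false (subst (λ w → T w ≡ true) (eqF-sound {i = v} e) tv) tb)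
        ... | true  | false = sym (∧-comm (proj₁ best v ∨ false) false)
        ... | false | true  = sym (trans (∧-identityʳ _) (∨-comm (proj₁ best v) true))
        ... | false | false = refl
        join : T' ≗ X ∪ Y
        join v with eqF v b in e | T v in tv
        ... | true  | true  = ∨-comm (proj₁ best v) true
        ... | true  | false = trans (cong (proj₁ best v ∨_) (sym tv)) (subst (λ w → T' w ≡ true) (sym (eqF-sound {i = v} e)) tb')
        ... | false | true  = ∨-comm (proj₁ best v) true
        ... | false | false = sym (∧-identityʳ _)
        uncrossed : cross r X Y ≡ 0
        uncrossed = ∑-zero λ u → ∑-zero λ v → pair u v
          where
          split : ∀ v → X v ≡ true → Y v ≡ false → v ≡ b
          split v xv yv with eqF v b in e | T v in tv
          ... | true  | _     = eqF-sound e
          ... | false | true  = ⊥-elim (true≢false (trans (∧-identityʳ _) (∨-comm (proj₁ best v) true)) yv)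
          outer : ∀ v → Y v ≡ true → X v ≡ false → T' v ≡ true × T v ≡ false
          outer v yv xv with T v in tv
          ... | false = proj₁ (∧-true yv) , refl
          pair : ∀ u v → ⟦ crossing (X u) (X v) (Y u) (Y v) ⟧ * r u v ≡ 0
          pair u v with X u in xu | X v in xv | Y u in yu | Y v in yv
          ... | true | false | false | true rewrite split u xu yu =
            trans (+-identityʳ _) (no-arc b v tb' tb (proj₁ (outer v yv xv)) (proj₂ (outer v yv xv)))
          ... | false | true | true | false rewrite split v xv yv =
            trans (+-identityʳ _) (no-arc u b (proj₁ (outer u yu xu)) (proj₂ (outer u yu xu)) tb' tb)
          ... | true  | true  | true  | true  = refl
          ... | true  | true  | true  | false = refl
          ... | true  | true  | false | true  = refl
          ... | true  | true  | false | false = refl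
          ... | true  | false | true  | true  = refl
          ... | true  | false | true  | false = refl
          ... | true  | false | false | false = refl
          ... | false | true  | true  | true  = refl
          ... | false | true  | false | true  = refl
          ... | false | true  | false | false = refl
          ... | false | false | true  | true  = refl
          ... | false | false | true  | false = refl
          ... | false | false | false | true  = refl
          ... | false | false | false | false = refl
        sums = exchange X Y refl refl refl refl (refl {x = cross r X Y})

    -- By `no-entry` no arc enters a tight prefix, so arcs only go forward: this is a topological
    -- order of the support.
    record Ordering : Set where
      field
        rank      : Fin n → ℕ
        injective : ∀ {u v} → rank u ≡ rank v → u ≡ v
        prefix    : ∀ j → Tight r (λ v → rank v <ᵇ j)

    -- Vertices that have not been placed yet carry the rank i.
    place : ∀ k i (rank : Fin n → ℕ) → (∀ v → rank v ≤ i) →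
      (∀ {u v} → rank u < i → rank u ≡ rank v → u ≡ v) →
      (∀ j → j ≤ i → Tight r (λ v → rank v <ᵇ j)) →
      size {n} full ≤ size (λ v → rank v <ᵇ i) + k → Ordering
    insert : ∀ k i (rank : Fin n → ℕ) → (∀ v → rank v ≤ i) →
      (∀ {u v} → rank u < i → rank u ≡ rank v → u ≡ v) →
      (∀ j → j ≤ i → Tight r (λ v → rank v <ᵇ j)) →
      size {n} full ≤ size (λ v → rank v <ᵇ i) + suc k →
      ∃ (λ b → (rank b <ᵇ i) ≡ false × Tight r (add (λ v → rank v <ᵇ i) b)) → Ordering
    place k i rank le inj tight fuel with searchFin (λ v → not (rank v <ᵇ i))
    ... | inj₂ none = record { rank = rank ; injective = inj (below _) ; prefix = λ j → at j (≤-total j i) }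
      where
      below : ∀ v → rank v < i
      below v with rank v <ᵇ i in e | none v
      ... | true | _ = <ᵇ-elim e
      at : ∀ j → j ≤ i ⊎ i ≤ j → Tight r (λ v → rank v <ᵇ j)
      at j (inj₁ j≤i) = tight j j≤i
      at j (inj₂ i≤j) = tight-cong (λ v → trans (<ᵇ-intro (below v)) (sym (<ᵇ-intro (<-≤-trans (below v) i≤j)))) (tight i ≤-refl)
    place zero i rank le inj tight fuel | inj₁ (x , ex) =
      ⊥-elim (<⇒≱ (size-< {S = λ v → rank v <ᵇ i} {full} (λ _ _ → refl) x (not-true ex) refl) (≤-trans fuel (≤-reflexive (+-identityʳ _))))
    place (suc k) i rank le inj tight fuel | inj₁ (x , ex) =
      insert k i rank le inj tight fuel (grow (λ v → rank v <ᵇ i) (tight i ≤-refl) x (not-true ex))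

    insert k i rank le inj tight fuel (b , b∉ , tb) = place k (suc i) rank' le' inj' tight' fuel'
      where
      T : VSet n
      T v = rank v <ᵇ i
      rank' : Fin n → ℕ
      -- The new vertex `b` had rank `i` like all unplaced ones and keeps it; the vertices still
      -- unplaced move on to `suc i`.
      rank' v = if add T b v then rank v else suc i
      same : ∀ {v} → add T b v ≡ true → rank' v ≡ rank v
      same e rewrite e = refl
      other : ∀ {v} → add T b v ≡ false → rank' v ≡ suc i
      other e rewrite e = refl
      le' : ∀ v → rank' v ≤ suc i
      le' v with add T b v
      ... | true  = ≤-trans (le v) (n≤1+n i)
      ... | false = ≤-refl
      here : ∀ v → (rank' v <ᵇ suc i) ≡ add T b v
      here v with add T b v
      ... | true  = <ᵇ-intro (s≤s (le v))
      ... | false = ≤⇒<ᵇ-false {suc i} ≤-refl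
      inj' : ∀ {u v} → rank' u < suc i → rank' u ≡ rank' v → u ≡ v
      inj' {u} {v} lt eq = decide (add T b u) (add T b v) refl refl
        where
        decide : ∀ x y → add T b u ≡ x → add T b v ≡ y → u ≡ v
        decide false _     eu ev = ⊥-elim (<-irrefl (other eu) lt)
        decide true  false eu ev = ⊥-elim (<-irrefl (trans eq (other ev)) lt)
        decide true  true  eu ev = both (T u) (T v) refl refl
          where
          eq' : rank u ≡ rank v
          eq' = trans (sym (same eu)) (trans eq (same ev))
          both : ∀ x y → T u ≡ x → T v ≡ y → u ≡ v
          both true  _     tu _  = inj (<ᵇ-elim tu) eq'
          both false true  _  tv = sym (inj (<ᵇ-elim tv) (sym eq'))
          both false false tu tv = trans (eqF-sound (subst (λ c → c ∨ eqF u b ≡ true) tu eu)) (sym (eqF-sound (subst (λ c → c ∨ eqF v b ≡ true) tv ev)))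
      tight' : ∀ j → j ≤ suc i → Tight r (λ v → rank' v <ᵇ j)
      tight' j j≤ with m≤n⇒m<n∨m≡n j≤
      ... | inj₂ refl      = tight-cong (λ v → sym (here v)) tb
      ... | inj₁ (s≤s j≤i) = tight-cong old (tight j j≤i)
        where
        old : ∀ v → (rank v <ᵇ j) ≡ (rank' v <ᵇ j)
        old v with rank v <ᵇ i in e
        ... | true = refl
        ... | false with eqF v b
        ...   | true  = refl
        ...   | false = trans (≤⇒<ᵇ-false (≤-trans j≤i (<ᵇ-false e))) (sym (≤⇒<ᵇ-false (≤-trans j≤i (n≤1+n i))))
      fuel' : size {n} full ≤ size (λ v → rank' v <ᵇ suc i) + k
      fuel' = begin
        size {n} full                       ≤⟨ fuel ⟩
        size T + suc k                      ≡⟨ +-suc (size T) k ⟩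
        suc (size T) + k                    ≤⟨ +-monoˡ-≤ k (size-< {S = T} {add T b} (λ v e → cong (_∨ eqF v b) e) b b∉ (trans (cong (T b ∨_) (eqF-refl b)) (∨-comm (T b) true))) ⟩
        size (add T b) + k                  ≡⟨ cong (_+ k) (mass-cong (λ _ → 1) here) ⟨
        size (λ v → rank' v <ᵇ suc i) + k   ∎
        where open ≤-Reasoning

    ordering : Ordering
    ordering = place (size {n} full) 0 (λ _ → 0) (λ _ → z≤n) (λ ())
      (λ { zero z≤n → tight-∅ }) (m≤n+m _ (size {n} (λ _ → false)))

    module Ordered (o : Ordering) where

      open Ordering o

      before : Fin n → VSet n
      before w v = rank v <ᵇ rank w

      before-self : ∀ v → before v v ≡ false
      before-self v = ≤⇒<ᵇ-false {rank v} ≤-refl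

      tight-upto : ∀ w → Tight r (add (before w) w)
      tight-upto w = tight-cong upto (prefix (suc (rank w)))
        where
        upto : ∀ v → (rank v <ᵇ suc (rank w)) ≡ add (before w) w v
        upto v with rank v <ᵇ rank w in e | eqF v w in e'
        ... | true  | _     = <ᵇ-intro {rank v} (m≤n⇒m≤1+n (<ᵇ-elim {rank v} {rank w} e))
        ... | false | true  = <ᵇ-intro (s≤s (≤-reflexive (cong rank (eqF-sound e'))))
        ... | false | false = ≤⇒<ᵇ-false (≤∧≢⇒< (<ᵇ-false e) λ eq → true≢false (trans (cong (λ x → eqF x w) (sym (injective eq))) (eqF-refl w)) e')

      no-backward : ∀ u v → before v u ≡ false → r u v ≡ 0
      no-backward u v e with u ≟ v
      ... | yes refl with r u u in eq
      ...   | zero  = refl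
      ...   | suc _ with crit u u (≤-trans (s≤s z≤n) (≤-reflexive (sym eq)))
      ...     | S , su , sv , _ = ⊥-elim (true≢false su sv)
      no-backward u v e | no u≢v = no-entry (add (before v) v) (tight-upto v) u v
        (cong₂ _∨_ e (dec-false (u ≟ v) u≢v)) (trans (cong (before v v ∨_) (eqF-refl v)) (∨-comm (before v v) true))

      -- What leaves a tight prefix is its surplus of supply over demand. This bounds the arcs
      -- passing over any position, and is where acyclicity limits the flow through a vertex.
      cut-prefix : ∀ w → cut r (before w) ≤ ∑ p
      cut-prefix w = ≤-trans (m≤m+n _ _) (≤-trans (≤-reflexive (sym (prefix (rank w)))) (mass≤∑ p (before w)))

      inflow-≤ : ∀ v → ∑ (λ u → r u v) ≤ ∑ p
      inflow-≤ v = ≤-trans (∑-mono λ u → ≤-trans (arc u (before v u) refl) (term≤∑ (λ w → ⟦ before v u ∧ not (before v w) ⟧ * r u w) v)) (cut-prefix v)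
        where
        arc : ∀ u b → before v u ≡ b → r u v ≤ ⟦ before v u ∧ not (before v v) ⟧ * r u v
        arc u true  e rewrite e | before-self v = ≤-reflexive (sym (*-identityˡ _))
        arc u false e = ≤-trans (≤-reflexive (no-backward u v e)) z≤n

      -- Compare the tight prefixes just before and just after `v`: since all arcs go forward, the
      -- cut changes by outflow minus inflow of `v`. Thus critical capacities are themselves a flow.
      conservation : ∀ v → ∑ (r v) + q v ≡ ∑ (λ u → r u v) + p v
      conservation v = +-cancelˡ-≡ (cut r B + mass q B) _ _ (begin
        cut r B + mass q B + (out + q v)         ≡⟨ s₁ (cut r B) (mass q B) out (q v) ⟩
        (cut r B + out) + (mass q B + q v)       ≡⟨ cong₂ _+_ (sym exchange') (sym (mass-add q)) ⟩
        (cut r B⁺ + inn) + mass q B⁺             ≡⟨ s₂ (cut r B⁺) inn (mass q B⁺) ⟩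
        (cut r B⁺ + mass q B⁺) + inn             ≡⟨ cong (_+ inn) (sym (tight-upto v)) ⟩
        mass p B⁺ + inn                          ≡⟨ cong (_+ inn) (mass-add p) ⟩
        (mass p B + p v) + inn                   ≡⟨ cong (λ x → x + p v + inn) (prefix (rank v)) ⟩
        (cut r B + mass q B) + p v + inn         ≡⟨ s₃ (cut r B + mass q B) (p v) inn ⟩
        (cut r B + mass q B) + (inn + p v)       ∎)
        where
        open ≡-Reasoning
        B B⁺ : VSet n
        B = before v
        B⁺ = add B v
        out inn : ℕ
        out = ∑ (r v)
        inn = ∑ (λ u → r u v)
        s₁ : ∀ a b c d → a + b + (c + d) ≡ a + c + (b + d)
        s₁ = solve-∀
        s₂ : ∀ a b c → a + b + c ≡ a + c + b
        s₂ = solve-∀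
        s₃ : ∀ a b c → a + b + c ≡ a + (c + b)
        s₃ = solve-∀
        mass-add : ∀ (f : Fin n → ℕ) → mass f B⁺ ≡ mass f B + f v
        mass-add f = trans (∑-cong λ u → one u (B u) (eqF u v) refl refl) (trans (∑-+ _ _) (cong (mass f B +_) (∑-single v f)))
          where
          one : ∀ u b e → B u ≡ b → eqF u v ≡ e → ⟦ b ∨ e ⟧ * f u ≡ ⟦ b ⟧ * f u + ⟦ e ⟧ * f u
          one u true  true  h h' = ⊥-elim (true≢false h (trans (cong (before v) (eqF-sound {i = u} h')) (before-self v)))
          one u true  false h h' = sym (+-identityʳ _)
          one u false e     h h' = refl
        exchange' : cut r B⁺ + inn ≡ cut r B + out
        exchange' = trans (cong (cut r B⁺ +_) (sym (∑-cong λ u → ∑-single v (r u))))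
          (trans (sym (∑₂-+ _ _)) (trans (∑₂-cong λ u w → one u w (B u) (B w) (eqF u v) (eqF w v) refl refl refl refl)
          (trans (∑₂-+ _ _) (cong (cut r B +_) (trans (∑-cong λ u → ∑-*ˡ ⟦ eqF u v ⟧ (r u)) (∑-single v λ u → ∑ (r u)))))))
          where
          one : ∀ u w b c d e → B u ≡ b → B w ≡ c → eqF u v ≡ d → eqF w v ≡ e →
            ⟦ (b ∨ d) ∧ not (c ∨ e) ⟧ * r u w + ⟦ e ⟧ * r u w ≡ ⟦ b ∧ not c ⟧ * r u w + ⟦ d ⟧ * r u w
          one u w true  c     true  e     hb hc hd he = ⊥-elim (true≢false hb (trans (cong (before v) (eqF-sound {i = u} hd)) (before-self v)))
          one u w b     true  d     true  hb hc hd he = ⊥-elim (true≢false hc (trans (cong (before v) (eqF-sound {i = w} he)) (before-self v)))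
          one u w true  true  false false hb hc hd he = refl
          one u w true  false false true  hb hc hd he = +-comm 0 _
          one u w true  false false false hb hc hd he = refl
          one u w false true  true  false hb hc hd he rewrite eqF-sound {i = u} hd | no-entry B (prefix (rank v)) v w (before-self v) hc = refl
          one u w false true  false false hb hc hd he = refl
          one u w false false true  true  hb hc hd he = refl
          one u w false false true  false hb hc hd he = +-comm _ 0
          one u w false false false true  hb hc hd he rewrite eqF-sound {i = w} he | no-backward u v hb = refl
          one u w false false false false hb hc hd he = refl

      -- Karger–Levine: arcs spanning at most ℓ positions of C are counted by their tails, longer ones by
      -- the prefixes they leave, each of which is left by at most ∑ p units.
      few-arcs : ∀ (C : VSet n) → (∀ u v → 0 < r u v → C u ≡ true × C v ≡ true) → ∀ ℓ →
        ℓ * ∑₂ (λ u v → ⟦ 0 <ᵇ r u v ⟧) ≤ size C * (ℓ * ℓ + ∑ p)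
      few-arcs C inC ℓ = begin
        ℓ * ∑₂ X                                            ≡⟨ ∑₂-*ˡ ℓ X ⟨
        ∑₂ (λ u v → ℓ * X u v)                              ≤⟨ ∑₂-mono (λ u v → arc u v (r u v) refl (len u v <ᵇ suc ℓ) refl) ⟩
        ∑₂ (λ u v → ⟦ C u ⟧ * (ℓ * ⟦ short u v ⟧) + X u v * len u v)      ≡⟨ ∑₂-+ _ _ ⟩
        ∑₂ (λ u v → ⟦ C u ⟧ * (ℓ * ⟦ short u v ⟧)) + ∑₂ (λ u v → X u v * len u v) ≤⟨ +-mono-≤ shorts longs ⟩
        size C * (ℓ * ℓ) + size C * ∑ p                     ≡⟨ *-distribˡ-+ (size C) (ℓ * ℓ) (∑ p) ⟨
        size C * (ℓ * ℓ + ∑ p)                              ∎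
        where
        open ≤-Reasoning
        X : Fin n → Fin n → ℕ
        X u v = ⟦ 0 <ᵇ r u v ⟧
        between : Fin n → Fin n → VSet n
        between u v w = C w ∧ (before w u ∧ not (before w v))
        len : Fin n → Fin n → ℕ
        len u v = ∑ λ w → ⟦ between u v w ⟧
        short : Fin n → VSet n
        short u v = C v ∧ (before v u ∧ (len u v <ᵇ suc ℓ))
        arc : ∀ u v m → r u v ≡ m → ∀ b → (len u v <ᵇ suc ℓ) ≡ b →
          ℓ * ⟦ 0 <ᵇ m ⟧ ≤ ⟦ C u ⟧ * (ℓ * ⟦ C v ∧ (before v u ∧ b) ⟧) + ⟦ 0 <ᵇ m ⟧ * len u v
        arc u v zero    e b e' = ≤-trans (≤-reflexive (*-zeroʳ ℓ)) z≤n
        arc u v (suc m) e true e' with inC u v (≤-trans (s≤s z≤n) (≤-reflexive (sym e))) | before v u in f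
        ... | cu , cv | true rewrite cu | cv = ≤-trans (≤-reflexive (sym (+-identityʳ (ℓ * 1)))) (m≤m+n _ _)
        ... | cu , cv | false = ⊥-elim (1+n≢0 (trans (sym e) (no-backward u v f)))
        arc u v (suc m) e false e' = begin
          ℓ * 1             ≡⟨ *-identityʳ ℓ ⟩
          ℓ                 ≤⟨ ≤-trans (n≤1+n ℓ) (<ᵇ-false e') ⟩
          len u v           ≡⟨ +-identityʳ (len u v) ⟨
          1 * len u v       ≤⟨ m≤n+m (1 * len u v) (⟦ C u ⟧ * (ℓ * ⟦ C v ∧ (before v u ∧ false) ⟧)) ⟩
          ⟦ C u ⟧ * (ℓ * ⟦ C v ∧ (before v u ∧ false) ⟧) + 1 * len u v ∎
        -- All short positions after `u` lie between `u` and the farthest of them, whose distance is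
        -- at most `ℓ`; hence they are at most `ℓ` many.
        few-short : ∀ u → ∑ (λ v → ⟦ short u v ⟧) ≤ ℓ
        few-short u with greatest (short u) rank
        ... | inj₂ none = ≤-trans (≤-reflexive (∑-zero λ v → cong ⟦_⟧ (none v))) z≤n
        ... | inj₁ (w , sw , top) = ≤-trans (∑-mono λ v → ⟦⟧-mono (inside v))
            (≤-pred (<ᵇ-elim (proj₂ (∧-true {before w u} (proj₂ (∧-true {C w} sw))))))
          where
          inside : ∀ v → short u v ≡ true → between u w v ≡ true
          inside v sv = ∧₃-intro (proj₁ (∧-true {C v} sv)) (proj₁ (∧-true {before v u} (proj₂ (∧-true {C v} sv)))) (≤⇒<ᵇ-false {rank w} {rank v} (top v sv))
            where
            ∧₃-intro : ∀ {a b c} → a ≡ true → b ≡ true → c ≡ false → a ∧ (b ∧ not c) ≡ true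
            ∧₃-intro refl refl refl = refl
        shorts : ∑₂ (λ u v → ⟦ C u ⟧ * (ℓ * ⟦ short u v ⟧)) ≤ size C * (ℓ * ℓ)
        shorts = begin
          ∑₂ (λ u v → ⟦ C u ⟧ * (ℓ * ⟦ short u v ⟧))       ≡⟨ ∑-cong (λ u → trans (∑-*ˡ ⟦ C u ⟧ _) (cong (⟦ C u ⟧ *_) (∑-*ˡ ℓ _))) ⟩
          ∑ (λ u → ⟦ C u ⟧ * (ℓ * ∑ (λ v → ⟦ short u v ⟧))) ≤⟨ ∑-mono (λ u → *-monoʳ-≤ ⟦ C u ⟧ (*-monoʳ-≤ ℓ (few-short u))) ⟩
          mass (λ _ → ℓ * ℓ) C                              ≡⟨ mass-const C (ℓ * ℓ) ⟩
          size C * (ℓ * ℓ)                                  ∎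
        longs : ∑₂ (λ u v → X u v * len u v) ≤ size C * ∑ p
        longs = begin
          ∑₂ (λ u v → X u v * len u v)                            ≡⟨ ∑₂-cong (λ u v → sym (∑-*ˡ (X u v) _)) ⟩
          ∑₂ (λ u v → ∑ λ w → X u v * ⟦ between u v w ⟧)          ≡⟨ ∑-∑₂ (λ w u v → X u v * ⟦ between u v w ⟧) ⟨
          ∑ (λ w → ∑₂ λ u v → X u v * ⟦ between u v w ⟧)          ≤⟨ ∑-mono (λ w → ∑₂-mono λ u v → cross-≤ (C w) (before w u ∧ not (before w v)) (r u v)) ⟩
          ∑ (λ w → ∑₂ λ u v → ⟦ C w ⟧ * (⟦ before w u ∧ not (before w v) ⟧ * r u v)) ≡⟨ ∑-cong (λ w → ∑₂-*ˡ ⟦ C w ⟧ _) ⟩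
          ∑ (λ w → ⟦ C w ⟧ * cut r (before w))                    ≤⟨ ∑-mono (λ w → *-monoʳ-≤ ⟦ C w ⟧ (cut-prefix w)) ⟩
          mass (λ _ → ∑ p) C                                      ≡⟨ mass-const C (∑ p) ⟩
          size C * ∑ p                                            ∎
          where
          cross-≤ : ∀ c b m → ⟦ 0 <ᵇ m ⟧ * ⟦ c ∧ b ⟧ ≤ ⟦ c ⟧ * (⟦ b ⟧ * m)
          cross-≤ c     b     zero    = z≤n
          cross-≤ true  true  (suc m) = s≤s z≤n
          cross-≤ true  false (suc m) = z≤n
          cross-≤ false b     (suc m) = z≤n
 

-- Routing a single commodity with congestion inside a graph

⟪_⟫ : ∀ {n} → Graph n → Fin n → Fin n → ℕ
⟪ E ⟫ u v = ⟦ E u v ⟧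

0<ᵇ-pos : ∀ {m} → (0 <ᵇ m) ≡ true → 0 < m
0<ᵇ-pos = <ᵇ-elim {0}

scaled-cut : ∀ {n} c (r : Fin n → Fin n → ℕ) S → cut (λ u v → c * r u v) S ≡ c * cut r S
scaled-cut c r S = trans (∑₂-cong λ u v → swap ⟦ S u ∧ not (S v) ⟧ c (r u v)) (∑₂-*ˡ c _)
  where
  swap : ∀ a b c → a * (b * c) ≡ b * (a * c)
  swap = solve-∀

module Routing {n : ℕ} (Γ : ℕ) (E : Graph n) (p q : Fin n → ℕ) where

  open Supply p q

  support : (Fin n → Fin n → ℕ) → Graph n
  support r u v = 0 <ᵇ r u v

  capacity : Fin n → Fin n → ℕ
  capacity u v = Γ * ⟪ E ⟫ u v

  routeIf : Feasible capacity ⊎ (∃ λ S → cut capacity S + mass q S < mass p S) → Graph n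
  routeIf (inj₁ feas) = support (proj₁ (minimise (∑₂ capacity) capacity ≤-refl feas))
  routeIf (inj₂ _)    = λ _ _ → false

  -- Empty if p cannot be routed to q: a player evaluates this on every input, consistent with the transcript or not.
  opaque
    route : Graph n
    route = routeIf (feasible? capacity)

  -- Only the support of the flow is revealed, so the cut condition is kept for `Γ` times the
  -- support. A supply of at most `ℓ * ℓ` balances the two terms of `few-arcs`, giving `2 * ℓ` arcs
  -- per vertex. The set `route` itself does not depend on `ℓ`, which can therefore be chosen in the
  -- analysis.
  record Routes (C : VSet n) (ℓ : ℕ) (X : Graph n) : Set where
    field
      within : ∀ u v → X u v ≡ true → E u v ≡ true
      enough : ∀ S → mass p S ≤ Γ * cut ⟪ X ⟫ S + mass q S
      few    : ∑₂ ⟪ X ⟫ ≤ size C * (2 * ℓ)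

  module _ (C : VSet n) (inC : ∀ u v → E u v ≡ true → C u ≡ true × C v ≡ true)
           (balanced : ∑ p ≡ ∑ q) (ℓ : ℕ) (ℓ>0 : 0 < ℓ) (∑p≤ : ∑ p ≤ ℓ * ℓ)
           (ok : ∀ S → mass p S ≤ Γ * cut ⟪ E ⟫ S + mass q S) where

    private
      feasible : Feasible capacity
      feasible S = ≤-trans (ok S) (≤-reflexive (cong (_+ mass q S) (sym (scaled-cut Γ ⟪ E ⟫ S))))

      minimal-routes : ∀ r → (∀ u v → r u v ≤ capacity u v) → Feasible r → Critical r → Routes C ℓ (support r)
      minimal-routes r below feas crit = record { within = within ; enough = enough ; few = few }
        where
        open Minimal r feas crit balanced
        within : ∀ u v → support r u v ≡ true → E u v ≡ true
        within u v e with E u v in eq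
        ... | true  = refl
        ... | false = ⊥-elim (<⇒≱ (0<ᵇ-pos e) (≤-trans (below u v) (≤-reflexive (trans (cong (λ b → Γ * ⟦ b ⟧) eq) (*-zeroʳ Γ)))))
        arc : ∀ u v → r u v ≤ Γ * ⟦ 0 <ᵇ r u v ⟧
        arc u v with r u v | below u v
        ... | zero  | _ = z≤n
        ... | suc m | b = ≤-trans b (*-monoʳ-≤ Γ (⟦⟧≤1 (E u v)))
        enough : ∀ S → mass p S ≤ Γ * cut ⟪ support r ⟫ S + mass q S
        enough S = ≤-trans (feas S) (+-monoˡ-≤ (mass q S) (≤-trans (cut-mono arc S) (≤-reflexive (scaled-cut Γ _ S))))
        few : ∑₂ ⟪ support r ⟫ ≤ size C * (2 * ℓ)
        few = *-cancelˡ-≤ ℓ {{>-nonZero ℓ>0}} (begin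
          ℓ * ∑₂ ⟪ support r ⟫          ≤⟨ Ordered.few-arcs ordering C (λ u v pos → inC u v (within u v (<ᵇ-intro pos))) ℓ ⟩
          size C * (ℓ * ℓ + ∑ p)        ≤⟨ *-monoʳ-≤ (size C) (+-monoʳ-≤ (ℓ * ℓ) ∑p≤) ⟩
          size C * (ℓ * ℓ + ℓ * ℓ)      ≡⟨ arith (size C) ℓ ⟩
          ℓ * (size C * (2 * ℓ))        ∎)
          where
          open ≤-Reasoning
          arith : ∀ c l → c * (l * l + l * l) ≡ l * (c * (2 * l))
          arith = solve-∀

      decide : ∀ d → Routes C ℓ (routeIf d)
      decide (inj₁ feas) with minimise (∑₂ capacity) capacity ≤-refl feas
      ... | r , below , f , c = minimal-routes r below f c
      decide (inj₂ (S , lt)) = ⊥-elim (<⇒≱ lt (feasible S))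

    opaque
      unfolding route

      route-routes : Routes C ℓ route
      route-routes = decide (feasible? capacity)

-- The public star network

-- Its nodes are the n vertices followed by one centre for each of the k clusters.
module Star {n k : ℕ} (K : Fin n → Fin n → ℕ) (w : Fin k → Fin n → ℕ) where

  arc : Fin n ⊎ Fin k → Fin n ⊎ Fin k → ℕ
  arc (inj₁ u) (inj₁ v) = K u v
  arc (inj₁ v) (inj₂ z) = w z v
  arc (inj₂ z) (inj₁ v) = w z v
  arc (inj₂ _) (inj₂ _) = 0

  net : Fin (n + k) → Fin (n + k) → ℕ
  net x y = arc (splitAt n x) (splitAt n y)

  vertex : Fin n → Fin (n + k)
  vertex v = v ↑ˡ k

  centre : Fin k → Fin (n + k)
  centre z = n ↑ʳ z

  net-vv : ∀ u v → net (vertex u) (vertex v) ≡ K u v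
  net-vv u v = cong₂ arc (splitAt-↑ˡ n u k) (splitAt-↑ˡ n v k)

  net-vc : ∀ v z → net (vertex v) (centre z) ≡ w z v
  net-vc v z = cong₂ arc (splitAt-↑ˡ n v k) (splitAt-↑ʳ n k z)

  net-cv : ∀ z v → net (centre z) (vertex v) ≡ w z v
  net-cv z v = cong₂ arc (splitAt-↑ʳ n k z) (splitAt-↑ˡ n v k)

  net-cc : ∀ z y → net (centre z) (centre y) ≡ 0
  net-cc z y = cong₂ arc (splitAt-↑ʳ n k z) (splitAt-↑ʳ n k y)

  -- What the star around z contributes to the cut S when z lies on the side of S iff b.
  star : VSet n → Bool → Fin k → ℕ
  star S true  z = mass (w z) (∁ S)
  star S false z = mass (w z) S

  cut-net : ∀ S → cut net S ≡ cut K (S ∘ vertex) + ∑ (λ z → star (S ∘ vertex) (S (centre z)) z)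
  cut-net S = begin
    cut net S                                      ≡⟨ ∑-++ n _ ⟩
    ∑ (λ u → ∑ (term (vertex u))) + ∑ (λ z → ∑ (term (centre z)))
      ≡⟨ cong₂ _+_ (trans (∑-cong λ u → ∑-++ n _) (∑-+ _ _)) (trans (∑-cong λ z → ∑-++ n _) (∑-+ _ _)) ⟩
    (∑₂ (λ u v → term (vertex u) (vertex v)) + ∑₂ (λ v z → term (vertex v) (centre z)))
      + (∑₂ (λ z v → term (centre z) (vertex v)) + ∑₂ (λ z y → term (centre z) (centre y)))
      ≡⟨ cong₂ _+_ (cong₂ _+_ (∑₂-cong λ u v → cong (ind (vertex u) (vertex v) *_) (net-vv u v)) (∑₂-swap _))
                   (trans (cong (∑₂ (λ z v → term (centre z) (vertex v)) +_) (∑-zero λ z → ∑-zero λ y → trans (cong (ind (centre z) (centre y) *_) (net-cc z y)) (*-zeroʳ (ind (centre z) (centre y))))) (+-identityʳ _)) ⟩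
    (cut K S₁ + ∑₂ (λ z v → term (vertex v) (centre z))) + ∑₂ (λ z v → term (centre z) (vertex v)) ≡⟨ +-assoc (cut K S₁) _ _ ⟩
    cut K S₁ + (∑₂ (λ z v → term (vertex v) (centre z)) + ∑₂ (λ z v → term (centre z) (vertex v)))
      ≡⟨ cong (cut K S₁ +_) (trans (sym (∑-+ _ _)) (∑-cong λ z → trans (sym (∑-+ _ _)) (leaves z (S (centre z)) refl))) ⟩
    cut K S₁ + ∑ (λ z → star S₁ (S (centre z)) z)  ∎
    where
    open ≡-Reasoning
    S₁ = S ∘ vertex
    ind : Fin (n + k) → Fin (n + k) → ℕ
    ind x y = ⟦ S x ∧ not (S y) ⟧
    term : Fin (n + k) → Fin (n + k) → ℕ
    term x y = ind x y * net x y
    leaves : ∀ z b → S (centre z) ≡ b → ∑ (λ v → term (vertex v) (centre z) + term (centre z) (vertex v)) ≡ star S₁ b z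
    leaves z true  e = ∑-cong λ v → trans (cong₂ (λ x y → ⟦ S (vertex v) ∧ not (S (centre z)) ⟧ * x + ⟦ S (centre z) ∧ not (S (vertex v)) ⟧ * y) (net-vc v z) (net-cv z v)) (one v (S (vertex v)))
      where
      one : ∀ v b → ⟦ b ∧ not (S (centre z)) ⟧ * w z v + ⟦ S (centre z) ∧ not b ⟧ * w z v ≡ ⟦ not b ⟧ * w z v
      one v true  rewrite e = refl
      one v false rewrite e = refl
    leaves z false e = ∑-cong λ v → trans (cong₂ (λ x y → ⟦ S (vertex v) ∧ not (S (centre z)) ⟧ * x + ⟦ S (centre z) ∧ not (S (vertex v)) ⟧ * y) (net-vc v z) (net-cv z v)) (one v (S (vertex v)))
      where
      one : ∀ v b → ⟦ b ∧ not (S (centre z)) ⟧ * w z v + ⟦ S (centre z) ∧ not b ⟧ * w z v ≡ ⟦ b ⟧ * w z v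
      one v true  rewrite e = +-identityʳ _
      one v false rewrite e = refl

  -- The cheapest extension of `S` to the network: each centre joins the side where its star
  -- contributes less.
  capacity : VSet n → ℕ
  capacity S = cut K S + ∑ (λ z → mass (w z) S ⊓ mass (w z) (∁ S))

  -- The trace of a maximum flow on the stars: centre `z` collects `into z` and hands out `out z`.
  -- That `bounded` limits a single star by the whole value uses acyclicity. `covers` is the flow
  -- balance of `S`, with the flow on arcs of `K` estimated by the cut.
  record Demand (s t : Fin n) : Set where
    field
      value    : ℕ
      into out : Fin k → Fin n → ℕ
      into≤    : ∀ z v → into z v ≤ w z v
      out≤     : ∀ z v → out z v ≤ w z v
      balanced : ∀ z → ∑ (into z) ≡ ∑ (out z)
      bounded  : ∀ z → ∑ (into z) ≤ value
      covers   : ∀ S → S s ≡ true → S t ≡ false → value + ∑ (λ z → mass (out z) S) ≤ cut K S + ∑ (λ z → mass (into z) S)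
      attained : ∃ λ S → S s ≡ true × S t ≡ false × capacity S ≤ value
      least    : ∀ S → S s ≡ true → S t ≡ false → value ≤ capacity S

  capacity-≤-cut : ∀ S → capacity (S ∘ vertex) ≤ cut net S
  capacity-≤-cut S = ≤-trans (+-monoʳ-≤ (cut K (S ∘ vertex)) (∑-mono λ z → side z (S (centre z)))) (≤-reflexive (sym (cut-net S)))
    where
    side : ∀ z b → mass (w z) (S ∘ vertex) ⊓ mass (w z) (∁ (S ∘ vertex)) ≤ star (S ∘ vertex) b z
    side z true  = m⊓n≤n _ _
    side z false = m⊓n≤m _ _

  closest : VSet n → VSet (n + k)
  closest S x = [ S , (λ z → mass (w z) (∁ S) <ᵇ mass (w z) S) ]′ (splitAt n x)

  closest-v : ∀ S v → closest S (vertex v) ≡ S v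
  closest-v S v = cong [ S , _ ]′ (splitAt-↑ˡ n v k)

  cut-closest : ∀ S → cut net (closest S) ≤ capacity S
  cut-closest S = ≤-trans (≤-reflexive (trans (cut-net (closest S)) (cong₂ _+_ (cut-cong K (closest-v S))
      (∑-cong λ z → trans (star-cong (closest S (centre z)) z) (cong (λ b → star S b z) (cong [ S , _ ]′ (splitAt-↑ʳ n k z)))))))
      (+-monoʳ-≤ (cut K S) (∑-mono λ z → cheap z _ refl))
    where
    star-cong : ∀ b z → star (closest S ∘ vertex) b z ≡ star S b z
    star-cong true  z = mass-cong (w z) λ v → cong not (closest-v S v)
    star-cong false z = mass-cong (w z) (closest-v S)
    cheap : ∀ z b → (mass (w z) (∁ S) <ᵇ mass (w z) S) ≡ b → star S b z ≤ mass (w z) S ⊓ mass (w z) (∁ S)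
    cheap z true  e = ≤-reflexive (sym (m≥n⇒m⊓n≡n (<⇒≤ (<ᵇ-elim e))))
    cheap z false e = ≤-reflexive (sym (m≤n⇒m⊓n≡m (<ᵇ-false e)))

  module _ (s t : Fin n) (s≢t : s ≢ t) where

    private
      isCut : VSet (n + k) → Bool
      isCut S = S (vertex s) ∧ not (S (vertex t))

      least-cut : ∃ λ S → isCut S ≡ true × (∀ T → isCut T ≡ true → cut net S ≤ cut net T)
      least-cut = argmin isCut (λ h → cong₂ (λ a b → a ∧ not b) (h (vertex s)) (h (vertex t))) (cut net) (cut-cong net)
        (λ x → eqF x (vertex s)) (cong₂ (λ a b → a ∧ not b) (eqF-refl (vertex s)) (dec-false (vertex t ≟ vertex s) λ e → s≢t (sym (↑ˡ-injective k t s e))))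

      module _ (V : ℕ) (S₀ : VSet (n + k)) (cut₀ : isCut S₀ ≡ true) (V≡ : V ≡ cut net S₀) (min₀ : ∀ T → isCut T ≡ true → V ≤ cut net T) where

        point : Fin n → Fin (n + k) → ℕ
        point v x = ⟦ eqF x (vertex v) ⟧ * V

        mass-point : ∀ v S → mass (point v) S ≡ ⟦ S (vertex v) ⟧ * V
        mass-point v S = trans (∑-cong λ x → swap ⟦ S x ⟧ ⟦ eqF x (vertex v) ⟧ V) (∑-single (vertex v) λ x → ⟦ S x ⟧ * V)
          where
          swap : ∀ a b c → a * (b * c) ≡ b * (a * c)
          swap = solve-∀

        total-point : ∀ v → ∑ (point v) ≡ V
        total-point v = ∑-single (vertex v) λ _ → V

        open Supply (point s) (point t)

        -- Only a set with `s` inside and `t` outside has surplus supply, and for it the condition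
        -- is the minimality of `V`.
        feasible : Feasible net
        feasible S with S (vertex s) in es | S (vertex t) in et
        ... | true  | false = ≤-trans (≤-reflexive (trans (mass-point s S) (trans (cong (λ b → ⟦ b ⟧ * V) es) (*-identityˡ V))))
                                (≤-trans (min₀ S (cong₂ (λ a b → a ∧ not b) es et)) (m≤m+n _ _))
        ... | false | _     = ≤-trans (≤-reflexive (trans (mass-point s S) (cong (λ b → ⟦ b ⟧ * V) es))) z≤n
        ... | true  | true  = ≤-trans (≤-reflexive (trans (mass-point s S) (trans (cong (λ b → ⟦ b ⟧ * V) (trans es (sym et))) (sym (mass-point t S))))) (m≤n+m _ _)

        demand-of : ∀ r → (∀ x y → r x y ≤ net x y) → Feasible r → Critical r → Demand s t
        demand-of r below feas crit = record
          { value = V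
          ; into = into
          ; out = out
          ; into≤ = λ z v → ≤-trans (below (vertex v) (centre z)) (≤-reflexive (net-vc v z))
          ; out≤ = λ z v → ≤-trans (below (centre z) (vertex v)) (≤-reflexive (net-cv z v))
          ; balanced = balanced
          ; bounded = λ z → ≤-trans (m≤m+n _ _) (≤-trans (≤-reflexive (sym (∑-++ n _))) (≤-trans (inflow-≤ (centre z)) (≤-reflexive (total-point s))))
          ; covers = covers
          ; attained = S₀ ∘ vertex , proj₁ (∧-true cut₀) , not-true (proj₂ (∧-true {S₀ (vertex s)} cut₀)) , ≤-trans (capacity-≤-cut S₀) (≤-reflexive (sym V≡))
          ; least = λ S Ss St → ≤-trans (min₀ (closest S) (cong₂ (λ a b → a ∧ not b) (trans (closest-v S s) Ss) (trans (closest-v S t) St))) (cut-closest S)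
          }
          where
          open Minimal r feas crit (trans (total-point s) (sym (total-point t)))
          open Ordered ordering
          into out : Fin k → Fin n → ℕ
          into z v = r (vertex v) (centre z)
          out  z v = r (centre z) (vertex v)
          zero-cc : ∀ z y → r (centre z) (centre y) ≡ 0
          zero-cc z y = n≤0⇒n≡0 (≤-trans (below (centre z) (centre y)) (≤-reflexive (net-cc z y)))
          not-vertex : ∀ z v → point v (centre z) ≡ 0
          not-vertex z v = cong (λ b → ⟦ b ⟧ * V) (dec-false (centre z ≟ vertex v) λ e → apart (trans (sym (splitAt-↑ʳ n k z)) (trans (cong (splitAt n) e) (splitAt-↑ˡ n v k))))
            where
            apart : ∀ {a b} → inj₂ {A = Fin n} {B = Fin k} a ≡ inj₁ b → ⊥
            apart ()
          balanced : ∀ z → ∑ (into z) ≡ ∑ (out z)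
          balanced z = sym (begin
            ∑ (out z)                                   ≡⟨ trans (cong (∑ (out z) +_) (∑-zero λ y → zero-cc z y)) (+-identityʳ _) ⟨
            ∑ (out z) + ∑ (λ y → r (centre z) (centre y)) ≡⟨ ∑-++ n _ ⟨
            ∑ (r (centre z))                            ≡⟨ trans (cong (∑ (r (centre z)) +_) (not-vertex z t)) (+-identityʳ _) ⟨
            ∑ (r (centre z)) + point t (centre z)       ≡⟨ conservation (centre z) ⟩
            ∑ (λ x → r x (centre z)) + point s (centre z) ≡⟨ trans (cong (∑ (λ x → r x (centre z)) +_) (not-vertex z s)) (+-identityʳ _) ⟩
            ∑ (λ x → r x (centre z))                    ≡⟨ ∑-++ n _ ⟩
            ∑ (into z) + ∑ (λ y → r (centre y) (centre z)) ≡⟨ trans (cong (∑ (into z) +_) (∑-zero λ y → zero-cc y z)) (+-identityʳ _) ⟩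
            ∑ (into z)                                  ∎)
            where open ≡-Reasoning
          ρ : Fin n → Fin n → ℕ
          ρ u v = r (vertex u) (vertex v)
          covers : ∀ S → S s ≡ true → S t ≡ false → V + ∑ (λ z → mass (out z) S) ≤ cut K S + ∑ (λ z → mass (into z) S)
          -- Conservation is summed over the vertices of `S`, centres left out. Arcs between
          -- vertices of `S` occur on both sides as `inner`, arcs entering `S` from other vertices
          -- are dropped, and arcs leaving towards other vertices are bounded by the cut of `K`.
          covers S Ss St = +-cancelˡ-≤ inner _ _ (begin
            inner + (V + ∑ (λ z → mass (out z) S))      ≡⟨ shuffle inner V _ ⟩
            inner + ∑ (λ z → mass (out z) S) + V        ≤⟨ +-monoˡ-≤ V (+-monoˡ-≤ _ inner≤cols) ⟩
            cols + ∑ (λ z → mass (out z) S) + V         ≡⟨ cong₂ _+_ in-side supply-s ⟨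
            mass (λ v → ∑ (λ x → r x (vertex v))) S + mass (point s ∘ vertex) S ≡⟨ masses (λ v → ∑ (λ x → r x (vertex v))) (point s ∘ vertex) ⟨
            mass (λ v → ∑ (λ x → r x (vertex v)) + point s (vertex v)) S ≡⟨ ∑-cong (λ v → cong (⟦ S v ⟧ *_) (conservation (vertex v))) ⟨
            mass (λ v → ∑ (r (vertex v)) + point t (vertex v)) S ≡⟨ masses (λ v → ∑ (r (vertex v))) (point t ∘ vertex) ⟩
            mass (λ v → ∑ (r (vertex v))) S + mass (point t ∘ vertex) S ≡⟨ cong₂ _+_ out-side supply-t ⟩
            rows + ∑ (λ z → mass (into z) S) + 0        ≡⟨ +-identityʳ _ ⟩
            rows + ∑ (λ z → mass (into z) S)            ≤⟨ +-monoˡ-≤ _ rows≤ ⟩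
            inner + cut K S + ∑ (λ z → mass (into z) S) ≡⟨ +-assoc inner _ _ ⟩
            inner + (cut K S + ∑ (λ z → mass (into z) S)) ∎)
            where
            open ≤-Reasoning
            inner rows cols : ℕ
            inner = ∑₂ λ u v → ⟦ S u ∧ S v ⟧ * ρ u v
            rows  = ∑₂ λ u v → ⟦ S u ⟧ * ρ u v
            cols  = ∑₂ λ u v → ⟦ S v ⟧ * ρ u v
            shuffle : ∀ a b c → a + (b + c) ≡ a + c + b
            shuffle = solve-∀
            masses : ∀ (f g : Fin n → ℕ) → mass (λ v → f v + g v) S ≡ mass f S + mass g S
            masses f g = trans (∑-cong λ v → *-distribˡ-+ ⟦ S v ⟧ (f v) (g v)) (∑-+ _ _)
            supply : ∀ v → mass (point v ∘ vertex) S ≡ ⟦ S v ⟧ * V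
            supply v = trans (∑-cong λ u → trans (swap ⟦ S u ⟧ ⟦ eqF (vertex u) (vertex v) ⟧ V) (cong (λ b → ⟦ b ⟧ * (⟦ S u ⟧ * V)) (eqF-vertex u)))
                (∑-single v λ u → ⟦ S u ⟧ * V)
              where
              swap : ∀ a b c → a * (b * c) ≡ b * (a * c)
              swap = solve-∀
              eqF-vertex : ∀ u → eqF (vertex u) (vertex v) ≡ eqF u v
              eqF-vertex u with u ≟ v
              ... | yes refl = eqF-refl (vertex u)
              ... | no u≢v   = dec-false (vertex u ≟ vertex v) (u≢v ∘ ↑ˡ-injective k u v)
            supply-s : mass (point s ∘ vertex) S ≡ V
            supply-s = trans (supply s) (trans (cong (λ b → ⟦ b ⟧ * V) Ss) (*-identityˡ V))
            supply-t : mass (point t ∘ vertex) S ≡ 0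
            supply-t = trans (supply t) (cong (λ b → ⟦ b ⟧ * V) St)
            out-side : mass (λ v → ∑ (r (vertex v))) S ≡ rows + ∑ (λ z → mass (into z) S)
            out-side = trans (∑-cong λ v → cong (⟦ S v ⟧ *_) (∑-++ n (r (vertex v))))
              (trans (masses _ _) (cong₂ _+_ (∑-cong λ v → sym (∑-*ˡ ⟦ S v ⟧ (ρ v)))
                (trans (∑-cong λ v → sym (∑-*ˡ ⟦ S v ⟧ (λ z → into z v))) (∑₂-swap _))))
            in-side : mass (λ v → ∑ (λ x → r x (vertex v))) S ≡ cols + ∑ (λ z → mass (out z) S)
            in-side = trans (∑-cong λ v → cong (⟦ S v ⟧ *_) (∑-++ n (λ x → r x (vertex v))))
              (trans (masses _ _) (cong₂ _+_ (trans (∑-cong λ v → sym (∑-*ˡ ⟦ S v ⟧ (λ u → ρ u v))) (∑₂-swap _))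
                (trans (∑-cong λ v → sym (∑-*ˡ ⟦ S v ⟧ (λ z → out z v))) (∑₂-swap _))))
            inner≤cols : inner ≤ cols
            inner≤cols = ∑₂-mono λ u v → *-monoˡ-≤ (ρ u v) (⟦⟧-mono (proj₂ ∘ ∧-true {S u} {S v}))
            rows≤ : rows ≤ inner + cut K S
            rows≤ = ≤-trans (≤-reflexive (trans (∑₂-cong λ u v → split (S u) (S v) (ρ u v)) (∑₂-+ _ _)))
              (+-monoʳ-≤ inner (cut-mono (λ u v → ≤-trans (below (vertex u) (vertex v)) (≤-reflexive (net-vv u v))) S))
              where
              split : ∀ a b x → ⟦ a ⟧ * x ≡ ⟦ a ∧ b ⟧ * x + ⟦ a ∧ not b ⟧ * x
              split true  true  x = sym (+-identityʳ _)
              split true  false x = refl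
              split false b     x = refl

    opaque
      demand : Demand s t
      demand with least-cut
      ... | S₀ , cut₀ , min₀ with Supply.minimise _ _ (∑₂ net) net ≤-refl (feasible (cut net S₀) S₀ cut₀ refl min₀)
      ...   | r , below , feas , crit = demand-of (cut net S₀) S₀ cut₀ refl min₀ r below feas crit

-- Expander decomposition

Symmetric : ∀ {n} → Graph n → Set
Symmetric E = ∀ u v → E u v ≡ E v u

≡ᵇ-elim : ∀ {m n} → (m ≡ᵇ n) ≡ true → m ≡ n
≡ᵇ-elim e = ≡ᵇ⇒≡ _ _ (≡true⇒T e)

≡ᵇ-intro : ∀ {m n} → m ≡ n → (m ≡ᵇ n) ≡ true
≡ᵇ-intro e = T⇒≡true (≡⇒≡ᵇ _ _ e)

≡ᵇ-sym : ∀ m n → (m ≡ᵇ n) ≡ (n ≡ᵇ m)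
≡ᵇ-sym zero    zero    = refl
≡ᵇ-sym zero    (suc n) = refl
≡ᵇ-sym (suc m) zero    = refl
≡ᵇ-sym (suc m) (suc n) = ≡ᵇ-sym m n

cut-swap : ∀ {n} (E : Graph n) → Symmetric E → ∀ (P : VSet n) → ∑₂ (λ u v → ⟦ P v ∧ not (P u) ⟧ * ⟪ E ⟫ u v) ≡ cut ⟪ E ⟫ P
cut-swap E sym-E P = trans (∑₂-swap _) (∑₂-cong λ u v → cong (λ b → ⟦ P u ∧ not (P v) ⟧ * ⟦ b ⟧) (sym-E v u))

module Expander {n : ℕ} (Γ : ℕ) (E : Graph n) (sym-E : Symmetric E) where

  degree : Fin n → ℕ
  degree v = ∑ (⟪ E ⟫ v)

  Labelling : Set
  Labelling = Fin n → ℕ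

  cluster : Labelling → ℕ → VSet n
  cluster κ c v = κ v ≡ᵇ c

  within across : Labelling → Graph n
  within κ u v = E u v ∧ (κ u ≡ᵇ κ v)
  across κ u v = E u v ∧ not (κ u ≡ᵇ κ v)

  within-sym : ∀ κ → Symmetric (within κ)
  within-sym κ u v = cong₂ _∧_ (sym-E u v) (≡ᵇ-sym (κ u) (κ v))

  across-sym : ∀ κ → Symmetric (across κ)
  across-sym κ u v = cong₂ (λ a b → a ∧ not b) (sym-E u v) (≡ᵇ-sym (κ u) (κ v))

  -- Volumes count degrees in all of `E`, including edges that leave the cluster, so they stay fixed
  -- while clusters are being split. These degrees later serve as capacities of the star.
  Expanding : Labelling → Set
  Expanding κ = ∀ v S → 2 * mass degree (S ∩ cluster κ (κ v)) ≤ mass degree (cluster κ (κ v)) →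
    mass degree (S ∩ cluster κ (κ v)) ≤ Γ * cut ⟪ within κ ⟫ (S ∩ cluster κ (κ v))

  potential : Labelling → ℕ
  potential κ = ∑ λ v → degree v * ⌊log₂ mass degree (cluster κ (κ v)) ⌋

  -- Every edge across clusters is priced at `Γ`. The factor 2 reflects that `across` counts both
  -- orientations: a split adds up to twice the cut, while the potential falls by the volume split
  -- off.
  Ω : Labelling → ℕ
  Ω κ = Γ * ∑₂ ⟪ across κ ⟫ + 2 * potential κ

  -- Cutting a sparse set P off its cluster halves the volume around every vertex of P,
  -- which pays for the edges that are cut.
  module Split (κ : Labelling) (N : ℕ) (fresh : ∀ v → κ v < N) (c : ℕ) (S : VSet n)
               (small : 2 * mass degree (S ∩ cluster κ c) ≤ mass degree (cluster κ c))
               (sparse : Γ * cut ⟪ within κ ⟫ (S ∩ cluster κ c) < mass degree (S ∩ cluster κ c)) where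

    P : VSet n
    P = S ∩ cluster κ c

    κ' : Labelling
    κ' v = if P v then N else κ v

    κ'-in : ∀ {v} → P v ≡ true → κ' v ≡ N
    κ'-in e rewrite e = refl

    κ'-out : ∀ {v} → P v ≡ false → κ' v ≡ κ v
    κ'-out e rewrite e = refl

    κ'-fresh : ∀ v → κ' v < suc N
    κ'-fresh v with P v
    ... | true  = ≤-refl
    ... | false = m≤n⇒m≤1+n (fresh v)

    across-≤ : ∑₂ ⟪ across κ' ⟫ ≤ ∑₂ ⟪ across κ ⟫ + 2 * cut ⟪ within κ ⟫ P
    across-≤ = begin
      ∑₂ ⟪ across κ' ⟫                                ≤⟨ ∑₂-mono arc ⟩
      ∑₂ (λ u v → ⟪ across κ ⟫ u v + (⟦ P u ∧ not (P v) ⟧ * ⟪ within κ ⟫ u v + ⟦ P v ∧ not (P u) ⟧ * ⟪ within κ ⟫ u v)) ≡⟨ trans (∑₂-+ _ _) (cong (∑₂ ⟪ across κ ⟫ +_) (∑₂-+ _ _)) ⟩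
      ∑₂ ⟪ across κ ⟫ + (cut ⟪ within κ ⟫ P + ∑₂ (λ u v → ⟦ P v ∧ not (P u) ⟧ * ⟪ within κ ⟫ u v)) ≡⟨ cong (∑₂ ⟪ across κ ⟫ +_) (cong (cut ⟪ within κ ⟫ P +_) (trans (cut-swap (within κ) (within-sym κ) P) (sym (+-identityʳ _)))) ⟩
      ∑₂ ⟪ across κ ⟫ + 2 * cut ⟪ within κ ⟫ P         ∎
      where
      open ≤-Reasoning
      arc : ∀ u v → ⟪ across κ' ⟫ u v ≤ ⟪ across κ ⟫ u v + (⟦ P u ∧ not (P v) ⟧ * ⟪ within κ ⟫ u v + ⟦ P v ∧ not (P u) ⟧ * ⟪ within κ ⟫ u v)
      arc u v = go (E u v) (κ u ≡ᵇ κ v) refl (P u) (P v) refl refl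
        where
        go : ∀ e s → (κ u ≡ᵇ κ v) ≡ s → ∀ a b → P u ≡ a → P v ≡ b → ⟦ e ∧ not (κ' u ≡ᵇ κ' v) ⟧ ≤ ⟦ e ∧ not s ⟧ + (⟦ a ∧ not b ⟧ * ⟦ e ∧ s ⟧ + ⟦ b ∧ not a ⟧ * ⟦ e ∧ s ⟧)
        go false s     hs a     b     ha hb = z≤n
        go true  false hs a     b     ha hb = ≤-trans (⟦⟧≤1 (not (κ' u ≡ᵇ κ' v))) (m≤m+n 1 _)
        go true  true  hs true  true  ha hb = ≤-reflexive (cong (λ b → ⟦ not b ⟧) (≡ᵇ-intro (trans (κ'-in ha) (sym (κ'-in hb)))))
        go true  true  hs true  false ha hb = ⟦⟧≤1 (not (κ' u ≡ᵇ κ' v))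
        go true  true  hs false true  ha hb = ⟦⟧≤1 (not (κ' u ≡ᵇ κ' v))
        go true  true  hs false false ha hb = ≤-reflexive (cong (λ b → ⟦ not b ⟧) (≡ᵇ-intro (trans (κ'-out ha) (trans (≡ᵇ-elim hs) (sym (κ'-out hb))))))

    volume-in : ∀ v → P v ≡ true → mass degree (cluster κ' (κ' v)) ≤ mass degree P
    volume-in v pv = mass-⊆ degree λ w e → member w (P w) refl (trans (≡ᵇ-elim e) (κ'-in pv))
      where
      member : ∀ w b → P w ≡ b → κ' w ≡ N → P w ≡ true
      member w true  e _  = e
      member w false e e' = ⊥-elim (<-irrefl (trans (sym (κ'-out e)) e') (fresh w))

    volume-out : ∀ v → P v ≡ false → mass degree (cluster κ' (κ' v)) ≤ mass degree (cluster κ (κ v))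
    volume-out v pv = mass-⊆ degree λ w e → member w (P w) refl (trans (≡ᵇ-elim e) (κ'-out pv))
      where
      member : ∀ w b → P w ≡ b → κ' w ≡ κ v → (κ w ≡ᵇ κ v) ≡ true
      member w true  e e' = ⊥-elim (<-irrefl (trans (sym e') (κ'-in e)) (fresh v))
      member w false e e' = ≡ᵇ-intro (trans (sym (κ'-out e)) e')

    potential-drops : potential κ' + mass degree P ≤ potential κ
    potential-drops = ≤-trans (≤-reflexive (sym (∑-+ _ _))) (∑-mono λ v → drop v (P v) refl)
      where
      open ≤-Reasoning
      positive : NonZero (mass degree P)
      positive = >-nonZero (≤-trans (s≤s z≤n) sparse)
      drop : ∀ v b → P v ≡ b → degree v * ⌊log₂ mass degree (cluster κ' (κ' v)) ⌋ + ⟦ b ⟧ * degree v ≤ degree v * ⌊log₂ mass degree (cluster κ (κ v)) ⌋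
      drop v true e = begin
        degree v * ⌊log₂ mass degree (cluster κ' (κ' v)) ⌋ + 1 * degree v ≤⟨ +-monoˡ-≤ (1 * degree v) (*-monoʳ-≤ (degree v) (⌊log₂⌋-mono-≤ (volume-in v e))) ⟩
        degree v * ⌊log₂ mass degree P ⌋ + 1 * degree v       ≡⟨ arith (degree v) ⌊log₂ mass degree P ⌋ ⟩
        degree v * (1 + ⌊log₂ mass degree P ⌋)                ≡⟨ cong (degree v *_) (⌊log₂[2*b]⌋≡1+⌊log₂b⌋ (mass degree P) {{positive}}) ⟨
        degree v * ⌊log₂ 2 * mass degree P ⌋                  ≤⟨ *-monoʳ-≤ (degree v) (⌊log₂⌋-mono-≤ small) ⟩
        degree v * ⌊log₂ mass degree (cluster κ c) ⌋          ≡⟨ cong (λ x → degree v * ⌊log₂ mass degree (cluster κ x) ⌋) (≡ᵇ-elim (proj₂ (∧-true {S v} e))) ⟨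
        degree v * ⌊log₂ mass degree (cluster κ (κ v)) ⌋      ∎
        where
        arith : ∀ d l → d * l + 1 * d ≡ d * (1 + l)
        arith = solve-∀
      drop v false e = ≤-trans (≤-reflexive (+-identityʳ _)) (*-monoʳ-≤ (degree v) (⌊log₂⌋-mono-≤ (volume-out v e)))

    Ω-drops : Ω κ' < Ω κ
    Ω-drops = begin-strict
      Γ * ∑₂ ⟪ across κ' ⟫ + 2 * potential κ'            ≤⟨ +-monoˡ-≤ _ (*-monoʳ-≤ Γ across-≤) ⟩
      Γ * (∑₂ ⟪ across κ ⟫ + 2 * cut ⟪ within κ ⟫ P) + 2 * potential κ' ≡⟨ arith Γ (∑₂ ⟪ across κ ⟫) (cut ⟪ within κ ⟫ P) (potential κ') ⟩
      Γ * ∑₂ ⟪ across κ ⟫ + 2 * (potential κ' + Γ * cut ⟪ within κ ⟫ P) <⟨ +-monoʳ-< (Γ * ∑₂ ⟪ across κ ⟫) (*-monoʳ-< 2 (+-monoʳ-< (potential κ') sparse)) ⟩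
      Γ * ∑₂ ⟪ across κ ⟫ + 2 * (potential κ' + mass degree P) ≤⟨ +-monoʳ-≤ (Γ * ∑₂ ⟪ across κ ⟫) (*-monoʳ-≤ 2 potential-drops) ⟩
      Ω κ ∎
      where
      open ≤-Reasoning
      arith : ∀ g x y z → g * (x + 2 * y) + 2 * z ≡ g * x + 2 * (z + g * y)
      arith = solve-∀

  refine : ∀ k κ N → (∀ v → κ v < N) → Ω κ ≤ k → ∃ λ κ' → Expanding κ' × Ω κ' ≤ Ω κ
  refine k κ N fresh le with findFin (λ v → violation v)
    where
    Violation : Fin n → Set
    Violation v = ∃ λ S → 2 * mass degree (S ∩ cluster κ (κ v)) ≤ mass degree (cluster κ (κ v)) ×
                          Γ * cut ⟪ within κ ⟫ (S ∩ cluster κ (κ v)) < mass degree (S ∩ cluster κ (κ v))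
    violation : ∀ v → Violation v ⊎ (∀ S → 2 * mass degree (S ∩ cluster κ (κ v)) ≤ mass degree (cluster κ (κ v)) →
      mass degree (S ∩ cluster κ (κ v)) ≤ Γ * cut ⟪ within κ ⟫ (S ∩ cluster κ (κ v)))
    violation v with search bad ext
      where
      bad : VSet n → Bool
      bad S = not (mass degree (cluster κ (κ v)) <ᵇ 2 * mass degree (S ∩ cluster κ (κ v))) ∧ (Γ * cut ⟪ within κ ⟫ (S ∩ cluster κ (κ v)) <ᵇ mass degree (S ∩ cluster κ (κ v)))
      ∩-cong : ∀ {S T : VSet n} → S ≗ T → (S ∩ cluster κ (κ v)) ≗ (T ∩ cluster κ (κ v))
      ∩-cong h w = cong (_∧ cluster κ (κ v) w) (h w)
      ext : Extensional bad
      ext h = cong₂ (λ a b → not (mass degree (cluster κ (κ v)) <ᵇ 2 * a) ∧ (Γ * b <ᵇ a)) (mass-cong degree (∩-cong h)) (cut-cong ⟪ within κ ⟫ (∩-cong h))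
    ... | inj₁ (S , e) = inj₁ (S , <ᵇ-false (not-true (proj₁ (∧-true e))) , <ᵇ-elim (proj₂ (∧-true {not (mass degree (cluster κ (κ v)) <ᵇ 2 * mass degree (S ∩ cluster κ (κ v)))} e)))
    ... | inj₂ none = inj₂ λ S small → <ᵇ-false (subst (λ b → not b ∧ (Γ * cut ⟪ within κ ⟫ (S ∩ cluster κ (κ v)) <ᵇ mass degree (S ∩ cluster κ (κ v))) ≡ false) (≤⇒<ᵇ-false small) (none S))
  ... | inj₂ expanding = κ , expanding , ≤-refl
  refine zero    κ N fresh le | inj₁ (v , S , small , sparse) = ⊥-elim (n≮0 (<-≤-trans (Split.Ω-drops κ N fresh (κ v) S small sparse) le))
  refine (suc k) κ N fresh le | inj₁ (v , S , small , sparse)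
    with refine k (Split.κ' κ N fresh (κ v) S small sparse) (suc N) (Split.κ'-fresh κ N fresh (κ v) S small sparse) (≤-pred (<-≤-trans (Split.Ω-drops κ N fresh (κ v) S small sparse) le))
  ... | κ' , expanding , le' = κ' , expanding , ≤-trans le' (<⇒≤ (Split.Ω-drops κ N fresh (κ v) S small sparse))

  -- Refinement starts from one cluster, where nothing is across and the potential is `M log M` with
  -- `M` the sum of all degrees. As `Ω` never grows, this start value bounds the final price of the
  -- edges across.
  decomposition : ∃ λ κ → Expanding κ × Γ * ∑₂ ⟪ across κ ⟫ ≤ 2 * (∑₂ ⟪ E ⟫ * ⌊log₂ ∑₂ ⟪ E ⟫ ⌋)
  decomposition = bound (refine (Ω (λ _ → 0)) (λ _ → 0) 1 (λ _ → s≤s z≤n) ≤-refl)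
    where
    open ≤-Reasoning
    trivial : Ω (λ _ → 0) ≡ 2 * (∑₂ ⟪ E ⟫ * ⌊log₂ ∑₂ ⟪ E ⟫ ⌋)
    trivial = cong₂ _+_ (trans (cong (Γ *_) (∑-zero λ u → ∑-zero λ v → cong ⟦_⟧ (∧-comm (E u v) false))) (*-zeroʳ Γ))
      (cong (2 *_) (trans (∑-cong λ v → trans (cong (λ x → degree v * ⌊log₂ x ⌋) (mass-full degree)) (*-comm (degree v) _)) (trans (∑-*ˡ ⌊log₂ ∑₂ ⟪ E ⟫ ⌋ degree) (*-comm ⌊log₂ ∑₂ ⟪ E ⟫ ⌋ (∑₂ ⟪ E ⟫)))))
    bound : (∃ λ κ → Expanding κ × Ω κ ≤ Ω (λ _ → 0)) → ∃ λ κ → Expanding κ × Γ * ∑₂ ⟪ across κ ⟫ ≤ 2 * (∑₂ ⟪ E ⟫ * ⌊log₂ ∑₂ ⟪ E ⟫ ⌋)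
    bound (κ , expanding , le) = κ , expanding , ≤-trans (m≤m+n _ _) (≤-trans le (≤-reflexive trivial))

-- From clusters to pieces of the graph

module Representative {n : ℕ} (κ : Fin n → ℕ) where

  pick : ∀ c → Fin n → (∃ λ w → (κ w ≡ᵇ c) ≡ true) ⊎ (∀ w → (κ w ≡ᵇ c) ≡ false) → Fin n
  pick c v (inj₁ (w , _)) = w
  pick c v (inj₂ _)       = v

  -- The numbers in `κ` grow with every split. Naming a cluster by one of its vertices, chosen from
  -- the value of `κ` alone, lets a label be sent in `b` bits.
  label : Fin n → Fin n
  label v = pick (κ v) v (searchFin λ w → κ w ≡ᵇ κ v)

  κ-label : ∀ v → κ (label v) ≡ κ v
  κ-label v with searchFin (λ w → κ w ≡ᵇ κ v)
  ... | inj₁ (w , e) = ≡ᵇ-elim e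
  ... | inj₂ _       = refl

  label-cong : ∀ {u v} → κ u ≡ κ v → label u ≡ label v
  label-cong {u} {v} eq rewrite eq with searchFin (λ w → κ w ≡ᵇ κ v)
  ... | inj₁ (w , e) = refl
  ... | inj₂ none    = ⊥-elim (true≢false (≡ᵇ-intro {κ v} refl) (none v))

  label-sound : ∀ {u v} → label u ≡ label v → κ u ≡ κ v
  label-sound {u} {v} eq = trans (sym (κ-label u)) (trans (cong κ eq) (κ-label v))

  label-≡ᵇ : ∀ u v → eqF (label u) (label v) ≡ (κ u ≡ᵇ κ v)
  label-≡ᵇ u v with κ u ≡ᵇ κ v in e
  ... | true  = trans (cong (eqF (label u)) (sym (label-cong (≡ᵇ-elim e)))) (eqF-refl (label u))
  ... | false = ≢true λ e' → true≢false (≡ᵇ-intro (label-sound (eqF-sound e'))) e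

-- The star with leaf capacities `w` overestimates every cut of the piece, but by at most `Γ`. The
-- lower side keeps the value of the public network at least `ν`; the upper side keeps it `O(Γ ν)`
-- and makes demands through the star routable in the piece.
record Piece {n : ℕ} (Γ : ℕ) (C : VSet n) (w : Fin n → ℕ) (E : Graph n) : Set where
  field
    inside    : ∀ u v → E u v ≡ true → C u ≡ true × C v ≡ true
    expands   : ∀ S → mass w S ⊓ mass w (∁ S) ≤ Γ * cut ⟪ E ⟫ S
    dominates : ∀ S → cut ⟪ E ⟫ S ≤ mass w S ⊓ mass w (∁ S)

clusterOf : ∀ {n} → (Fin n → Fin n) → Fin n → VSet n
clusterOf label c v = eqF c (label v)

restrict : ∀ {n} → VSet n → (Fin n → ℕ) → Fin n → ℕ
restrict C d v = ⟦ C v ⟧ * d v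

module Pieces {n : ℕ} (Γ : ℕ) (E : Graph n) (sym-E : Symmetric E) (κ : Fin n → ℕ)
              (expanding : Expander.Expanding Γ E sym-E κ) where

  open Expander Γ E sym-E
  open Representative κ

  piece : Fin n → Graph n
  piece c u v = clusterOf label c u ∧ (E u v ∧ clusterOf label c v)

  weight : Fin n → Fin n → ℕ
  weight c = restrict (clusterOf label c) degree

  piece-sum : ∀ u v → ∑ (λ c → ⟪ piece c ⟫ u v) ≡ ⟪ within κ ⟫ u v
  piece-sum u v = trans (∑-cong λ c → split (eqF c (label u)) (E u v ∧ eqF c (label v)))
    (trans (∑-single (label u) λ c → ⟦ E u v ∧ eqF c (label v) ⟧) (cong (λ b → ⟦ E u v ∧ b ⟧) (label-≡ᵇ u v)))
    where
    split : ∀ a b → ⟦ a ∧ b ⟧ ≡ ⟦ a ⟧ * ⟦ b ⟧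
    split true  b = sym (+-identityʳ _)
    split false b = refl

  piece-sym : ∀ c → Symmetric (piece c)
  piece-sym c u v = trans (cong (λ e → clusterOf label c u ∧ (e ∧ clusterOf label c v)) (sym-E u v)) (comm (clusterOf label c u) (E v u) (clusterOf label c v))
    where
    comm : ∀ a b c → a ∧ (b ∧ c) ≡ c ∧ (b ∧ a)
    comm true  true  true  = refl
    comm true  true  false = refl
    comm true  false true  = refl
    comm true  false false = refl
    comm false true  true  = refl
    comm false true  false = refl
    comm false false true  = refl
    comm false false false = refl

  weighted : ∀ c S → mass (weight c) S ≡ mass degree (S ∩ clusterOf label c)
  weighted c S = ∑-cong λ v → assoc (S v) (clusterOf label c v) (degree v)
    where
    assoc : ∀ a b x → ⟦ a ⟧ * (⟦ b ⟧ * x) ≡ ⟦ a ∧ b ⟧ * x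
    assoc true  b x = *-identityˡ _
    assoc false b x = refl

  isPiece : ∀ c → Piece Γ (clusterOf label c) (weight c) (piece c)
  isPiece c = record { inside = inside ; expands = expands ; dominates = dominates }
    where
    open ≤-Reasoning
    C : VSet n
    C = clusterOf label c
    inside : ∀ u v → piece c u v ≡ true → C u ≡ true × C v ≡ true
    inside u v e = proj₁ (∧-true e) , proj₂ (∧-true {E u v} (proj₂ (∧-true {C u} e)))
    tails : ∀ S → cut ⟪ piece c ⟫ S ≤ mass (weight c) S
    tails S = ∑-mono λ u → ≤-trans (∑-mono λ v → arc (S u) (S v) (C u) (E u v) (C v))
        (≤-reflexive (trans (∑-*ˡ ⟦ S u ⟧ _) (cong (⟦ S u ⟧ *_) (∑-*ˡ ⟦ C u ⟧ _))))
      where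
      arc : ∀ a b x e y → ⟦ a ∧ not b ⟧ * ⟦ x ∧ (e ∧ y) ⟧ ≤ ⟦ a ⟧ * (⟦ x ⟧ * ⟦ e ⟧)
      arc false b     x     e     y = z≤n
      arc true  true  x     e     y = z≤n
      arc true  false false e     y = z≤n
      arc true  false true  false y = z≤n
      arc true  false true  true  y = ≤-trans (⟦⟧*≤ true ⟦ y ⟧) (⟦⟧≤1 y)
    heads : ∀ S → cut ⟪ piece c ⟫ S ≤ cut ⟪ piece c ⟫ (∁ S)
    heads S = ≤-trans (≤-reflexive (sym (cut-swap (piece c) (piece-sym c) S))) (∑₂-mono λ u v → *-monoˡ-≤ (⟪ piece c ⟫ u v) (flip (S u) (S v)))
      where
      flip : ∀ a b → ⟦ b ∧ not a ⟧ ≤ ⟦ not a ∧ not (not b) ⟧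
      flip true  true  = z≤n
      flip true  false = z≤n
      flip false true  = ≤-refl
      flip false false = z≤n
    dominates : ∀ S → cut ⟪ piece c ⟫ S ≤ mass (weight c) S ⊓ mass (weight c) (∁ S)
    dominates S = ⊓-glb (tails S) (≤-trans (heads S) (tails (∁ S)))
    expand-at : ∀ v₀ → c ≡ label v₀ → ∀ S → 2 * mass (weight c) S ≤ mass degree C → mass (weight c) S ≤ Γ * cut ⟪ piece c ⟫ S
    expand-at v₀ e₀ S small = begin
      mass (weight c) S                 ≡⟨ trans (weighted c S) (mass-cong degree same) ⟩
      mass degree P                     ≤⟨ expanding v₀ S (≤-trans (≤-reflexive (cong (2 *_) (sym (trans (weighted c S) (mass-cong degree same))))) (≤-trans small (≤-reflexive (mass-cong degree C≗)))) ⟩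
      Γ * cut ⟪ within κ ⟫ P            ≤⟨ *-monoʳ-≤ Γ (∑₂-mono λ u v → arc u v) ⟩
      Γ * cut ⟪ piece c ⟫ S             ∎
      where
      C≗ : C ≗ cluster κ (κ v₀)
      C≗ v = trans (cong (λ x → eqF x (label v)) e₀) (trans (label-≡ᵇ v₀ v) (≡ᵇ-sym (κ v₀) (κ v)))
      P : VSet n
      P = S ∩ cluster κ (κ v₀)
      same : (S ∩ C) ≗ P
      same v = cong (S v ∧_) (C≗ v)
      arc : ∀ u v → ⟦ P u ∧ not (P v) ⟧ * ⟪ within κ ⟫ u v ≤ ⟦ S u ∧ not (S v) ⟧ * ⟪ piece c ⟫ u v
      arc u v = go (S u) (κ u ≡ᵇ κ v₀) refl (S v) (κ v ≡ᵇ κ v₀) refl (E u v) (κ u ≡ᵇ κ v) refl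
        where
        go : ∀ a x → (κ u ≡ᵇ κ v₀) ≡ x → ∀ b y → (κ v ≡ᵇ κ v₀) ≡ y → ∀ e s → (κ u ≡ᵇ κ v) ≡ s →
          ⟦ (a ∧ x) ∧ not (b ∧ y) ⟧ * ⟦ e ∧ s ⟧ ≤ ⟦ a ∧ not b ⟧ * ⟦ C u ∧ (e ∧ C v) ⟧
        go false x     hx b y hy e s hs = z≤n
        go true  false hx b y hy e s hs = z≤n
        go true  true  hx b y hy false s hs = ≤-trans (≤-reflexive (*-zeroʳ ⟦ true ∧ not (b ∧ y) ⟧)) z≤n
        go true  true  hx b y hy true false hs = ≤-trans (≤-reflexive (*-zeroʳ ⟦ true ∧ not (b ∧ y) ⟧)) z≤n
        go true  true  hx b false hy true true hs = ⊥-elim (true≢false (≡ᵇ-intro (trans (sym (≡ᵇ-elim {κ u} {κ v} hs)) (≡ᵇ-elim hx))) hy)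
        go true  true  hx b true hy true true hs rewrite trans (C≗ u) hx | trans (C≗ v) hy = ≤-reflexive (cong (λ z → ⟦ not z ⟧ * 1) (∧-identityʳ b))
    empty : (∀ v → C v ≡ false) → ∀ S → mass (weight c) S ≡ 0
    empty none S = ∑-zero λ v → trans (cong (λ b → ⟦ S v ⟧ * (⟦ b ⟧ * degree v)) (none v)) (*-zeroʳ ⟦ S v ⟧)
    halves : ∀ S → mass (weight c) S + mass (weight c) (∁ S) ≡ mass degree C
    halves = mass-∁ (weight c)
    half : ∀ {a b m} → a + b ≡ m → a ≤ b → 2 * a ≤ m
    half {a} {b} refl le = +-monoʳ-≤ a (≤-trans (≤-reflexive (+-identityʳ a)) le)
    expands : ∀ S → mass (weight c) S ⊓ mass (weight c) (∁ S) ≤ Γ * cut ⟪ piece c ⟫ S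
    -- A name borne by no cluster has weight zero. Otherwise expansion applies to whichever of `S`
    -- and its complement has at most half of the volume; symmetry gives both the same cut.
    expands S with searchFin C
    ... | inj₂ none = ≤-trans (m⊓n≤m _ _) (≤-trans (≤-reflexive (empty none S)) z≤n)
    ... | inj₁ (v₀ , e₀) with ≤-total (mass (weight c) S) (mass (weight c) (∁ S))
    ...   | inj₁ le = ≤-trans (m⊓n≤m _ _) (expand-at v₀ (eqF-sound e₀) S (half (halves S) le))
    ...   | inj₂ ge = ≤-trans (m⊓n≤n (mass (weight c) S) _) (≤-trans (expand-at v₀ (eqF-sound e₀) (∁ S) (half (trans (+-comm (mass (weight c) (∁ S)) _) (halves S)) ge))
                      (*-monoʳ-≤ Γ (≤-trans (heads (∁ S)) (≤-reflexive (cut-cong ⟪ piece c ⟫ λ v → not-involutive (S v))))))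

-- Hierarchies of clusters

record Hierarchy {n : ℕ} (Γ j : ℕ) (E : Graph n) : Set where
  field
    label     : Fin j → Fin n → Fin n
    degrees   : Fin j → Fin n → ℕ
    pieces    : Fin j → Fin n → Graph n
    degrees≤  : ∀ l v → degrees l v ≤ n
    isPiece   : ∀ l c → Piece Γ (clusterOf (label l) c) (restrict (clusterOf (label l) c) (degrees l)) (pieces l c)
    partition : ∀ u v → ∑ (λ l → ∑ λ c → ⟪ pieces l c ⟫ u v) ≡ ⟪ E ⟫ u v

module Levels {n : ℕ} (b : ℕ) (b>0 : 0 < b) (n≤ : n ≤ 2 ^ b) where

  -- With `M ≤ 2 ^ (b + b)` arcs the start value of `Ω` is at most `4 * b * M`, so the price `8 * b`
  -- leaves at most `M / 2` arcs across.
  Γ₀ : ℕ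
  Γ₀ = 8 * b

  -- The arcs across clusters form the graph of the next level. Their number at least halves each
  -- time, so fewer than `2 ^ j` arcs are used up after `j` levels.
  levels : ∀ j (E : Graph n) → Symmetric E → ∑₂ ⟪ E ⟫ ≤ 2 ^ (b + b) → ∑₂ ⟪ E ⟫ < 2 ^ j → Hierarchy Γ₀ j E
  levels zero E sym-E le lt = record
    { label = λ () ; degrees = λ () ; pieces = λ () ; degrees≤ = λ () ; isPiece = λ ()
    ; partition = λ u v → trans (∑-zero λ ()) (sym (n≤0⇒n≡0 (≤-trans (term≤∑₂ ⟪ E ⟫ u v) (≤-pred lt)))) }
  levels (suc j) E sym-E le lt = build (Expander.decomposition Γ₀ E sym-E)
    where
    open Expander Γ₀ E sym-E
    build : (∃ λ κ → Expanding κ × Γ₀ * ∑₂ ⟪ across κ ⟫ ≤ 2 * (∑₂ ⟪ E ⟫ * ⌊log₂ ∑₂ ⟪ E ⟫ ⌋)) → Hierarchy Γ₀ (suc j) E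
    build (κ , expanding , few) = record
      { label     = λ { zero → R.label ; (suc l) → H.label l }
      ; degrees   = λ { zero → degree ; (suc l) → H.degrees l }
      ; pieces    = λ { zero → R.piece ; (suc l) → H.pieces l }
      ; degrees≤  = λ { zero v → ≤-trans (∑-≤ _ {1} λ u → ⟦⟧≤1 (E v u)) (≤-reflexive (*-identityʳ n)) ; (suc l) → H.degrees≤ l }
      ; isPiece   = λ { zero → R.isPiece ; (suc l) → H.isPiece l }
      ; partition = λ u v → trans (∑-suc _) (trans (cong₂ _+_ (R.piece-sum u v) (H.partition u v)) (rejoin (E u v) (κ u ≡ᵇ κ v)))
      }
      where
      rejoin : ∀ e s → ⟦ e ∧ s ⟧ + ⟦ e ∧ not s ⟧ ≡ ⟦ e ⟧
      rejoin true  true  = refl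
      rejoin true  false = refl
      rejoin false s     = refl
      open ≤-Reasoning
      M X : ℕ
      M = ∑₂ ⟪ E ⟫
      X = ∑₂ ⟪ across κ ⟫
      halved : 2 * X ≤ M
      halved = *-cancelˡ-≤ (4 * b) {{>-nonZero (*-mono-≤ {1} {4} (s≤s z≤n) b>0)}} (begin
        4 * b * (2 * X)                ≡⟨ arith₁ b X ⟩
        8 * b * X                      ≤⟨ few ⟩
        2 * (M * ⌊log₂ M ⌋)            ≤⟨ *-monoʳ-≤ 2 (*-monoʳ-≤ M (≤-trans (⌊log₂⌋-mono-≤ le) (≤-reflexive (⌊log₂[2^n]⌋≡n (b + b))))) ⟩
        2 * (M * (b + b))              ≡⟨ arith₂ M b ⟩
        4 * b * M                      ∎)
        where
        arith₁ : ∀ b x → 4 * b * (2 * x) ≡ 8 * b * x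
        arith₁ = solve-∀
        arith₂ : ∀ m b → 2 * (m * (b + b)) ≡ 4 * b * m
        arith₂ = solve-∀
      module R where
        open Representative κ public
        open Pieces Γ₀ E sym-E κ expanding public
      module H = Hierarchy (levels j (across κ) (across-sym κ)
        (≤-trans (≤-trans (m≤n*m X 2) halved) le)
        (*-cancelˡ-< 2 X (2 ^ j) (≤-<-trans halved lt)))

  opaque
    hierarchy : (E : Graph n) → Symmetric E → Hierarchy Γ₀ (suc (b + b)) E
    hierarchy E sym-E = levels (suc (b + b)) E sym-E edges (≤-<-trans edges (^-monoʳ-< 2 (s≤s (s≤s z≤n)) (n<1+n (b + b))))
      where
      edges : ∑₂ ⟪ E ⟫ ≤ 2 ^ (b + b)
      edges = ≤-trans (∑-≤ _ λ u → ∑-≤ _ {1} λ v → ⟦⟧≤1 (E u v)) (≤-trans (*-mono-≤ n≤ (≤-trans (≤-reflexive (*-identityʳ n)) n≤)) (≤-reflexive (sym (^-distribˡ-+-* 2 b b))))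

-- Messages

data Player : Set where
  first second : Player

module Messages {X : Set} where

  input : Player → X → X → X
  input first  x y = x
  input second x y = y

  ask : ∀ {O} → Player → (X → Bool) → Protocol X X O → Protocol X X O → Protocol X X O
  ask first  = alice
  ask second = bob

  infixl 1 _>>=_
  _>>=_ : ∀ {O O'} → Protocol X X O → (O → Protocol X X O') → Protocol X X O'
  leaf o      >>= k = k o
  alice f P Q >>= k = alice f (P >>= k) (Q >>= k)
  bob f P Q   >>= k = bob f (P >>= k) (Q >>= k)

  run->>= : ∀ {O O'} (P : Protocol X X O) (k : O → Protocol X X O') x y → run (P >>= k) x y ≡ run (k (run P x y)) x y
  run->>= (leaf o)      k x y = refl
  run->>= (alice f P Q) k x y with f x
  ... | true  = run->>= P k x y
  ... | false = run->>= Q k x y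
  run->>= (bob f P Q)   k x y with f y
  ... | true  = run->>= P k x y
  ... | false = run->>= Q k x y

  cost->>= : ∀ {O O'} (P : Protocol X X O) (k : O → Protocol X X O') x y → cost (P >>= k) x y ≡ cost P x y + cost (k (run P x y)) x y
  cost->>= (leaf o)      k x y = refl
  cost->>= (alice f P Q) k x y with f x
  ... | true  = cong suc (cost->>= P k x y)
  ... | false = cong suc (cost->>= Q k x y)
  cost->>= (bob f P Q)   k x y with f y
  ... | true  = cong suc (cost->>= P k x y)
  ... | false = cong suc (cost->>= Q k x y)

  run-ask : ∀ {O} π (f : X → Bool) (P Q : Protocol X X O) x y →
    run (ask π f P Q) x y ≡ (if f (input π x y) then run P x y else run Q x y)
  run-ask first  f P Q x y = refl
  run-ask second f P Q x y = refl

  cost-ask : ∀ {O} π (f : X → Bool) (P Q : Protocol X X O) x y →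
    cost (ask π f P Q) x y ≡ suc (if f (input π x y) then cost P x y else cost Q x y)
  cost-ask first  f P Q x y = refl
  cost-ask second f P Q x y = refl

  module _ {O : Set} (π : Player) (f : X → Bool) (P Q : Protocol X X O) (x y : X) where

    run-ask-true : f (input π x y) ≡ true → run (ask π f P Q) x y ≡ run P x y
    run-ask-true e = trans (run-ask π f P Q x y) (cong (λ b → if b then run P x y else run Q x y) e)

    run-ask-false : f (input π x y) ≡ false → run (ask π f P Q) x y ≡ run Q x y
    run-ask-false e = trans (run-ask π f P Q x y) (cong (λ b → if b then run P x y else run Q x y) e)

    cost-ask-true : f (input π x y) ≡ true → cost (ask π f P Q) x y ≡ suc (cost P x y)
    cost-ask-true e = trans (cost-ask π f P Q x y) (cong (λ b → suc (if b then cost P x y else cost Q x y)) e)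

    cost-ask-false : f (input π x y) ≡ false → cost (ask π f P Q) x y ≡ suc (cost Q x y)
    cost-ask-false e = trans (cost-ask π f P Q x y) (cong (λ b → suc (if b then cost P x y else cost Q x y)) e)

  sendNum : Player → ℕ → (X → ℕ) → Protocol X X ℕ
  sendNum π zero    f = leaf 0
  sendNum π (suc b) f = ask π (λ x → not (f x <ᵇ 2 ^ b))
    (sendNum π b (λ x → f x ∸ 2 ^ b) >>= λ m → leaf (m + 2 ^ b))
    (sendNum π b f)

  run-sendNum : ∀ π b f x y → f (input π x y) < 2 ^ b → run (sendNum π b f) x y ≡ f (input π x y)
  run-sendNum π zero    f x y lt = sym (n≤0⇒n≡0 (≤-pred lt))
  run-sendNum π (suc b) f x y lt with f (input π x y) <ᵇ 2 ^ b in e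
  ... | true  = trans (run-ask-false π _ _ _ x y (cong not e)) (run-sendNum π b f x y (<ᵇ-elim {f (input π x y)} {2 ^ b} e))
  ... | false = trans (run-ask-true π _ _ _ x y (cong not e)) (trans (run->>= (sendNum π b (λ x → f x ∸ 2 ^ b)) _ x y)
      (trans (cong (_+ 2 ^ b) (run-sendNum π b (λ x → f x ∸ 2 ^ b) x y (+-cancelʳ-< (2 ^ b) _ _ (≤-<-trans (≤-reflexive restore) (<-≤-trans lt (≤-reflexive (cong (2 ^ b +_) (+-identityʳ _)))))))) restore))
    where
    restore : f (input π x y) ∸ 2 ^ b + 2 ^ b ≡ f (input π x y)
    restore = m∸n+n≡m (<ᵇ-false {f (input π x y)} {2 ^ b} e)

  cost-sendNum : ∀ π b f x y → cost (sendNum π b f) x y ≡ b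
  cost-sendNum π zero    f x y = refl
  cost-sendNum π (suc b) f x y with f (input π x y) <ᵇ 2 ^ b in e
  ... | true  = trans (cost-ask-false π _ _ _ x y (cong not e)) (cong suc (cost-sendNum π b f x y))
  ... | false = trans (cost-ask-true π _ _ _ x y (cong not e)) (cong suc (trans (cost->>= (sendNum π b (λ x → f x ∸ 2 ^ b)) _ x y) (trans (+-identityʳ _) (cost-sendNum π b _ x y))))

  cons : ∀ {A : Set} {N} → A → (Fin N → A) → Fin (suc N) → A
  cons a g zero    = a
  cons a g (suc i) = g i

  table : ∀ {A : Set} N → (Fin N → Protocol X X A) → Protocol X X (Fin N → A)
  tableFrom : ∀ {A : Set} N → (Fin N → Protocol X X A) → A → Protocol X X (Fin (suc N) → A)
  table zero    P = leaf λ ()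
  table (suc N) P = P zero >>= tableFrom N (P ∘ suc)
  tableFrom N P a = table N P >>= (leaf ∘ cons a)

  run-table : ∀ {A : Set} N (P : Fin N → Protocol X X A) x y i → run (table N P) x y i ≡ run (P i) x y
  run-table {A} (suc N) P x y i = trans (cong (λ (g : Fin (suc N) → A) → g i) (trans (run->>= (P zero) (tableFrom N (P ∘ suc)) x y)
      (run->>= (table N (P ∘ suc)) (leaf ∘ cons (run (P zero) x y)) x y))) (at i)
    where
    at : ∀ i → cons (run (P zero) x y) (run (table N (P ∘ suc)) x y) i ≡ run (P i) x y
    at zero    = refl
    at (suc i) = run-table N (P ∘ suc) x y i

  cost-table : ∀ {A : Set} N (P : Fin N → Protocol X X A) x y {c} → (∀ i → cost (P i) x y ≤ c) → cost (table N P) x y ≤ N * c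
  cost-table zero    P x y h = z≤n
  cost-table (suc N) P x y h = ≤-trans (≤-reflexive (trans (cost->>= (P zero) (tableFrom N (P ∘ suc)) x y)
      (cong (cost (P zero) x y +_) (trans (cost->>= (table N (P ∘ suc)) (leaf ∘ cons (run (P zero) x y)) x y) (+-identityʳ _)))))
    (+-mono-≤ (h zero) (cost-table N (P ∘ suc) x y (h ∘ suc)))

  -- Sending vertices, arcs and sets of arcs

  module Vertices {n : ℕ} (b : ℕ) (n≤ : n ≤ 2 ^ b) (default : Fin n) where

    decode : ℕ → Fin n
    decode m with m <? n
    ... | yes lt = fromℕ< lt
    -- Codes of `n` and above are never sent; the default makes decoding total.
    ... | no _   = default

    decode-toℕ : ∀ i → decode (toℕ i) ≡ i
    decode-toℕ i with toℕ i <? n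
    ... | yes lt = fromℕ<-toℕ i lt
    ... | no ≮   = ⊥-elim (≮ (toℕ<n i))

    sendFin : Player → (X → Fin n) → Protocol X X (Fin n)
    sendFin π f = sendNum π b (toℕ ∘ f) >>= (leaf ∘ decode)

    run-sendFin : ∀ π f x y → run (sendFin π f) x y ≡ f (input π x y)
    run-sendFin π f x y = trans (run->>= (sendNum π b (toℕ ∘ f)) (leaf ∘ decode) x y)
      (trans (cong decode (run-sendNum π b (toℕ ∘ f) x y (<-≤-trans (toℕ<n _) n≤))) (decode-toℕ _))

    cost-sendFin : ∀ π f x y → cost (sendFin π f) x y ≡ b
    cost-sendFin π f x y = trans (cost->>= (sendNum π b (toℕ ∘ f)) (leaf ∘ decode) x y) (trans (+-identityʳ _) (cost-sendNum π b (toℕ ∘ f) x y))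

    findArc : (G : Graph n) → (∃ λ u → ∃ λ v → G u v ≡ true) ⊎ (∀ u v → G u v ≡ false)
    findArc G = findFin λ u → searchFin (G u)

    anyArc : Graph n → Bool
    anyArc G = [ (λ _ → true) , (λ _ → false) ]′ (findArc G)

    someArc : Graph n → Fin n × Fin n
    someArc G = [ (λ (u , v , _) → u , v) , (λ _ → default , default) ]′ (findArc G)

    anyArc-true : ∀ G → anyArc G ≡ true → G (proj₁ (someArc G)) (proj₂ (someArc G)) ≡ true
    anyArc-true G e with findArc G
    ... | inj₁ (u , v , a) = a

    anyArc-false : ∀ G → anyArc G ≡ false → ∀ u v → G u v ≡ false
    anyArc-false G e with findArc G
    ... | inj₂ none = none

    sendArc : Player → (X → Fin n × Fin n) → Protocol X X (Fin n × Fin n)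
    sendArc π f = sendFin π (proj₁ ∘ f) >>= λ u → sendFin π (proj₂ ∘ f) >>= λ v → leaf (u , v)

    run-sendArc : ∀ π f x y → run (sendArc π f) x y ≡ f (input π x y)
    run-sendArc π f x y = trans (run->>= (sendFin π (proj₁ ∘ f)) _ x y) (trans (run->>= (sendFin π (proj₂ ∘ f)) _ x y)
      (cong₂ _,_ (run-sendFin π (proj₁ ∘ f) x y) (run-sendFin π (proj₂ ∘ f) x y)))

    cost-sendArc : ∀ π f x y → cost (sendArc π f) x y ≡ b + b
    cost-sendArc π f x y = trans (cost->>= (sendFin π (proj₁ ∘ f)) _ x y) (cong₂ _+_ (cost-sendFin π (proj₁ ∘ f) x y)
      (trans (cost->>= (sendFin π (proj₂ ∘ f)) _ x y) (trans (+-identityʳ _) (cost-sendFin π (proj₂ ∘ f) x y))))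

    single : Fin n × Fin n → Graph n
    single (a , b) u v = eqF u a ∧ eqF v b

    without : Fin n × Fin n → Graph n → Graph n
    without a G u v = G u v ∧ not (single a u v)

    adding : Fin n × Fin n → Graph n → Graph n
    adding a H u v = single a u v ∨ H u v

    silent : Protocol X X (Graph n)
    silent = leaf λ _ _ → false

    -- A bit before each arc tells whether one is left. Hence the cost follows the number of arcs
    -- actually sent, and the budget `k` only bounds the depth of the tree.
    reveal   : Player → ℕ → (X → Graph n) → Protocol X X (Graph n)
    continue : Player → ℕ → (X → Graph n) → Fin n × Fin n → Protocol X X (Graph n)
    reveal π zero    G = silent
    reveal π (suc k) G = ask π (anyArc ∘ G) (sendArc π (someArc ∘ G) >>= continue π k G) silent

    continue π k G a = reveal π k (without a ∘ G) >>= (leaf ∘ adding a)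

    ∑₂-without : ∀ a G → G (proj₁ a) (proj₂ a) ≡ true → ∑₂ ⟪ G ⟫ ≡ suc (∑₂ ⟪ without a G ⟫)
    ∑₂-without (a , b) G e = trans (∑₂-lower a b ⟪ G ⟫ (≤-reflexive (cong ⟦_⟧ (sym e)))) (trans (+-comm _ 1)
      (cong suc (∑₂-cong λ u v → diff (G u v) (single (a , b) u v) (arc u v))))
      where
      arc : ∀ u v → single (a , b) u v ≡ true → G u v ≡ true
      arc u v s with eqF-sound {i = u} (proj₁ (∧-true s)) | eqF-sound {i = v} (proj₂ (∧-true {eqF u a} s))
      ... | refl | refl = e
      diff : ∀ g s → (s ≡ true → g ≡ true) → ⟦ g ⟧ ∸ ⟦ s ⟧ ≡ ⟦ g ∧ not s ⟧
      diff true  true  h = refl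
      diff true  false h = refl
      diff false true  h = refl
      diff false false h = refl

    run-reveal : ∀ π k G x y → ∑₂ ⟪ G (input π x y) ⟫ ≤ k → ∀ u v → run (reveal π k G) x y u v ≡ G (input π x y) u v
    run-reveal π zero G x y le u v = sym (none (G (input π x y) u v) (≤-trans (term≤∑₂ ⟪ G (input π x y) ⟫ u v) le))
      where
      none : ∀ b → ⟦ b ⟧ ≤ 0 → b ≡ false
      none false _ = refl
    run-reveal π (suc k) G x y le u v with anyArc (G (input π x y)) in e
    ... | false = trans (cong (λ (H : Graph n) → H u v) (run-ask-false π (anyArc ∘ G) (sendArc π (someArc ∘ G) >>= continue π k G) silent x y e)) (sym (anyArc-false _ e u v))
    ... | true  = trans (cong (λ (H : Graph n) → H u v) (trans (run-ask-true π (anyArc ∘ G) (sendArc π (someArc ∘ G) >>= continue π k G) silent x y e) (trans (run->>= (sendArc π (someArc ∘ G)) (continue π k G) x y)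
        (run->>= (reveal π k (without (run (sendArc π (someArc ∘ G)) x y) ∘ G)) (leaf ∘ adding (run (sendArc π (someArc ∘ G)) x y)) x y))))
        (rest (run (sendArc π (someArc ∘ G)) x y) (run-sendArc π (someArc ∘ G) x y))
      where
      G₀ : Graph n
      G₀ = G (input π x y)
      rest : ∀ a → a ≡ someArc G₀ → single a u v ∨ run (reveal π k (without a ∘ G)) x y u v ≡ G₀ u v
      rest a refl = trans (cong (single a u v ∨_) (run-reveal π k (without a ∘ G) x y (≤-pred (≤-trans (≤-reflexive (sym (∑₂-without a G₀ (anyArc-true G₀ e)))) le)) u v))
          (rejoin (single a u v) refl)
        where
        rejoin : ∀ s → single a u v ≡ s → s ∨ (G₀ u v ∧ not (single a u v)) ≡ G₀ u v
        rejoin true  es with eqF-sound {i = u} (proj₁ (∧-true es)) | eqF-sound {i = v} (proj₂ (∧-true {eqF u (proj₁ a)} es))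
        ... | refl | refl = sym (anyArc-true G₀ e)
        rejoin false es = trans (cong (λ b → G₀ u v ∧ not b) es) (∧-identityʳ _)

    cost-reveal : ∀ π k G x y → cost (reveal π k G) x y ≤ ∑₂ ⟪ G (input π x y) ⟫ * suc (b + b) + 1
    cost-reveal π zero    G x y = z≤n
    cost-reveal π (suc k) G x y with anyArc (G (input π x y)) in e
    ... | false = ≤-trans (≤-reflexive (cost-ask-false π (anyArc ∘ G) (sendArc π (someArc ∘ G) >>= continue π k G) silent x y e)) (m≤n+m 1 _)
    ... | true  = ≤-trans (≤-reflexive (trans (cost-ask-true π (anyArc ∘ G) (sendArc π (someArc ∘ G) >>= continue π k G) silent x y e) (cong suc (trans (cost->>= (sendArc π (someArc ∘ G)) (continue π k G) x y)
        (cong₂ _+_ (cost-sendArc π (someArc ∘ G) x y) (trans (cost->>= (reveal π k (without (run (sendArc π (someArc ∘ G)) x y) ∘ G)) (leaf ∘ adding (run (sendArc π (someArc ∘ G)) x y)) x y) (+-identityʳ _)))))))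
        (rest (run (sendArc π (someArc ∘ G)) x y) (run-sendArc π (someArc ∘ G) x y))
      where
      G₀ : Graph n
      G₀ = G (input π x y)
      rest : ∀ a → a ≡ someArc G₀ → suc (b + b + cost (reveal π k (without a ∘ G)) x y) ≤ ∑₂ ⟪ G₀ ⟫ * suc (b + b) + 1
      rest a refl rewrite ∑₂-without a G₀ (anyArc-true G₀ e) = ≤-trans (s≤s (+-monoʳ-≤ (b + b) (cost-reveal π k (without a ∘ G) x y)))
        (≤-reflexive (sym (+-assoc (suc (b + b)) _ 1)))

-- Rounds of learning

existsᵇ : ∀ {n} → (Fin n → Bool) → Bool
existsᵇ P = [ (λ _ → true) , (λ _ → false) ]′ (searchFin P)

existsᵇ-intro : ∀ {n} (P : Fin n → Bool) i → P i ≡ true → existsᵇ P ≡ true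
existsᵇ-intro P i e with searchFin P
... | inj₁ _    = refl
... | inj₂ none = ⊥-elim (true≢false e (none i))

existsᵇ-elim : ∀ {n} (P : Fin n → Bool) → existsᵇ P ≡ true → ∃ λ i → P i ≡ true
existsᵇ-elim P e with searchFin P
... | inj₁ found = found

-- The clusters of one level partition the vertices. Summing a cost per vertex of each cluster
-- therefore gives a factor `n` per level, however many clusters there are.
∑-clusters : ∀ {n} (label : Fin n → Fin n) → ∑ (λ c → size (clusterOf label c)) ≡ n
∑-clusters {n} label = trans (∑₂-swap (λ c v → ⟦ eqF c (label v) ⟧ * 1)) (trans (∑-cong λ v → ∑-single (label v) λ _ → 1) (count n))
  where
  opaque
    unfolding ∑
    count : ∀ n → ∑ {n} (λ _ → 1) ≡ n
    count zero    = refl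
    count (suc n) = cong suc (count n)

module Served {n Γ j : ℕ} {N : Graph n} (h : Hierarchy Γ j N) where

  open Hierarchy h

  weight : Fin j → Fin n → Fin n → ℕ
  weight l c = restrict (clusterOf (label l) c) (degrees l)

  cheaper : Fin j → Fin n → VSet n → ℕ
  cheaper l c S = mass (weight l c) S ⊓ mass (weight l c) (∁ S)

  cut-pieces : ∀ S → ∑₂ (λ l c → cut ⟪ pieces l c ⟫ S) ≡ cut ⟪ N ⟫ S
  cut-pieces S = trans (∑-cong λ l → cut-∑ (λ c → ⟪ pieces l c ⟫)) (trans (cut-∑ λ l u v → ∑ λ c → ⟪ pieces l c ⟫ u v)
      (∑₂-cong λ u v → cong (⟦ S u ∧ not (S v) ⟧ *_) (partition u v)))
    where
    cut-∑ : ∀ {k} (r : Fin k → Fin n → Fin n → ℕ) → ∑ (λ z → cut (r z) S) ≡ cut (λ u v → ∑ λ z → r z u v) S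
    cut-∑ r = trans (∑-∑₂ _) (∑₂-cong λ u v → ∑-*ˡ ⟦ S u ∧ not (S v) ⟧ _)

  cut≤cheaper : ∀ S → cut ⟪ N ⟫ S ≤ ∑₂ (λ l c → cheaper l c S)
  cut≤cheaper S = ≤-trans (≤-reflexive (sym (cut-pieces S))) (∑₂-mono λ l c → Piece.dominates (isPiece l c) S)

  cheaper≤cut : ∀ S → ∑₂ (λ l c → cheaper l c S) ≤ Γ * cut ⟪ N ⟫ S
  cheaper≤cut S = ≤-trans (∑₂-mono λ l c → Piece.expands (isPiece l c) S)
    (≤-reflexive (trans (∑₂-*ˡ Γ _) (cong (Γ *_) (cut-pieces S))))

  routed : (p q : Fin j → Fin n → Fin n → ℕ) → Fin j → Fin n → Graph n
  routed p q l c = Routing.route Γ (pieces l c) (p l c) (q l c)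

  allRouted : (p q : Fin j → Fin n → Fin n → ℕ) → Graph n
  allRouted p q u v = existsᵇ λ l → existsᵇ λ c → routed p q l c u v

  module _ (p q : Fin j → Fin n → Fin n → ℕ)
           (p≤ : ∀ l c v → p l c v ≤ weight l c v) (q≤ : ∀ l c v → q l c v ≤ weight l c v)
           (balanced : ∀ l c → ∑ (p l c) ≡ ∑ (q l c)) where

    private
      -- The surplus in `S` is at most the weight of `S`, because supplies obey the weights, and at
      -- most the weight of the complement, because by balance it equals a deficiency there. So the
      -- cheaper side bounds it, and expansion turns this into `Γ` times the cut.
      feasible : ∀ l c S → mass (p l c) S ≤ Γ * cut ⟪ pieces l c ⟫ S + mass (q l c) S
      feasible l c S = ≤-trans both (+-monoˡ-≤ (mass (q l c) S) (Piece.expands (isPiece l c) S))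
        where
        open ≤-Reasoning
        far : mass (p l c) S ≤ mass (weight l c) (∁ S) + mass (q l c) S
        far = begin
          mass (p l c) S                                ≤⟨ mass≤∑ (p l c) S ⟩
          ∑ (p l c)                                     ≡⟨ balanced l c ⟩
          ∑ (q l c)                                     ≡⟨ mass-∁ (q l c) S ⟨
          mass (q l c) S + mass (q l c) (∁ S)           ≤⟨ +-monoʳ-≤ (mass (q l c) S) (mass-mono (q≤ l c) (∁ S)) ⟩
          mass (q l c) S + mass (weight l c) (∁ S)      ≡⟨ +-comm (mass (q l c) S) _ ⟩
          mass (weight l c) (∁ S) + mass (q l c) S      ∎
        both : mass (p l c) S ≤ cheaper l c S + mass (q l c) S
        both with ⊓-sel (mass (weight l c) S) (mass (weight l c) (∁ S))
        ... | inj₁ e = ≤-trans (≤-trans (mass-mono (p≤ l c) S) (m≤m+n _ _)) (≤-reflexive (cong (_+ mass (q l c) S) (sym e)))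
        ... | inj₂ e = ≤-trans far (≤-reflexive (cong (_+ mass (q l c) S) (sym e)))

      routes : ∀ σ → 0 < σ → (∀ l c → ∑ (p l c) ≤ σ * σ) → ∀ l c → Routing.Routes Γ (pieces l c) (p l c) (q l c) (clusterOf (label l) c) σ (routed p q l c)
      routes σ σ>0 bounded l c = Routing.route-routes Γ (pieces l c) (p l c) (q l c) (clusterOf (label l) c)
        (Piece.inside (isPiece l c)) (balanced l c) σ σ>0 (bounded l c) (feasible l c)

      -- The fields `within` and `enough` do not mention `ℓ`, so they may be read off with any
      -- sufficiently large one, chosen here without a bound on the flow value.
      roomy : ∀ l c → ∑ (p l c) ≤ suc (∑₂ λ l c → ∑ (p l c)) * suc (∑₂ λ l c → ∑ (p l c))
      roomy l c = ≤-trans (term≤∑₂ (λ l c → ∑ (p l c)) l c) (≤-trans (n≤1+n _) (m≤m*n _ _))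

      loose : ∀ l c → Routing.Routes Γ (pieces l c) (p l c) (q l c) (clusterOf (label l) c) (suc (∑₂ λ l c → ∑ (p l c))) (routed p q l c)
      loose = routes _ (s≤s z≤n) roomy

      -- Each arc belongs to at most one piece, so different routes never share an arc and their
      -- cuts add up inside the union.
      single : ∀ u v → ∑₂ (λ l c → ⟪ routed p q l c ⟫ u v) ≤ ⟪ allRouted p q ⟫ u v
      single u v = go (allRouted p q u v) refl
        where
        go : ∀ b → allRouted p q u v ≡ b → ∑₂ (λ l c → ⟪ routed p q l c ⟫ u v) ≤ ⟦ b ⟧
        go true  e = ≤-trans (∑₂-mono λ l c → ⟦⟧-mono (Routing.Routes.within (loose l c) u v)) (≤-trans (≤-reflexive (partition u v)) (⟦⟧≤1 (N u v)))
        go false e = ≤-reflexive (∑-zero λ l → ∑-zero λ c → cong ⟦_⟧ (≢true λ e' →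
          true≢false (existsᵇ-intro (λ l → existsᵇ λ c → routed p q l c u v) l (existsᵇ-intro (λ c → routed p q l c u v) c e')) e))

    allRouted-⊆ : ∀ u v → allRouted p q u v ≡ true → N u v ≡ true
    allRouted-⊆ u v e with existsᵇ-elim (λ l → existsᵇ λ c → routed p q l c u v) e
    ... | l , e' with existsᵇ-elim (λ c → routed p q l c u v) e'
    ...   | c , e'' = positive (N u v) (≤-trans (≤-trans (≤-reflexive (cong ⟦_⟧ (sym (Routing.Routes.within (loose l c) u v e'')))) (term≤∑₂ (λ l c → ⟪ pieces l c ⟫ u v) l c)) (≤-reflexive (partition u v)))
      where
      positive : ∀ b → 1 ≤ ⟦ b ⟧ → b ≡ true
      positive true _ = refl

    allRouted-enough : ∀ S → ∑₂ (λ l c → mass (p l c) S) ≤ Γ * cut ⟪ allRouted p q ⟫ S + ∑₂ (λ l c → mass (q l c) S)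
    allRouted-enough S = begin
      ∑₂ (λ l c → mass (p l c) S)                                             ≤⟨ ∑₂-mono (λ l c → Routing.Routes.enough (loose l c) S) ⟩
      ∑₂ (λ l c → Γ * cut ⟪ routed p q l c ⟫ S + mass (q l c) S)               ≡⟨ trans (∑₂-+ _ _) (cong (_+ ∑₂ (λ l c → mass (q l c) S)) (∑₂-*ˡ Γ _)) ⟩
      Γ * ∑₂ (λ l c → cut ⟪ routed p q l c ⟫ S) + ∑₂ (λ l c → mass (q l c) S)  ≤⟨ +-monoˡ-≤ _ (*-monoʳ-≤ Γ merge) ⟩
      Γ * cut ⟪ allRouted p q ⟫ S + ∑₂ (λ l c → mass (q l c) S)                ∎
      where
      open ≤-Reasoning
      merge : ∑₂ (λ l c → cut ⟪ routed p q l c ⟫ S) ≤ cut ⟪ allRouted p q ⟫ S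
      merge = ≤-trans (≤-reflexive (trans (∑-cong λ l → ∑-∑₂ _) (∑-∑₂ _))) (∑₂-mono λ u v → ≤-trans
        (≤-reflexive (trans (∑-cong λ l → ∑-*ˡ ⟦ S u ∧ not (S v) ⟧ _) (∑-*ˡ ⟦ S u ∧ not (S v) ⟧ _)))
        (*-monoʳ-≤ ⟦ S u ∧ not (S v) ⟧ (single u v)))

    allRouted-few : ∀ σ → 0 < σ → (∀ l c → ∑ (p l c) ≤ σ * σ) → ∑₂ ⟪ allRouted p q ⟫ ≤ j * (n * (2 * σ))
    allRouted-few σ σ>0 bounded = begin
      ∑₂ ⟪ allRouted p q ⟫                                          ≤⟨ ∑₂-mono covered ⟩
      ∑₂ (λ u v → ∑₂ λ l c → ⟪ routed p q l c ⟫ u v)                ≡⟨ trans (∑-cong λ l → ∑-∑₂ _) (∑-∑₂ _) ⟨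
      ∑₂ (λ l c → ∑₂ ⟪ routed p q l c ⟫)                            ≤⟨ ∑₂-mono (λ l c → Routing.Routes.few (routes σ σ>0 bounded l c)) ⟩
      ∑₂ (λ l c → size (clusterOf (label l) c) * (2 * σ))           ≤⟨ ∑-≤ _ (λ l → ≤-reflexive (level l)) ⟩
      j * (n * (2 * σ))                                             ∎
      where
      open ≤-Reasoning
      level : ∀ l → ∑ (λ c → size (clusterOf (label l) c) * (2 * σ)) ≡ n * (2 * σ)
      level l = trans (∑-cong λ c → *-comm (size (clusterOf (label l) c)) (2 * σ)) (trans (∑-*ˡ (2 * σ) _)
        (trans (cong ((2 * σ) *_) (∑-clusters (label l))) (*-comm (2 * σ) n)))
      covered : ∀ u v → ⟪ allRouted p q ⟫ u v ≤ ∑₂ λ l c → ⟪ routed p q l c ⟫ u v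
      covered u v with allRouted p q u v in e
      ... | false = z≤n
      ... | true with existsᵇ-elim (λ l → existsᵇ λ c → routed p q l c u v) e
      ...   | l , e' with existsᵇ-elim (λ c → routed p q l c u v) e'
      ...     | c , e'' = ≤-trans (≤-reflexive (cong ⟦_⟧ (sym e''))) (term≤∑₂ (λ l c → ⟪ routed p q l c ⟫ u v) l c)

either : ∀ {A : Set} → Player → A → A → A
either first  a b = a
either second a b = b

place-of : ∀ j n → Player → Fin j → Fin n → Fin (j * n + j * n)
place-of j n first  l c = combine l c ↑ˡ (j * n)
place-of j n second l c = (j * n) ↑ʳ combine l c

∑-places : ∀ j n (f : Fin (j * n + j * n) → ℕ) →
  ∑ f ≡ ∑₂ (λ l c → f (place-of j n first l c)) + ∑₂ (λ l c → f (place-of j n second l c))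
∑-places j n f = trans (∑-++ (j * n) f) (cong₂ _+_ (∑-combine j {n} _) (∑-combine j {n} _))

module Step {n Γ j : ℕ} (K : Graph n) (N : Player → Graph n) (h : ∀ π → Hierarchy Γ j (N π))
            (w : Fin (j * n + j * n) → Fin n → ℕ)
            (w≡ : ∀ π l c v → w (place-of j n π l c) v ≡ Served.weight (h π) l c v)
            (s t : Fin n) (D : Star.Demand ⟪ K ⟫ w s t) where

  open Star.Demand D

  at : Player → Fin j → Fin n → Fin (j * n + j * n)
  at = place-of j n

  new : Player → Graph n
  new π = Served.allRouted (h π) (λ l c → into (at π l c)) (λ l c → out (at π l c))

  private
    into-≤ : ∀ π l c v → into (at π l c) v ≤ Served.weight (h π) l c v
    into-≤ π l c v = ≤-trans (into≤ (at π l c) v) (≤-reflexive (w≡ π l c v))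

    out-≤ : ∀ π l c v → out (at π l c) v ≤ Served.weight (h π) l c v
    out-≤ π l c v = ≤-trans (out≤ (at π l c) v) (≤-reflexive (w≡ π l c v))

    enough : ∀ π S → ∑₂ (λ l c → mass (into (at π l c)) S) ≤ Γ * cut ⟪ new π ⟫ S + ∑₂ (λ l c → mass (out (at π l c)) S)
    enough π = Served.allRouted-enough (h π) _ _ (into-≤ π) (out-≤ π) (λ l c → balanced (at π l c))

    cheaper-at : ∀ π l c S → mass (w (at π l c)) S ⊓ mass (w (at π l c)) (∁ S) ≡ Served.cheaper (h π) l c S
    cheaper-at π l c S = cong₂ _⊓_ (∑-cong λ v → cong (⟦ S v ⟧ *_) (w≡ π l c v)) (∑-cong λ v → cong (⟦ ∁ S v ⟧ *_) (w≡ π l c v))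

    capacity-≡ : ∀ S → Star.capacity ⟪ K ⟫ w S ≡ cut ⟪ K ⟫ S + (∑₂ (λ l c → Served.cheaper (h first) l c S) + ∑₂ (λ l c → Served.cheaper (h second) l c S))
    capacity-≡ S = cong (cut ⟪ K ⟫ S +_) (trans (∑-places j n _) (cong₂ _+_ (∑₂-cong λ l c → cheaper-at first l c S) (∑₂-cong λ l c → cheaper-at second l c S)))

  new-⊆ : ∀ π u v → new π u v ≡ true → N π u v ≡ true
  new-⊆ π = Served.allRouted-⊆ (h π) _ _ (into-≤ π) (out-≤ π) (λ l c → balanced (at π l c))

  new-few : ∀ π σ → 0 < σ → value ≤ σ * σ → ∑₂ ⟪ new π ⟫ ≤ j * (n * (2 * σ))
  new-few π σ σ>0 le = Served.allRouted-few (h π) _ _ (into-≤ π) (out-≤ π) (λ l c → balanced (at π l c)) σ σ>0 (λ l c → ≤-trans (bounded (at π l c)) le)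

  -- In `covers` every inflow of a star is replaced by `Γ` times its revealed arcs plus its outflow;
  -- the outflows then cancel. So what was routed through stars is now carried by real edges.
  value-reached : ∀ S → S s ≡ true → S t ≡ false → value ≤ cut ⟪ K ⟫ S + Γ * (cut ⟪ new first ⟫ S + cut ⟪ new second ⟫ S)
  value-reached S Ss St = +-cancelʳ-≤ (∑ λ z → mass (out z) S) _ _ (begin
    value + ∑ (λ z → mass (out z) S)                                  ≤⟨ covers S Ss St ⟩
    cut ⟪ K ⟫ S + ∑ (λ z → mass (into z) S)                           ≡⟨ cong (cut ⟪ K ⟫ S +_) (∑-places j n _) ⟩
    cut ⟪ K ⟫ S + (∑₂ (λ l c → mass (into (at first l c)) S) + ∑₂ (λ l c → mass (into (at second l c)) S)) ≤⟨ +-monoʳ-≤ (cut ⟪ K ⟫ S) (+-mono-≤ (enough first S) (enough second S)) ⟩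
    cut ⟪ K ⟫ S + (Γ * cut ⟪ new first ⟫ S + o₁ + (Γ * cut ⟪ new second ⟫ S + o₂)) ≡⟨ arith (cut ⟪ K ⟫ S) Γ (cut ⟪ new first ⟫ S) o₁ (cut ⟪ new second ⟫ S) o₂ ⟩
    cut ⟪ K ⟫ S + Γ * (cut ⟪ new first ⟫ S + cut ⟪ new second ⟫ S) + (o₁ + o₂) ≡⟨ cong (cut ⟪ K ⟫ S + Γ * (cut ⟪ new first ⟫ S + cut ⟪ new second ⟫ S) +_) (∑-places j n _) ⟨
    cut ⟪ K ⟫ S + Γ * (cut ⟪ new first ⟫ S + cut ⟪ new second ⟫ S) + ∑ (λ z → mass (out z) S) ∎)
    where
    open ≤-Reasoning
    o₁ o₂ : ℕ
    o₁ = ∑₂ λ l c → mass (out (at first l c)) S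
    o₂ = ∑₂ λ l c → mass (out (at second l c)) S
    arith : ∀ k g a x b y → k + (g * a + x + (g * b + y)) ≡ k + g * (a + b) + (x + y)
    arith = solve-∀

  -- At a cheapest cut of the network the stars dominate the hidden edges that they replace.
  value-≥ : ∀ ν → (∀ S → S s ≡ true → S t ≡ false → ν ≤ cut ⟪ K ⟫ S + (cut ⟪ N first ⟫ S + cut ⟪ N second ⟫ S)) → ν ≤ value
  value-≥ ν below with attained
  ... | S , Ss , St , le = ≤-trans (below S Ss St) (≤-trans (+-monoʳ-≤ (cut ⟪ K ⟫ S) (+-mono-≤ (Served.cut≤cheaper (h first) S) (Served.cut≤cheaper (h second) S)))
      (≤-trans (≤-reflexive (sym (capacity-≡ S))) le))

  -- Expansion limits the overestimate: the stars charge at most `Γ` for each hidden edge,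
  -- separately for each player.
  value-≤ : ∀ S → S s ≡ true → S t ≡ false → value ≤ cut ⟪ K ⟫ S + Γ * (cut ⟪ N first ⟫ S + cut ⟪ N second ⟫ S)
  value-≤ S Ss St = ≤-trans (least S Ss St) (≤-trans (≤-reflexive (capacity-≡ S)) (+-monoʳ-≤ (cut ⟪ K ⟫ S)
    (≤-trans (+-mono-≤ (Served.cheaper≤cut (h first) S) (Served.cheaper≤cut (h second) S)) (≤-reflexive (sym (*-distribˡ-+ Γ _ _))))))

-- One round as a protocol

symm : ∀ {n} → Graph n → Graph n
symm E u v = E u v ∨ E v u

symm-sym : ∀ {n} (E : Graph n) → Symmetric (symm E)
symm-sym E u v = ∨-comm (E u v) (E v u)

-- Symmetrised so that players can decompose it on every input; see hidden-≡ for the symmetric ones.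
hidden : ∀ {n} → Graph n → Graph n → Graph n
hidden K E = symm λ u v → E u v ∧ not (K u v)

hidden-≡ : ∀ {n} (K E : Graph n) → Symmetric K → Symmetric E → ∀ u v → hidden K E u v ≡ E u v ∧ not (K u v)
hidden-≡ K E sym-K sym-E u v = trans (cong₂ (λ a b → (E u v ∧ not (K u v)) ∨ (a ∧ not b)) (sym (sym-E u v)) (sym (sym-K u v))) (∨-idem _)

module Rounds {n : ℕ} (s t : Fin n) (s≢t : s ≢ t) (b : ℕ) (b>0 : 0 < b) (n≤ : n ≤ 2 ^ b) where

  open Levels b b>0 n≤ public
  open Messages {Graph n} public
  open Vertices b n≤ s public

  -- Used twice, for the levels of a hierarchy and for the halving phases of the protocol. Both
  -- times the point is that `2 ^ J` exceeds `n * n`.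
  J : ℕ
  J = suc (b + b)

  H : ∀ K E → Hierarchy Γ₀ J (hidden K E)
  H K E = hierarchy (hidden K E) (symm-sym λ u v → E u v ∧ not (K u v))

  Message : Set
  Message = Fin J → Fin n → Fin n × ℕ

  message : Graph n → Graph n → Message
  message K E l v = Hierarchy.label (H K E) l v , Hierarchy.degrees (H K E) l v

  entry : Player → (Graph n → Fin n × ℕ) → Protocol (Graph n) (Graph n) (Fin n × ℕ)
  entry-rest : Player → (Graph n → Fin n × ℕ) → Fin n → Protocol (Graph n) (Graph n) (Fin n × ℕ)
  entry π f = sendFin π (proj₁ ∘ f) >>= entry-rest π f
  entry-rest π f c = sendNum π (suc b) (proj₂ ∘ f) >>= λ d → leaf (c , d)

  run-entry : ∀ π f x y → proj₂ (f (input π x y)) ≤ n → run (entry π f) x y ≡ f (input π x y)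
  run-entry π f x y le = trans (run->>= (sendFin π (proj₁ ∘ f)) (entry-rest π f) x y)
    (trans (run->>= (sendNum π (suc b) (proj₂ ∘ f)) _ x y) (cong₂ _,_ (run-sendFin π (proj₁ ∘ f) x y)
      (run-sendNum π (suc b) (proj₂ ∘ f) x y (≤-<-trans (≤-trans le n≤) (^-monoʳ-< 2 (s≤s (s≤s z≤n)) (n<1+n b))))))

  cost-entry : ∀ π f x y → cost (entry π f) x y ≡ b + suc b
  cost-entry π f x y = trans (cost->>= (sendFin π (proj₁ ∘ f)) (entry-rest π f) x y) (cong₂ _+_ (cost-sendFin π (proj₁ ∘ f) x y)
    (trans (cost->>= (sendNum π (suc b) (proj₂ ∘ f)) _ x y) (trans (+-identityʳ _) (cost-sendNum π (suc b) (proj₂ ∘ f) x y))))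

  announce : Player → Graph n → Protocol (Graph n) (Graph n) Message
  announce π K = table J λ l → table n λ v → entry π λ E → message K E l v

  run-announce : ∀ π K x y l v → run (announce π K) x y l v ≡ message K (input π x y) l v
  run-announce π K x y l v = trans (cong (λ (g : Fin n → Fin n × ℕ) → g v) (run-table J (λ l → table n λ v → entry π λ E → message K E l v) x y l))
    (trans (run-table n (λ v → entry π λ E → message K E l v) x y v) (run-entry π (λ E → message K E l v) x y (Hierarchy.degrees≤ (H K (input π x y)) l v)))

  cost-announce : ∀ π K x y → cost (announce π K) x y ≤ J * (n * (b + suc b))
  cost-announce π K x y = cost-table J (λ l → table n λ v → entry π λ E → message K E l v) x y λ l →
    cost-table n (λ v → entry π λ E → message K E l v) x y λ v → ≤-reflexive (cost-entry π (λ E → message K E l v) x y)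

  weightOf : Message → Fin (J * n) → Fin n → ℕ
  weightOf m z = restrict (clusterOf (proj₁ ∘ m (proj₁ (remQuot {J} n z))) (proj₂ (remQuot {J} n z))) (proj₂ ∘ m (proj₁ (remQuot {J} n z)))

  weights : Message → Message → Fin (J * n + J * n) → Fin n → ℕ
  weights m₁ m₂ z = [ weightOf m₁ , weightOf m₂ ]′ (splitAt (J * n) z)

  weights-≡ : ∀ m₁ m₂ π l c v → weights m₁ m₂ (place-of J n π l c) v ≡ restrict (clusterOf (proj₁ ∘ either π m₁ m₂ l) c) (proj₂ ∘ either π m₁ m₂ l) v
  weights-≡ m₁ m₂ first  l c v = trans (cong (λ z → [ weightOf m₁ , weightOf m₂ ]′ z v) (splitAt-↑ˡ (J * n) (combine l c) (J * n)))
    (cong (λ z → restrict (clusterOf (proj₁ ∘ m₁ (proj₁ z)) (proj₂ z)) (proj₂ ∘ m₁ (proj₁ z)) v) (remQuot-combine {J} {n} l c))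
  weights-≡ m₁ m₂ second l c v = trans (cong (λ z → [ weightOf m₁ , weightOf m₂ ]′ z v) (splitAt-↑ʳ (J * n) (J * n) (combine l c)))
    (cong (λ z → restrict (clusterOf (proj₁ ∘ m₂ (proj₁ z)) (proj₂ z)) (proj₂ ∘ m₂ (proj₁ z)) v) (remQuot-combine {J} {n} l c))

  -- A function of public data alone, so both players hold the same demands without further
  -- communication.
  demandOf : ∀ K m₁ m₂ → Star.Demand ⟪ K ⟫ (weights m₁ m₂) s t
  demandOf K m₁ m₂ = Star.demand ⟪ K ⟫ (weights m₁ m₂) s t s≢t

  newArcs : Player → Graph n → Message → Message → Graph n → Graph n
  newArcs π K m₁ m₂ E = Served.allRouted (H K E) (λ l c → Star.Demand.into (demandOf K m₁ m₂) (place-of J n π l c))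
                                                 (λ l c → Star.Demand.out (demandOf K m₁ m₂) (place-of J n π l c))

  -- Routes are directed; adding both orientations keeps `K` symmetric and inside the symmetric
  -- graph.
  merge : Graph n → Graph n → Graph n → Graph n
  merge K X₁ X₂ u v = K u v ∨ (symm X₁ u v ∨ symm X₂ u v)

  afterFirst  : Graph n → Message → Protocol (Graph n) (Graph n) (Graph n)
  afterSecond : Graph n → Message → Message → Protocol (Graph n) (Graph n) (Graph n)
  afterReveal : Graph n → Message → Message → Graph n → Protocol (Graph n) (Graph n) (Graph n)
  round : Graph n → Protocol (Graph n) (Graph n) (Graph n)
  round K = announce first K >>= afterFirst K
  afterFirst K m₁ = announce second K >>= afterSecond K m₁
  afterSecond K m₁ m₂ = reveal first (n * n) (newArcs first K m₁ m₂) >>= afterReveal K m₁ m₂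
  afterReveal K m₁ m₂ X₁ = reveal second (n * n) (newArcs second K m₁ m₂) >>= (leaf ∘ merge K X₁)

  -- Messages and revealed graphs are parameters tied to the computed ones pointwise, which is the
  -- form of equality that `run-announce` and `run-reveal` deliver.
  module Outcome (K x y : Graph n) (sym-K : Symmetric K) (sym-x : Symmetric x) (sym-y : Symmetric y)
                 (K⊆ : ∀ u v → K u v ≡ true → (x ∪ᴳ y) u v ≡ true)
                 (m₁ m₂ : Message) (messages-≡ : ∀ π l v → either π m₁ m₂ l v ≡ message K (input π x y) l v)
                 (X₁ X₂ : Graph n) (X₁-≡ : ∀ u v → X₁ u v ≡ newArcs first K m₁ m₂ x u v) (X₂-≡ : ∀ u v → X₂ u v ≡ newArcs second K m₁ m₂ y u v)
                 (K' : Graph n) (K'-≡ : ∀ u v → K' u v ≡ merge K X₁ X₂ u v) where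

    private
      N : Player → Graph n
      N π = hidden K (input π x y)
      sym-input : ∀ π → Symmetric (input π x y)
      sym-input first  = sym-x
      sym-input second = sym-y

      open Step K N (λ π → H K (input π x y)) (weights m₁ m₂)
        (λ π l c v → trans (weights-≡ m₁ m₂ π l c v) (cong (λ (m : Fin n × ℕ) → restrict (clusterOf (λ _ → proj₁ m) c) (λ _ → proj₂ m) v) (messages-≡ π l v)))
        s t (demandOf K m₁ m₂)
      open Star.Demand (demandOf K m₁ m₂) using (value)

      unseen : ∀ π u v → N π u v ≡ true → input π x y u v ≡ true × K u v ≡ false
      unseen π u v e = proj₁ (∧-true e') , not-true (proj₂ (∧-true {input π x y u v} e'))
        where e' = trans (sym (hidden-≡ K (input π x y) sym-K (sym-input π) u v)) e

      input-⊆ : ∀ π u v → input π x y u v ≡ true → (x ∪ᴳ y) u v ≡ true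
      input-⊆ first  u v e rewrite e = refl
      input-⊆ second u v e rewrite e = ∨-comm (x u v) true

      new-⊆G : ∀ π u v → new π u v ≡ true → (x ∪ᴳ y) u v ≡ true
      new-⊆G π u v e = input-⊆ π u v (proj₁ (unseen π u v (new-⊆ π u v e)))

      sym-G : Symmetric (x ∪ᴳ y)
      sym-G u v = cong₂ _∨_ (sym-x u v) (sym-y u v)

    K'-sym : Symmetric K'
    K'-sym u v = trans (K'-≡ u v) (trans (cong₂ _∨_ (sym-K u v) (cong₂ _∨_ (symm-sym X₁ u v) (symm-sym X₂ u v))) (sym (K'-≡ v u)))

    K'-⊆ : ∀ u v → K' u v ≡ true → (x ∪ᴳ y) u v ≡ true
    K'-⊆ u v e = go (K u v) refl (X₁ u v) refl (X₁ v u) refl (X₂ u v) refl (X₂ v u) refl (trans (sym (K'-≡ u v)) e)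
      where
      go : ∀ k → K u v ≡ k → ∀ a → X₁ u v ≡ a → ∀ a' → X₁ v u ≡ a' → ∀ d → X₂ u v ≡ d → ∀ d' → X₂ v u ≡ d' →
        k ∨ ((a ∨ a') ∨ (d ∨ d')) ≡ true → (x ∪ᴳ y) u v ≡ true
      go true  ek a ea a' ea' d ed d' ed' _ = K⊆ u v ek
      go false ek true  ea a' ea' d ed d' ed' _ = new-⊆G first u v (trans (sym (X₁-≡ u v)) ea)
      go false ek false ea true  ea' d ed d' ed' _ = trans (sym-G u v) (new-⊆G first v u (trans (sym (X₁-≡ v u)) ea'))
      go false ek false ea false ea' true ed d' ed' _ = new-⊆G second u v (trans (sym (X₂-≡ u v)) ed)
      go false ek false ea false ea' false ed true ed' _ = trans (sym-G u v) (new-⊆G second v u (trans (sym (X₂-≡ v u)) ed'))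

    private
      -- The new arcs of a player were hidden and hence are disjoint from `K`. The arcs of the two
      -- players may coincide, so the gain is credited to one player at a time and `progress` adds
      -- the two estimates.
      gain : ∀ π S → cut ⟪ K ⟫ S + cut ⟪ new π ⟫ S ≤ cut ⟪ K' ⟫ S
      gain π S = ≤-trans (≤-reflexive (sym (cut-+ ⟪ K ⟫ ⟪ new π ⟫ S))) (cut-mono (λ u v → arc u v (K u v) refl (new π u v) refl) S)
        where
        arc : ∀ u v k → K u v ≡ k → ∀ a → new π u v ≡ a → ⟦ k ⟧ + ⟦ a ⟧ ≤ ⟦ K' u v ⟧
        arc u v true  ek true  ea = ⊥-elim (true≢false ek (proj₂ (unseen π u v (new-⊆ π u v ea))))
        arc u v true  ek false ea = ≤-reflexive (cong ⟦_⟧ (sym (trans (K'-≡ u v) (cong (_∨ (symm X₁ u v ∨ symm X₂ u v)) ek))))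
        arc u v false ek false ea = z≤n
        arc u v false ek true  ea = ≤-reflexive (cong ⟦_⟧ (sym (trans (K'-≡ u v) (trans (cong (K u v ∨_) (reveals π ea)) (∨-comm (K u v) true)))))
          where
          reveals : ∀ π → new π u v ≡ true → symm X₁ u v ∨ symm X₂ u v ≡ true
          reveals first  e = cong (λ c → (c ∨ X₁ v u) ∨ symm X₂ u v) (trans (X₁-≡ u v) e)
          reveals second e = trans (cong (λ c → symm X₁ u v ∨ (c ∨ X₂ v u)) (trans (X₂-≡ u v) e)) (∨-comm (symm X₁ u v) true)

    -- With `k` and `k'` the cuts before and after, this reads `ν - k ≤ 2 * Γ₀ * (k' - k)`, arranged
    -- without truncated subtraction.
    progress : ∀ ν → (∀ S → S s ≡ true → S t ≡ false → ν ≤ cut ⟪ x ∪ᴳ y ⟫ S) →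
      ∀ S → S s ≡ true → S t ≡ false → ν + 2 * Γ₀ * cut ⟪ K ⟫ S ≤ cut ⟪ K ⟫ S + 2 * Γ₀ * cut ⟪ K' ⟫ S
    progress ν below S Ss St = begin
      ν + 2 * Γ₀ * k                         ≤⟨ +-monoˡ-≤ (2 * Γ₀ * k) (≤-trans (value-≥ ν λ T Ts Tt → ≤-trans (below T Ts Tt) (cover T)) (value-reached S Ss St)) ⟩
      k + Γ₀ * (a + d) + 2 * Γ₀ * k          ≡⟨ arith k Γ₀ a d ⟩
      k + Γ₀ * ((k + a) + (k + d))           ≤⟨ +-monoʳ-≤ k (*-monoʳ-≤ Γ₀ (+-mono-≤ (gain first S) (gain second S))) ⟩
      k + Γ₀ * (k' + k')                     ≡⟨ arith' k Γ₀ k' ⟩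
      k + 2 * Γ₀ * k'                        ∎
      where
      open ≤-Reasoning
      k k' a d : ℕ
      k = cut ⟪ K ⟫ S
      k' = cut ⟪ K' ⟫ S
      a = cut ⟪ new first ⟫ S
      d = cut ⟪ new second ⟫ S
      arith : ∀ k g a d → k + g * (a + d) + 2 * g * k ≡ k + g * ((k + a) + (k + d))
      arith = solve-∀
      arith' : ∀ k g m → k + g * (m + m) ≡ k + 2 * g * m
      arith' = solve-∀
      cover : ∀ T → cut ⟪ x ∪ᴳ y ⟫ T ≤ cut ⟪ K ⟫ T + (cut ⟪ N first ⟫ T + cut ⟪ N second ⟫ T)
      cover T = ≤-trans (cut-mono arc T) (≤-reflexive (trans (cut-+ ⟪ K ⟫ (λ u v → ⟪ N first ⟫ u v + ⟪ N second ⟫ u v) T) (cong (cut ⟪ K ⟫ T +_) (cut-+ ⟪ N first ⟫ ⟪ N second ⟫ T))))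
        where
        go : ∀ p q r → ⟦ p ∨ q ⟧ ≤ ⟦ r ⟧ + (⟦ p ∧ not r ⟧ + ⟦ q ∧ not r ⟧)
        go true  q     true  = m≤m+n 1 _
        go true  q     false = m≤m+n 1 _
        go false true  true  = ≤-refl
        go false true  false = ≤-refl
        go false false r     = z≤n
        arc : ∀ u v → ⟪ x ∪ᴳ y ⟫ u v ≤ ⟪ K ⟫ u v + (⟪ N first ⟫ u v + ⟪ N second ⟫ u v)
        arc u v = ≤-trans (go (x u v) (y u v) (K u v)) (≤-reflexive (cong₂ (λ p q → ⟦ K u v ⟧ + (⟦ p ⟧ + ⟦ q ⟧)) (sym (hidden-≡ K x sym-K sym-x u v)) (sym (hidden-≡ K y sym-K sym-y u v))))

    -- The factor `1 + 2 * Γ₀` has a share 1 from `K` and `Γ₀` from each player's stars, since the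
    -- hidden part of either is at most the whole cut.
    few-new : ∀ S → S s ≡ true → S t ≡ false → ∀ σ → 0 < σ → (1 + 2 * Γ₀) * cut ⟪ x ∪ᴳ y ⟫ S ≤ σ * σ →
      ∀ π → ∑₂ ⟪ newArcs π K m₁ m₂ (input π x y) ⟫ ≤ J * (n * (2 * σ))
    few-new S Ss St σ σ>0 le π = new-few π σ σ>0 value≤
      where
      open ≤-Reasoning
      G : Graph n
      G = x ∪ᴳ y
      value≤ : value ≤ σ * σ
      value≤ = begin
        value                                                     ≤⟨ value-≤ S Ss St ⟩
        cut ⟪ K ⟫ S + Γ₀ * (cut ⟪ N first ⟫ S + cut ⟪ N second ⟫ S) ≤⟨ +-mono-≤ (cut-mono (λ u v → ⟦⟧-mono (K⊆ u v)) S) (*-monoʳ-≤ Γ₀ (+-mono-≤ (inG first) (inG second))) ⟩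
        cut ⟪ G ⟫ S + Γ₀ * (cut ⟪ G ⟫ S + cut ⟪ G ⟫ S)             ≡⟨ arith'' (cut ⟪ G ⟫ S) Γ₀ ⟩
        (1 + 2 * Γ₀) * cut ⟪ G ⟫ S                                 ≤⟨ le ⟩
        σ * σ                                                     ∎
        where
        arith'' : ∀ c g → c + g * (c + c) ≡ (1 + 2 * g) * c
        arith'' = solve-∀
        inG : ∀ π → cut ⟪ N π ⟫ S ≤ cut ⟪ G ⟫ S
        inG π = cut-mono (λ u v → ⟦⟧-mono λ e → input-⊆ π u v (proj₁ (unseen π u v e))) S

  module Round (K x y : Graph n) (sym-K : Symmetric K) (sym-x : Symmetric x) (sym-y : Symmetric y)
               (K⊆ : ∀ u v → K u v ≡ true → (x ∪ᴳ y) u v ≡ true) where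

    private
      m₁ m₂ : Message
      m₁ = run (announce first K) x y
      m₂ = run (announce second K) x y
      X₁ X₂ : Graph n
      X₁ = run (reveal first (n * n) (newArcs first K m₁ m₂)) x y
      X₂ = run (reveal second (n * n) (newArcs second K m₁ m₂)) x y

      round-≡ : run (round K) x y ≡ merge K X₁ X₂
      round-≡ = trans (run->>= (announce first K) (afterFirst K) x y) (trans (run->>= (announce second K) (afterSecond K m₁) x y)
        (trans (run->>= (reveal first (n * n) (newArcs first K m₁ m₂)) (afterReveal K m₁ m₂) x y)
               (run->>= (reveal second (n * n) (newArcs second K m₁ m₂)) (leaf ∘ merge K X₁) x y)))

      messages-≡ : ∀ π l v → either π m₁ m₂ l v ≡ message K (input π x y) l v
      messages-≡ first  = run-announce first K x y
      messages-≡ second = run-announce second K x y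

      fits : ∀ (E : Graph n) → ∑₂ ⟪ E ⟫ ≤ n * n
      fits E = ∑-≤ _ λ u → ≤-trans (∑-≤ _ {1} λ v → ⟦⟧≤1 (E u v)) (≤-reflexive (*-identityʳ n))

      module O = Outcome K x y sym-K sym-x sym-y K⊆ m₁ m₂ messages-≡ X₁ X₂
        (run-reveal first (n * n) (newArcs first K m₁ m₂) x y (fits _)) (run-reveal second (n * n) (newArcs second K m₁ m₂) x y (fits _))
        (run (round K) x y) (λ u v → cong (λ (g : Graph n) → g u v) round-≡)

    open O public using (K'-sym; K'-⊆; progress)

    round-cost : ∀ S → S s ≡ true → S t ≡ false → ∀ σ → 0 < σ → (1 + 2 * Γ₀) * cut ⟪ x ∪ᴳ y ⟫ S ≤ σ * σ →
      cost (round K) x y ≤ 2 * (J * (n * (b + suc b)) + (J * (n * (2 * σ)) * suc (b + b) + 1))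
    round-cost S Ss St σ σ>0 le = ≤-trans (≤-reflexive (trans (cost->>= (announce first K) (afterFirst K) x y) (cong (cost (announce first K) x y +_)
        (trans (cost->>= (announce second K) (afterSecond K m₁) x y) (cong (cost (announce second K) x y +_)
        (trans (cost->>= (reveal first (n * n) (newArcs first K m₁ m₂)) (afterReveal K m₁ m₂) x y) (cong (cost (reveal first (n * n) (newArcs first K m₁ m₂)) x y +_)
        (cost->>= (reveal second (n * n) (newArcs second K m₁ m₂)) (leaf ∘ merge K X₁) x y))))))))
      (≤-trans (+-mono-≤ (cost-announce first K x y) (+-mono-≤ (cost-announce second K x y) (+-mono-≤ (revealed first) (+-monoˡ-≤ 0 (revealed second)))))
        (≤-reflexive (arith (J * (n * (b + suc b))) (J * (n * (2 * σ)) * suc (b + b) + 1))))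
      where
      arith : ∀ a r → a + (a + (r + (r + 0))) ≡ 2 * (a + r)
      arith = solve-∀
      revealed : ∀ π → cost (reveal π (n * n) (newArcs π K m₁ m₂)) x y ≤ J * (n * (2 * σ)) * suc (b + b) + 1
      revealed π = ≤-trans (cost-reveal π (n * n) (newArcs π K m₁ m₂) x y) (+-monoˡ-≤ 1 (*-monoˡ-≤ (suc (b + b)) (O.few-new S Ss St σ σ>0 le π)))

-- From saturating all cuts to a minimum cut

-- The inequality of `progress` in terms of truncated deficits. The delicate case is `ν ≤ k`, where
-- no deficit existed: growth of `K` is not among the hypotheses, and it is `h` itself that excludes
-- `k' < ν`.
shrink : ∀ c ν k k' → 0 < c → ν + c * k ≤ k + c * k' → c * (ν ∸ k') + (ν ∸ k) ≤ c * (ν ∸ k)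
shrink (suc e) ν k k' _ h with ≤-total ν k'
... | inj₁ ν≤k' rewrite m≤n⇒m∸n≡0 ν≤k' | *-zeroʳ e = m≤m+n (ν ∸ k) _
... | inj₂ k'≤ν with ≤-total k ν
...   | inj₁ k≤ν = +-cancelʳ-≤ (suc e * k) _ _ (begin
  suc e * d' + d + suc e * k            ≡⟨ arith (suc e) d' d (suc e * k) ⟩
  suc e * d' + (d + suc e * k)          ≤⟨ +-monoʳ-≤ (suc e * d') (+-cancelˡ-≤ k _ _ (≤-trans (≤-reflexive rearrange) h)) ⟩
  suc e * d' + suc e * k'               ≡⟨ *-distribˡ-+ (suc e) d' k' ⟨
  suc e * (d' + k')                     ≡⟨ cong (suc e *_) (trans (m∸n+n≡m k'≤ν) (sym (m∸n+n≡m k≤ν))) ⟩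
  suc e * (d + k)                       ≡⟨ *-distribˡ-+ (suc e) d k ⟩
  suc e * d + suc e * k                 ∎)
  where
  open ≤-Reasoning
  d d' : ℕ
  d = ν ∸ k
  d' = ν ∸ k'
  arith : ∀ c x y z → c * x + y + z ≡ c * x + (y + z)
  arith = solve-∀
  swap : ∀ k d z → k + (d + z) ≡ d + k + z
  swap = solve-∀
  rearrange : k + (d + suc e * k) ≡ ν + suc e * k
  rearrange = trans (swap k d (suc e * k)) (cong (_+ suc e * k) (m∸n+n≡m k≤ν))
...   | inj₂ ν≤k = ≤-trans (≤-reflexive (cong₂ (λ a d → suc e * a + d) flat (m≤n⇒m∸n≡0 ν≤k))) (≤-trans (≤-reflexive (trans (+-identityʳ _) (*-zeroʳ (suc e)))) z≤n)
  where
  flat : ν ∸ k' ≡ 0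
  flat = m≤n⇒m∸n≡0 (+-cancelʳ-≤ (e * k') _ _ (≤-trans (+-monoʳ-≤ ν (*-monoʳ-≤ e (≤-trans k'≤ν ν≤k))) (+-cancelˡ-≤ k _ _ (≤-trans (≤-reflexive (swap k ν (e * k))) h))))
    where
    swap : ∀ k v z → k + (v + z) ≡ v + (k + z)
    swap = solve-∀

contract : ∀ c ν k k' → 0 < c → ν + c * k ≤ k + c * k' → (1 + c) * (ν ∸ k') ≤ c * (ν ∸ k)
contract c ν k k' c>0 h = ≤-trans (≤-reflexive (+-comm (ν ∸ k') _)) (≤-trans (+-monoʳ-≤ (c * (ν ∸ k')) smaller) (shrink c ν k k' c>0 h))
  where
  smaller : ν ∸ k' ≤ ν ∸ k
  smaller = *-cancelˡ-≤ c {{>-nonZero c>0}} (≤-trans (m≤m+n _ (ν ∸ k)) (shrink c ν k k' c>0 h))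

-- Inductive step of Bernoulli's inequality `(1 + 1 / c) ^ r ≥ 1 + r / c`, which spares the powers.
-- At `r = c` the factor is 2, as used by `halve`.
chain : ∀ r c d₂ d₁ d₀ → 0 < c → (r + c) * d₂ ≤ c * d₁ → (1 + c) * d₁ ≤ c * d₀ → (suc r + c) * d₂ ≤ c * d₀
chain r c d₂ d₁ d₀ c>0 h h' = ≤-trans (+-mono-≤ d₂≤d₁ h) h'
  where
  d₂≤d₁ : d₂ ≤ d₁
  d₂≤d₁ = *-cancelˡ-≤ c {{>-nonZero c>0}} (≤-trans (*-monoˡ-≤ d₂ (m≤n+m c r)) h)

halve : ∀ c d d₀ → 0 < c → (c + c) * d ≤ c * d₀ → 2 * d ≤ d₀
halve c d d₀ c>0 h = *-cancelˡ-≤ c {{>-nonZero c>0}} (≤-trans (≤-reflexive (arith c d)) h)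
  where
  arith : ∀ c d → c * (2 * d) ≡ (c + c) * d
  arith = solve-∀

-- The whole protocol and its correctness

module Search {n : ℕ} (s t : Fin n) (s≢t : s ≢ t) (b : ℕ) (b>0 : 0 < b) (n≤ : n ≤ 2 ^ b) where

  open Rounds s t s≢t b b>0 n≤

  iterate : ∀ {A : Set} → ℕ → (A → Protocol (Graph n) (Graph n) A) → A → Protocol (Graph n) (Graph n) A
  iterate zero    f a = leaf a
  iterate (suc m) f a = f a >>= iterate m f

  avoids : VSet n → VSet n → Bool
  avoids R S = existsᵇ λ v → R v ∧ not (S v)

  candidate : VSet n → VSet n → Bool
  candidate R S = (S s ∧ not (S t)) ∧ not (avoids R S)

  existsᵇ-cong : ∀ {k} {P Q : Fin k → Bool} → P ≗ Q → existsᵇ P ≡ existsᵇ Q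
  existsᵇ-cong {P = P} {Q} h with existsᵇ P in p | existsᵇ Q in q
  ... | true  | true  = refl
  ... | false | false = refl
  ... | true  | false with existsᵇ-elim P p
  ...   | i , e = ⊥-elim (true≢false (existsᵇ-intro Q i (trans (sym (h i)) e)) q)
  existsᵇ-cong {P = P} {Q} h | false | true with existsᵇ-elim Q q
  ...   | i , e = ⊥-elim (true≢false (existsᵇ-intro P i (trans (h i) e)) p)

  candidate-ext : ∀ R → Extensional (candidate R)
  candidate-ext R h = cong₂ (λ a c → a ∧ not c) (cong₂ (λ a c → a ∧ not c) (h s) (h t)) (existsᵇ-cong λ v → cong (λ c → R v ∧ not c) (h v))

  candidate-intro : ∀ R S → S s ≡ true → S t ≡ false → (∀ v → R v ≡ true → S v ≡ true) → candidate R S ≡ true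
  candidate-intro R S Ss St sub with avoids R S in e
  ... | false rewrite Ss | St = refl
  ... | true with existsᵇ-elim (λ v → R v ∧ not (S v)) e
  ...   | v , e' = ⊥-elim (true≢false (sub v (proj₁ (∧-true e'))) (not-true (proj₂ (∧-true {R v} e'))))

  candidate-elim : ∀ R S → candidate R S ≡ true → S s ≡ true × S t ≡ false × (∀ v → R v ≡ true → S v ≡ true)
  candidate-elim R S e = proj₁ (∧-true cuts) , not-true (proj₂ (∧-true {S s} cuts)) , sub
    where
    cuts : S s ∧ not (S t) ≡ true
    cuts = proj₁ (∧-true e)
    sub : ∀ v → R v ≡ true → S v ≡ true
    sub v rv with S v in sv
    ... | true  = refl
    ... | false = ⊥-elim (true≢false (existsᵇ-intro (λ v → R v ∧ not (S v)) v (cong₂ (λ a c → a ∧ not c) rv sv)) (not-true (proj₂ (∧-true {S s ∧ not (S t)} e))))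

  -- The factor suc n makes the cut value dominate, so that the size only breaks ties.
  score : Graph n → VSet n → ℕ
  score K S = suc n * cut ⟪ K ⟫ S + size S

  score-ext : ∀ K → Extensional (score K)
  score-ext K h = cong₂ (λ a c → suc n * a + c) (cut-cong ⟪ K ⟫ h) (mass-cong (λ _ → 1) h)

  opaque
    best : Graph n → VSet n → VSet n
    -- The default `R` is for sets contained in no cut; along an actual run the fixed minimum cut
    -- `S*` is always a candidate.
    best K R = [ (λ (S , e) → proj₁ (argmin (candidate R) (candidate-ext R) (score K) (score-ext K) S e)) , (λ _ → R) ]′ (search (candidate R) (candidate-ext R))

    best-spec : ∀ K R S → candidate R S ≡ true → candidate R (best K R) ≡ true × (∀ S → candidate R S ≡ true → score K (best K R) ≤ score K S)
    best-spec K R S e with search (candidate R) (candidate-ext R)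
    ... | inj₁ (S₀ , e₀) = proj₂ (argmin (candidate R) (candidate-ext R) (score K) (score-ext K) S₀ e₀)
    ... | inj₂ none      = ⊥-elim (true≢false e (none S))

  leaving : Graph n → VSet n → Graph n → Graph n
  leaving K S E u v = E u v ∧ (not (K u v) ∧ (S u ∧ not (S v)))

  insert : VSet n → Fin n × Fin n → VSet n
  insert R a v = R v ∨ eqF v (proj₂ a)

  -- Either some player holds a hidden arc leaving the current cheapest cut, and its head is added
  -- to `R`, or the cut has the same value in `K` as in the whole graph. At most `n` heads can be
  -- added, each for `O(b)` bits.
  finish     : Graph n → ℕ → VSet n → Protocol (Graph n) (Graph n) (VSet n)
  finishFrom : Graph n → ℕ → VSet n → Fin n × Fin n → Protocol (Graph n) (Graph n) (VSet n)
  extendBy   : Player → Graph n → ℕ → VSet n → Protocol (Graph n) (Graph n) (VSet n)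
  secondTurn : Graph n → ℕ → VSet n → Protocol (Graph n) (Graph n) (VSet n)
  leavingArc : Graph n → VSet n → Graph n → Bool
  finish K zero    R = leaf (best K R)
  finish K (suc k) R = ask first (leavingArc K R) (extendBy first K k R) (secondTurn K k R)
  secondTurn K k R = ask second (leavingArc K R) (extendBy second K k R) (leaf (best K R))
  leavingArc K R = anyArc ∘ leaving K (best K R)
  extendBy π K k R = sendArc π (someArc ∘ leaving K (best K R)) >>= finishFrom K k R
  finishFrom K k R a = finish K k (insert R a)

  cost-extendBy : ∀ π K k R x y {c} → (∀ R → cost (finish K k R) x y ≤ c) → cost (extendBy π K k R) x y ≤ (b + b) + c
  cost-extendBy π K k R x y h = ≤-trans (≤-reflexive (trans (cost->>= (sendArc π (someArc ∘ leaving K (best K R))) (finishFrom K k R) x y)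
    (cong (_+ cost (finishFrom K k R (run (sendArc π (someArc ∘ leaving K (best K R))) x y)) x y) (cost-sendArc π (someArc ∘ leaving K (best K R)) x y)))) (+-monoʳ-≤ (b + b) (h _))

  cost-finish : ∀ K k R x y → cost (finish K k R) x y ≤ k * (2 + (b + b))
  cost-finish K zero    R x y = z≤n
  cost-finish K (suc k) R x y = go (leavingArc K R (input first x y)) refl (leavingArc K R (input second x y)) refl
    where
    go : ∀ p → leavingArc K R (input first x y) ≡ p → ∀ q → leavingArc K R (input second x y) ≡ q → cost (finish K (suc k) R) x y ≤ suc k * (2 + (b + b))
    go true p _ _ = ≤-trans (≤-reflexive (cost-ask-true first (leavingArc K R) (extendBy first K k R) (secondTurn K k R) x y p))
      (s≤s (≤-trans (cost-extendBy first K k R x y λ R → cost-finish K k R x y) (n≤1+n _)))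
    go false p true q = ≤-trans (≤-reflexive (trans (cost-ask-false first (leavingArc K R) (extendBy first K k R) (secondTurn K k R) x y p)
      (cong suc (cost-ask-true second (leavingArc K R) (extendBy second K k R) (leaf (best K R)) x y q))))
      (s≤s (s≤s (cost-extendBy second K k R x y λ R → cost-finish K k R x y)))
    go false p false q = ≤-trans (≤-reflexive (trans (cost-ask-false first (leavingArc K R) (extendBy first K k R) (secondTurn K k R) x y p)
      (cong suc (cost-ask-false second (leavingArc K R) (extendBy second K k R) (leaf (best K R)) x y q))))
      (s≤s (s≤s z≤n))

  -- The number of rounds in a phase: a round contracts deficits by `c / (1 + c)`, with `c` the
  -- constant of `progress`.
  c : ℕ
  c = 2 * Γ₀

  nothing : Graph n
  nothing _ _ = false

  start : VSet n
  start v = eqF v s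

  protocol : Protocol (Graph n) (Graph n) (VSet n)
  protocol = iterate J (iterate c round) nothing >>= λ K → finish K n start

  module Correct (x y : Graph n) (sym-x : Symmetric x) (sym-y : Symmetric y)
                 (S* : VSet n) (S*s : S* s ≡ true) (S*t : S* t ≡ false)
                 (minimum : ∀ S → S s ≡ true → S t ≡ false → cut ⟪ x ∪ᴳ y ⟫ S* ≤ cut ⟪ x ∪ᴳ y ⟫ S) where

    G : Graph n
    G = x ∪ᴳ y

    ν : ℕ
    ν = cut ⟪ G ⟫ S*

    Valid : Graph n → Set
    Valid K = Symmetric K × (∀ u v → K u v ≡ true → G u v ≡ true)

    module Finish (K : Graph n) (K⊆ : ∀ u v → K u v ≡ true → G u v ≡ true)
                  (saturated : ∀ S → S s ≡ true → S t ≡ false → ν ≤ cut ⟪ K ⟫ S) where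

      cut-S* : cut ⟪ K ⟫ S* ≡ ν
      cut-S* = ≤-antisym (cut-mono (λ u v → ⟦⟧-mono (K⊆ u v)) S*) (saturated S* S*s S*t)

      Good : VSet n → Set
      Good S = S s ≡ true × S t ≡ false × cut ⟪ G ⟫ S ≤ ν

      module At (R : VSet n) (R⊆S* : ∀ v → R v ≡ true → S* v ≡ true) where

        S : VSet n
        S = best K R

        private
          spec : candidate R S ≡ true × (∀ T → candidate R T ≡ true → score K S ≤ score K T)
          spec = best-spec K R S* (candidate-intro R S* S*s S*t R⊆S*)
          parts : S s ≡ true × S t ≡ false × (∀ v → R v ≡ true → S v ≡ true)
          parts = candidate-elim R S (proj₁ spec)

        S-s : S s ≡ true
        S-s = proj₁ parts
        S-t : S t ≡ false
        S-t = proj₁ (proj₂ parts)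
        R⊆S : ∀ v → R v ≡ true → S v ≡ true
        R⊆S = proj₂ (proj₂ parts)

        size≤n : ∀ (T : VSet n) → size T ≤ n
        size≤n T = ≤-trans (∑-≤ _ {1} λ v → ⟦⟧*≤ (T v) 1) (≤-reflexive (*-identityʳ n))

        cut-S : cut ⟪ K ⟫ S ≤ ν
        -- `S*` is a candidate too. Its size is below `suc n`, so comparing scores cannot hide a
        -- difference of one in the cut value.
        cut-S = ≤-pred (*-cancelˡ-< (suc n) _ _ (begin-strict
          suc n * cut ⟪ K ⟫ S              ≤⟨ m≤m+n _ _ ⟩
          score K S                        ≤⟨ proj₂ spec S* (candidate-intro R S* S*s S*t R⊆S*) ⟩
          suc n * cut ⟪ K ⟫ S* + size S*   ≡⟨ cong (λ a → suc n * a + size S*) cut-S* ⟩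
          suc n * ν + size S*              <⟨ +-monoʳ-< (suc n * ν) (s≤s (size≤n S*)) ⟩
          suc n * ν + suc n                ≡⟨ trans (+-comm (suc n * ν) (suc n)) (sym (*-suc (suc n) ν)) ⟩
          suc n * suc ν                    ∎))
          where open ≤-Reasoning

        -- The union with `S*` is again an `s`-`t` cut and thus has value at least `ν`;
        -- submodularity leaves at most `ν` for the intersection.
        meet-≤ : cut ⟪ K ⟫ (S ∩ S*) ≤ ν
        meet-≤ = +-cancelʳ-≤ ν _ _ (begin
          cut ⟪ K ⟫ (S ∩ S*) + ν                         ≤⟨ +-monoʳ-≤ (cut ⟪ K ⟫ (S ∩ S*)) (saturated (S ∪ S*) (cong (_∨ S* s) S-s) (cong₂ _∨_ S-t S*t)) ⟩
          cut ⟪ K ⟫ (S ∩ S*) + cut ⟪ K ⟫ (S ∪ S*)        ≤⟨ m≤m+n _ (cross ⟪ K ⟫ S S*) ⟩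
          cut ⟪ K ⟫ (S ∩ S*) + cut ⟪ K ⟫ (S ∪ S*) + cross ⟪ K ⟫ S S* ≡⟨ cut-∩∪ ⟪ K ⟫ S S* ⟨
          cut ⟪ K ⟫ S + cut ⟪ K ⟫ S*                     ≤⟨ +-mono-≤ cut-S (≤-reflexive cut-S*) ⟩
          ν + ν                                          ∎)
          where open ≤-Reasoning

        size-meet : size S ≤ size (S ∩ S*)
        size-meet = +-cancelˡ-≤ (suc n * ν) _ _ (begin
          suc n * ν + size S                   ≤⟨ +-monoˡ-≤ (size S) (*-monoʳ-≤ (suc n) (saturated S S-s S-t)) ⟩
          score K S                            ≤⟨ proj₂ spec (S ∩ S*) (candidate-intro R (S ∩ S*) (cong₂ _∧_ S-s S*s) (cong (_∧ S* t) S-t) λ v e → cong₂ _∧_ (R⊆S v e) (R⊆S* v e)) ⟩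
          suc n * cut ⟪ K ⟫ (S ∩ S*) + size (S ∩ S*) ≤⟨ +-monoˡ-≤ (size (S ∩ S*)) (*-monoʳ-≤ (suc n) meet-≤) ⟩
          suc n * ν + size (S ∩ S*)            ∎)
          where open ≤-Reasoning

        -- Otherwise `S ∩ S*` would be a candidate of no larger cut value with fewer vertices,
        -- contradicting the tie-break by size.
        S⊆S* : ∀ v → S v ≡ true → S* v ≡ true
        S⊆S* v sv with S* v in e
        ... | true  = refl
        ... | false = ⊥-elim (<⇒≱ (size-< {S = S ∩ S*} {S} (λ w e → proj₁ (∧-true e)) v (trans (cong (S v ∧_) e) (∧-comm (S v) false)) sv) size-meet)

        -- S* is crossed by no edge outside K, since K already accounts for its whole value.
        head-in-S* : ∀ u v → G u v ≡ true → K u v ≡ false → S u ≡ true → S* v ≡ true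
        head-in-S* u v guv kuv su with S* v in e
        ... | true  = refl
        ... | false = ⊥-elim (<-irrefl refl (begin-strict
          ν                                                  <⟨ n<1+n ν ⟩
          suc ν                                              ≡⟨ +-comm 1 ν ⟩
          ν + 1                                              ≡⟨ cong₂ _+_ cut-S* (cong₂ (λ a c → ⟦ a ∧ not c ⟧) (S⊆S* u su) e) ⟨
          cut ⟪ K ⟫ S* + ⟦ S* u ∧ not (S* v) ⟧               ≡⟨ cong (cut ⟪ K ⟫ S* +_) (∑₂-unit u v λ u v → ⟦ S* u ∧ not (S* v) ⟧) ⟨
          cut ⟪ K ⟫ S* + cut (unit u v) S*                   ≡⟨ cut-+ ⟪ K ⟫ (unit u v) S* ⟨
          cut (λ u' v' → ⟪ K ⟫ u' v' + unit u v u' v') S*    ≤⟨ cut-mono (λ u' v' → arc u' v' (K u' v') refl (eqF u' u) refl (eqF v' v) refl) S* ⟩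
          ν                                                  ∎))
          where
          open ≤-Reasoning
          arc : ∀ u' v' k → K u' v' ≡ k → ∀ p → eqF u' u ≡ p → ∀ q → eqF v' v ≡ q → ⟦ k ⟧ + ⟦ p ∧ q ⟧ ≤ ⟦ G u' v' ⟧
          arc u' v' k ek true p true q with eqF-sound {i = u'} p | eqF-sound {i = v'} q
          arc u' v' true  ek true p true q | refl | refl = ⊥-elim (true≢false ek kuv)
          arc u' v' false ek true p true q | refl | refl = ≤-reflexive (cong ⟦_⟧ (sym guv))
          arc u' v' true  ek true  p false q = ≤-reflexive (cong ⟦_⟧ (sym (K⊆ u' v' ek)))
          arc u' v' true  ek false p c     q = ≤-reflexive (cong ⟦_⟧ (sym (K⊆ u' v' ek)))
          arc u' v' false ek true  p false q = z≤n
          arc u' v' false ek false p c     q = z≤n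

        -- Without hidden arcs leaving `S`, every arc that counts in the whole graph already counts
        -- in `K`.
        closed : (∀ u v → leaving K S x u v ≡ false) → (∀ u v → leaving K S y u v ≡ false) → cut ⟪ G ⟫ S ≤ ν
        closed hx hy = ≤-trans (∑₂-mono λ u v → arc (x u v) (y u v) (K u v) (S u) (S v) (hx u v) (hy u v)) cut-S
          where
          arc : ∀ p q k a c → p ∧ (not k ∧ (a ∧ not c)) ≡ false → q ∧ (not k ∧ (a ∧ not c)) ≡ false → ⟦ a ∧ not c ⟧ * ⟦ p ∨ q ⟧ ≤ ⟦ a ∧ not c ⟧ * ⟦ k ⟧
          arc p q true a c e e' = *-monoʳ-≤ ⟦ a ∧ not c ⟧ (⟦⟧≤1 (p ∨ q))
          arc p q false false c e e' = z≤n
          arc p q false true true e e' = z≤n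
          arc false false false true false e e' = z≤n

      input-⊆G : ∀ π u v → input π x y u v ≡ true → G u v ≡ true
      input-⊆G first  u v e = cong (_∨ y u v) e
      input-⊆G second u v e = trans (cong (x u v ∨_) e) (∨-comm (x u v) true)

      -- The set R stays inside S* and grows with every arc sent, so the budget k is never exhausted.
      finish-good : ∀ k R → (∀ v → R v ≡ true → S* v ≡ true) → size {n} full ≤ size R + k → Good (run (finish K k R) x y)
      extendBy-good : ∀ π k R → (∀ v → R v ≡ true → S* v ≡ true) → size {n} full ≤ size R + suc k →
        leavingArc K R (input π x y) ≡ true → Good (run (extendBy π K k R) x y)

      finish-good zero R R⊆S* fuel = ⊥-elim (<⇒≱ (size-< {S = R} {full} (λ _ _ → refl) t (≢true λ e → true≢false (R⊆S* t e) S*t) refl) (≤-trans fuel (≤-reflexive (+-identityʳ _))))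
      finish-good (suc k) R R⊆S* fuel = go (leavingArc K R (input first x y)) refl (leavingArc K R (input second x y)) refl
        where
        open At R R⊆S*
        go : ∀ p → leavingArc K R (input first x y) ≡ p → ∀ q → leavingArc K R (input second x y) ≡ q → Good (run (finish K (suc k) R) x y)
        go true p _ _ = subst Good (sym (run-ask-true first (leavingArc K R) (extendBy first K k R) (secondTurn K k R) x y p)) (extendBy-good first k R R⊆S* fuel p)
        go false p true q = subst Good (sym (trans (run-ask-false first (leavingArc K R) (extendBy first K k R) (secondTurn K k R) x y p)
          (run-ask-true second (leavingArc K R) (extendBy second K k R) (leaf (best K R)) x y q))) (extendBy-good second k R R⊆S* fuel q)
        go false p false q = subst Good (sym (trans (run-ask-false first (leavingArc K R) (extendBy first K k R) (secondTurn K k R) x y p)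
          (run-ask-false second (leavingArc K R) (extendBy second K k R) (leaf (best K R)) x y q)))
          (S-s , S-t , closed (anyArc-false (leaving K S x) p) (anyArc-false (leaving K S y) q))

      extendBy-good π k R R⊆S* fuel any = subst Good (sym (trans (run->>= (sendArc π (someArc ∘ leaving K (best K R))) (finishFrom K k R) x y)
          (cong (λ a → run (finishFrom K k R a) x y) (run-sendArc π (someArc ∘ leaving K (best K R)) x y)))) (extended _ (anyArc-true (leaving K S (input π x y)) any))
        where
        open At R R⊆S*
        extended : ∀ a → leaving K S (input π x y) (proj₁ a) (proj₂ a) ≡ true → Good (run (finish K k (insert R a)) x y)
        extended (u , v) e = finish-good k (insert R (u , v)) sub (begin
            size {n} full               ≤⟨ fuel ⟩
            size R + suc k              ≡⟨ +-suc (size R) k ⟩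
            suc (size R) + k            ≤⟨ +-monoˡ-≤ k (size-< {S = R} {insert R (u , v)} (λ w e → cong (_∨ eqF w v) e) v
                                             (≢true λ e' → true≢false (R⊆S v e') Sv) (trans (cong (R v ∨_) (eqF-refl v)) (∨-comm (R v) true))) ⟩
            size (insert R (u , v)) + k ∎)
          where
          open ≤-Reasoning
          Euv : input π x y u v ≡ true
          Euv = proj₁ (∧-true e)
          e₁ : not (K u v) ∧ (S u ∧ not (S v)) ≡ true
          e₁ = proj₂ (∧-true {input π x y u v} e)
          e₂ : S u ∧ not (S v) ≡ true
          e₂ = proj₂ (∧-true {not (K u v)} e₁)
          Sv : S v ≡ false
          Sv = not-true (proj₂ (∧-true {S u} e₂))
          sub : ∀ w → insert R (u , v) w ≡ true → S* w ≡ true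
          sub w h with R w in rw | eqF w v in ew
          ... | true  | _    = R⊆S* w rw
          ... | false | true rewrite eqF-sound {i = w} ew = head-in-S* u v (input-⊆G π u v Euv) (not-true (proj₁ (∧-true e₁))) (proj₁ (∧-true e₂))

    c>0 : 0 < c
    c>0 = *-mono-≤ {1} {2} (s≤s z≤n) (*-mono-≤ {1} {8} (s≤s z≤n) b>0)

    CutOf : VSet n → Set
    CutOf S = S s ≡ true × S t ≡ false

    deficit : Graph n → VSet n → ℕ
    deficit K S = ν ∸ cut ⟪ K ⟫ S

    module Phases (σ : ℕ) (σ>0 : 0 < σ) (σ-large : (1 + 2 * Γ₀) * ν ≤ σ * σ) where

      C : ℕ
      C = 2 * (J * (n * (b + suc b)) + (J * (n * (2 * σ)) * suc (b + b) + 1))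

      RoundsTo : ℕ → Graph n → Graph n → Set
      RoundsTo r K K' = Valid K' × (∀ S → CutOf S → (r + c) * deficit K' S ≤ c * deficit K S)

      PhasesTo : ℕ → Graph n → Graph n → Set
      PhasesTo m K K' = Valid K' × (∀ S → CutOf S → 2 ^ m * deficit K' S ≤ deficit K S)

      round-to : ∀ K → Valid K → RoundsTo 1 K (run (round K) x y)
      round-to K (sym-K , K⊆) = (R.K'-sym , R.K'-⊆) , λ S (Ss , St) →
        contract c ν (cut ⟪ K ⟫ S) (cut ⟪ run (round K) x y ⟫ S) c>0 (R.progress ν minimum S Ss St)
        where module R = Round K x y sym-K sym-x sym-y K⊆

      round-cost-≤ : ∀ K → Valid K → cost (round K) x y ≤ C
      round-cost-≤ K (sym-K , K⊆) = Round.round-cost K x y sym-K sym-x sym-y K⊆ S* S*s S*t σ σ>0 σ-large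

      rounds-to : ∀ r K → Valid K → RoundsTo r K (run (iterate r round K) x y) × cost (iterate r round K) x y ≤ r * C
      rounds-to zero    K valid = (valid , λ S _ → ≤-refl) , z≤n
      rounds-to (suc r) K valid = subst (RoundsTo (suc r) K) (sym (run->>= (round K) (iterate r round) x y)) (proj₁ rest , combined) ,
        ≤-trans (≤-reflexive (cost->>= (round K) (iterate r round) x y)) (+-mono-≤ (round-cost-≤ K valid) (proj₂ later))
        where
        K₁ : Graph n
        K₁ = run (round K) x y
        here : RoundsTo 1 K K₁
        here = round-to K valid
        later : RoundsTo r K₁ (run (iterate r round K₁) x y) × cost (iterate r round K₁) x y ≤ r * C
        later = rounds-to r K₁ (proj₁ here)
        rest : RoundsTo r K₁ (run (iterate r round K₁) x y)
        rest = proj₁ later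
        combined : ∀ S → CutOf S → (suc r + c) * deficit (run (iterate r round K₁) x y) S ≤ c * deficit K S
        combined S cutS = chain r c (deficit (run (iterate r round K₁) x y) S) (deficit K₁ S) (deficit K S) c>0 (proj₂ rest S cutS) (proj₂ here S cutS)

      phases-to : ∀ m K → Valid K → PhasesTo m K (run (iterate m (iterate c round) K) x y) × cost (iterate m (iterate c round) K) x y ≤ m * (c * C)
      phases-to zero    K valid = (valid , λ S _ → ≤-reflexive (*-identityˡ _)) , z≤n
      phases-to (suc m) K valid = subst (PhasesTo (suc m) K) (sym (run->>= (iterate c round K) (iterate m (iterate c round)) x y)) (proj₁ rest , combined) ,
        ≤-trans (≤-reflexive (cost->>= (iterate c round K) (iterate m (iterate c round)) x y)) (+-mono-≤ (proj₂ here) (proj₂ later))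
        where
        K₁ : Graph n
        K₁ = run (iterate c round K) x y
        here : RoundsTo c K K₁ × cost (iterate c round K) x y ≤ c * C
        here = rounds-to c K valid
        later : PhasesTo m K₁ (run (iterate m (iterate c round) K₁) x y) × cost (iterate m (iterate c round) K₁) x y ≤ m * (c * C)
        later = phases-to m K₁ (proj₁ (proj₁ here))
        rest : PhasesTo m K₁ (run (iterate m (iterate c round) K₁) x y)
        rest = proj₁ later
        combined : ∀ S → CutOf S → 2 ^ suc m * deficit (run (iterate m (iterate c round) K₁) x y) S ≤ deficit K S
        combined S cutS = begin
          2 * 2 ^ m * deficit K₂ S      ≡⟨ *-assoc 2 (2 ^ m) _ ⟩
          2 * (2 ^ m * deficit K₂ S)    ≤⟨ *-monoʳ-≤ 2 (proj₂ rest S cutS) ⟩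
          2 * deficit K₁ S              ≤⟨ halve c (deficit K₁ S) (deficit K S) c>0 (proj₂ (proj₁ here) S cutS) ⟩
          deficit K S                   ∎
          where
          open ≤-Reasoning
          K₂ : Graph n
          K₂ = run (iterate m (iterate c round) K₁) x y

      learned : Graph n
      learned = run (iterate J (iterate c round) nothing) x y

      learned-ok : PhasesTo J nothing learned × cost (iterate J (iterate c round) nothing) x y ≤ J * (c * C)
      learned-ok = phases-to J nothing ((λ _ _ → refl) , λ _ _ ())

      ν-small : ν < 2 ^ J
      ν-small = ≤-<-trans (≤-trans (∑₂-mono λ u v → ⟦⟧*≤ (S* u ∧ not (S* v)) (⟪ G ⟫ u v)) (≤-trans (∑-≤ _ λ u → ∑-≤ _ {1} λ v → ⟦⟧≤1 (G u v))
          (≤-trans (*-mono-≤ n≤ (≤-trans (≤-reflexive (*-identityʳ n)) n≤)) (≤-reflexive (sym (^-distribˡ-+-* 2 b b))))))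
        (^-monoʳ-< 2 (s≤s (s≤s z≤n)) (n<1+n (b + b)))

      saturated : ∀ S → S s ≡ true → S t ≡ false → ν ≤ cut ⟪ learned ⟫ S
      -- The empty graph starts with a deficit of at most `ν < 2 ^ J`, so after `J` halvings an
      -- integer deficit is zero.
      saturated S Ss St = m∸n≡0⇒m≤n (vanishes (deficit learned S) (≤-trans (proj₂ (proj₁ learned-ok) S (Ss , St)) (m∸n≤m ν (cut ⟪ nothing ⟫ S))))
        where
        vanishes : ∀ d → 2 ^ J * d ≤ ν → d ≡ 0
        vanishes zero    _  = refl
        vanishes (suc d) le = ⊥-elim (<⇒≱ ν-small (≤-trans (m≤m*n (2 ^ J) (suc d)) le))

      finished : Finish.Good learned (proj₂ (proj₁ (proj₁ learned-ok))) saturated (run (finish learned n start) x y)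
      finished = Finish.finish-good learned (proj₂ (proj₁ (proj₁ learned-ok))) saturated n start
        (λ v e → subst (λ w → S* w ≡ true) (sym (eqF-sound {i = v} e)) S*s)
        (≤-trans (≤-trans (∑-≤ _ {1} λ v → ≤-refl) (≤-reflexive (*-identityʳ n))) (m≤n+m n (size start)))

      protocol-≡ : run protocol x y ≡ run (finish learned n start) x y
      protocol-≡ = run->>= (iterate J (iterate c round) nothing) (λ K → finish K n start) x y

      protocol-correct : run protocol x y s ≡ true × run protocol x y t ≡ false × cut ⟪ G ⟫ (run protocol x y) ≤ ν
      protocol-correct = subst (λ S → S s ≡ true × S t ≡ false × cut ⟪ G ⟫ S ≤ ν) (sym protocol-≡) finished

      protocol-cost : cost protocol x y ≤ J * (c * C) + n * (2 + (b + b))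
      protocol-cost = ≤-trans (≤-reflexive (cost->>= (iterate J (iterate c round) nothing) (λ K → finish K n start) x y))
        (+-mono-≤ (proj₂ learned-ok) (cost-finish learned n start x y))

-- Comparison with the definitions in Defs, and arithmetic of the cost

opaque
  unfolding ∑

  ∑-list : ∀ {n} (f : Fin n → ℕ) → List.sum (map f (allFin n)) ≡ ∑ f
  ∑-list {n} f = trans (cong List.sum (map-tabulate {n = n} (λ i → i) f)) (tabulated f)
    where
    tabulated : ∀ {n} (f : Fin n → ℕ) → List.sum (tabulate f) ≡ ∑ f
    tabulated {zero}  f = refl
    tabulated {suc n} f = cong (f zero +_) (tabulated (f ∘ suc))

-- An edge with `u` below `v` is counted by the orientation that leaves `S`. Swapping the summation
-- indices in the other orientation and using symmetry collects all ordered pairs; diagonal terms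
-- vanish.
cutValue-≡ : ∀ {n} (G : Graph n) → Symmetric G → ∀ S → cutValue G S ≡ cut ⟪ G ⟫ S
cutValue-≡ {n} G sym-G S = begin
  cutValue G S                                              ≡⟨ trans (∑-list {n} _) (∑-cong λ u → ∑-list {n} _) ⟩
  ∑₂ (λ u v → if lt u v ∧ (G u v ∧ differ (S u) (S v)) then 1 else 0) ≡⟨ ∑₂-cong (λ u v → arc (lt u v) (G u v) (S u) (S v)) ⟩
  ∑₂ (λ u v → ⟦ lt u v ⟧ * edge u v + ⟦ lt u v ⟧ * (⟦ S v ∧ not (S u) ⟧ * ⟦ G u v ⟧)) ≡⟨ ∑₂-+ _ _ ⟩
  ∑₂ (λ u v → ⟦ lt u v ⟧ * edge u v) + ∑₂ (λ u v → ⟦ lt u v ⟧ * (⟦ S v ∧ not (S u) ⟧ * ⟦ G u v ⟧))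
    ≡⟨ cong (∑₂ (λ u v → ⟦ lt u v ⟧ * edge u v) +_) (trans (∑₂-swap _) (∑₂-cong λ v u → cong (λ b → ⟦ lt u v ⟧ * (⟦ S v ∧ not (S u) ⟧ * ⟦ b ⟧)) (sym-G u v))) ⟩
  ∑₂ (λ u v → ⟦ lt u v ⟧ * edge u v) + ∑₂ (λ u v → ⟦ lt v u ⟧ * edge u v) ≡⟨ ∑₂-+ _ _ ⟨
  ∑₂ (λ u v → ⟦ lt u v ⟧ * edge u v + ⟦ lt v u ⟧ * edge u v) ≡⟨ ∑₂-cong once ⟩
  cut ⟪ G ⟫ S                                               ∎
  where
  open ≡-Reasoning
  lt : Fin n → Fin n → Bool
  lt u v = toℕ u <ᵇ toℕ v
  edge : Fin n → Fin n → ℕ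
  edge u v = ⟦ S u ∧ not (S v) ⟧ * ⟦ G u v ⟧
  arc : ∀ l g a c → (if l ∧ (g ∧ differ a c) then 1 else 0) ≡ ⟦ l ⟧ * (⟦ a ∧ not c ⟧ * ⟦ g ⟧) + ⟦ l ⟧ * (⟦ c ∧ not a ⟧ * ⟦ g ⟧)
  arc false g     a     c     = refl
  arc true  true  true  true  = refl
  arc true  true  true  false = refl
  arc true  true  false true  = refl
  arc true  true  false false = refl
  arc true  false a     c     rewrite *-zeroʳ ⟦ a ∧ not c ⟧ | *-zeroʳ ⟦ c ∧ not a ⟧ = refl
  once : ∀ u v → ⟦ lt u v ⟧ * edge u v + ⟦ lt v u ⟧ * edge u v ≡ edge u v
  once u v with lt u v in e | lt v u in e'
  ... | true  | true  = ⊥-elim (<-asym (<ᵇ-elim {toℕ u} {toℕ v} e) (<ᵇ-elim {toℕ v} {toℕ u} e'))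
  ... | true  | false = trans (+-identityʳ _) (+-identityʳ _)
  ... | false | true  = +-identityʳ _
  ... | false | false with toℕ-injective (≤-antisym (<ᵇ-false {toℕ v} {toℕ u} e') (<ᵇ-false {toℕ u} {toℕ v} e))
  ...   | refl = sym (loop (S u))
    where
    loop : ∀ a → ⟦ a ∧ not a ⟧ * ⟦ G u u ⟧ ≡ 0
    loop true  = refl
    loop false = refl

-- The cost bound grows with `ν`, so the true minimum has to be bounded by the fold. The hypothesis
-- `m ≤ n * n` handles the default of the fold.
minCutValue-≥ : ∀ {n} (s t : Fin n) (G : Graph n) m → m ≤ n * n → (∀ S → isCutᵇ s t S ≡ true → m ≤ cutValue G S) → m ≤ minCutValue s t G
minCutValue-≥ {n} s t G m m≤ below = go (allSubsets n)
  where
  go : ∀ L → m ≤ foldr (λ S k → if isCutᵇ s t S then cutValue G S ⊓ k else k) (n * n) L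
  go [] = m≤
  go (S ∷ L) with isCutᵇ s t S in e
  ... | true  = ⊓-glb (below S e) (go L)
  ... | false = go L

-- Square roots, bit lengths and the cost bound

-- Increasing a positive `σ` by one at most quadruples its square, and it is increased only when
-- `σ * σ ≤ B`. The summand 4 covers `B = 0`, where `σ` must still be positive.
root : ∀ B → ∃ λ σ → 0 < σ × B ≤ σ * σ × σ * σ ≤ 4 * B + 4
root zero = 1 , s≤s z≤n , z≤n , s≤s z≤n
root (suc B) with root B
... | σ , σ>0 , low , high with suc B ≤? σ * σ
...   | yes le = σ , σ>0 , le , ≤-trans high (+-monoˡ-≤ 4 (*-monoʳ-≤ 4 (n≤1+n B)))
...   | no nle = suc σ , s≤s z≤n , ≤-trans (s≤s low) (≤-trans (m≤m+n (suc (σ * σ)) (σ + σ)) (≤-reflexive (square σ))) , (begin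
  suc σ * suc σ          ≡⟨ square σ ⟨
  suc (σ * σ) + (σ + σ)  ≤⟨ +-mono-≤ (+-monoˡ-≤ (σ * σ) (*-mono-≤ σ>0 σ>0)) (+-mono-≤ (m≤m*n σ σ {{>-nonZero σ>0}}) (m≤m*n σ σ {{>-nonZero σ>0}})) ⟩
  (σ * σ + σ * σ) + (σ * σ + σ * σ) ≡⟨ four (σ * σ) ⟩
  4 * (σ * σ)            ≤⟨ *-monoʳ-≤ 4 (≤-pred (≰⇒> nle)) ⟩
  4 * B                  ≤⟨ *-monoʳ-≤ 4 (n≤1+n B) ⟩
  4 * suc B              ≤⟨ m≤m+n _ 4 ⟩
  4 * suc B + 4          ∎)
  where
  open ≤-Reasoning
  square : ∀ σ → suc (σ * σ) + (σ + σ) ≡ suc σ * suc σ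
  square = solve-∀
  four : ∀ x → x + x + (x + x) ≡ 4 * x
  four = solve-∀

bits : ∀ m → ∃ λ b → suc m ≤ 2 ^ b × 2 ^ b ≤ 2 * suc m
bits zero = 0 , ≤-refl , s≤s z≤n
bits (suc m) with bits m
... | b , low , high with suc (suc m) ≤? 2 ^ b
...   | yes le = b , le , ≤-trans high (*-monoʳ-≤ 2 (n≤1+n (suc m)))
...   | no nle = suc b , ≤-trans (s≤s low) (≤-trans (+-monoˡ-≤ (2 ^ b) (≤-trans (s≤s z≤n) low)) (≤-reflexive (cong (2 ^ b +_) (sym (+-identityʳ (2 ^ b)))))) ,
    *-monoʳ-≤ 2 (<⇒≤ (≰⇒> nle))

bits-log : ∀ m b → 2 ^ b ≤ 2 * suc m → suc b ≤ 3 * ⌊log₂ (suc m + 2) ⌋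
bits-log m b le = begin
  suc b                                ≡⟨ cong suc (⌊log₂[2^n]⌋≡n b) ⟨
  suc ⌊log₂ 2 ^ b ⌋                    ≤⟨ s≤s (⌊log₂⌋-mono-≤ le) ⟩
  suc ⌊log₂ 2 * suc m ⌋                ≡⟨ cong suc (⌊log₂[2*b]⌋≡1+⌊log₂b⌋ (suc m)) ⟩
  -- Because of the `+ 2` under the logarithm `L` is at least 1 for every `m` and absorbs the
  -- additive constant.
  2 + ⌊log₂ suc m ⌋                    ≤⟨ +-mono-≤ (*-monoʳ-≤ 2 one) (⌊log₂⌋-mono-≤ (m≤m+n (suc m) 2)) ⟩
  2 * L + L                            ≡⟨ +-comm (2 * L) L ⟩
  3 * L                                ∎
  where
  open ≤-Reasoning
  L : ℕ
  L = ⌊log₂ (suc m + 2) ⌋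
  one : 1 ≤ L
  one = ≤-trans (≤-reflexive (sym (⌊log₂[2^n]⌋≡n 1))) (⌊log₂⌋-mono-≤ (m≤n+m 2 (suc m)))

-- All terms are lifted to `b ^ 4 * (n * σ)` with `2 * b + 1 ≤ 3 * b`. The rounds give
-- `96 * (9 + 18 + 1) = 2688`, for announcements, arcs and stop bits, and the final search gives 4.
total-cost : ∀ b n σ → 0 < b → 0 < n → 0 < σ →
  suc (b + b) * (2 * (8 * b) * (2 * (suc (b + b) * (n * (b + suc b)) + (suc (b + b) * (n * (2 * σ)) * suc (b + b) + 1)))) + n * (2 + (b + b))
    ≤ 2692 * (b ^ 4 * (n * σ))
total-cost b n σ b>0 n>0 σ>0 = begin
  J * (2 * (8 * b) * (2 * (J * (n * (b + suc b)) + (J * (n * (2 * σ)) * J + 1)))) + n * (2 + (b + b))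
    ≤⟨ +-mono-≤ (*-mono-≤ J≤ (*-monoʳ-≤ (2 * (8 * b)) (*-monoʳ-≤ 2 (+-mono-≤ (*-mono-≤ J≤ (*-monoʳ-≤ n (≤-trans (≤-reflexive (+-suc b b)) J≤))) (+-mono-≤ (*-mono-≤ (*-monoˡ-≤ (n * (2 * σ)) J≤) J≤) q>0)))))
       (*-monoʳ-≤ n (+-monoˡ-≤ (b + b) (*-monoʳ-≤ 2 b>0))) ⟩
  3 * b * (2 * (8 * b) * (2 * (3 * b * (n * (3 * b)) + (3 * b * (n * (2 * σ)) * (3 * b) + q)))) + n * (2 * b + (b + b))
    ≤⟨ +-mono-≤ (*-monoʳ-≤ (3 * b) (*-monoʳ-≤ (2 * (8 * b)) (*-monoʳ-≤ 2 (+-monoˡ-≤ _ (m≤m*n (3 * b * (n * (3 * b))) σ {{>-nonZero σ>0}}))))) (m≤m*n (n * (2 * b + (b + b))) (b * b * b * σ) {{>-nonZero (*-mono-≤ (*-mono-≤ (*-mono-≤ b>0 b>0) b>0) σ>0)}}) ⟩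
  3 * b * (2 * (8 * b) * (2 * (3 * b * (n * (3 * b)) * σ + (3 * b * (n * (2 * σ)) * (3 * b) + q)))) + n * (2 * b + (b + b)) * (b * b * b * σ)
    ≡⟨ collect b n σ ⟩
  2692 * (b ^ 4 * (n * σ)) ∎
  where
  open ≤-Reasoning
  J q : ℕ
  J = suc (b + b)
  q = b * b * n * σ
  q>0 : 1 ≤ q
  q>0 = *-mono-≤ (*-mono-≤ (*-mono-≤ b>0 b>0) n>0) σ>0
  J≤ : suc (b + b) ≤ 3 * b
  J≤ = ≤-trans (+-monoˡ-≤ (b + b) b>0) (≤-reflexive (cong (λ x → b + (b + x)) (sym (+-identityʳ b))))
  collect : ∀ b n σ → 3 * b * (2 * (8 * b) * (2 * (3 * b * (n * (3 * b)) * σ + (3 * b * (n * (2 * σ)) * (3 * b) + b * b * n * σ)))) + n * (2 * b + (b + b)) * (b * b * b * σ)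
    ≡ 2692 * (b * (b * (b * (b * 1))) * (n * σ))
  collect = solve-∀

^-distribʳ-* : ∀ k m n → (m * n) ^ k ≡ m ^ k * n ^ k
^-distribʳ-* zero    m n = refl
^-distribʳ-* (suc k) m n = trans (cong (m * n *_) (^-distribʳ-* k m n)) ([m*n]*[o*p]≡[m*o]*[n*p] m n (m ^ k) (n ^ k))

-- Of the exponent 32, 28 comes from the seventh power of `b ^ 4`, and 4 from the one logarithm
-- contained in `σ * σ`.
seventh-power : ∀ A D n σ b L μ X → X ≤ A * (b ^ 4 * (n * σ)) → 0 < σ → b ≤ 3 * L → σ * σ ≤ D * (L * μ) →
  X ^ 7 ≤ (A ^ 7 * 3 ^ 28 * D ^ 4) * n ^ 7 * μ ^ 4 * L ^ 32
seventh-power A D n σ b L μ X X≤ σ>0 b≤ σσ≤ = begin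
  X ^ 7                                                  ≤⟨ ^-monoˡ-≤ 7 X≤ ⟩
  (A * (b ^ 4 * (n * σ))) ^ 7                            ≡⟨ trans (^-distribʳ-* 7 A _) (cong (A ^ 7 *_) (trans (^-distribʳ-* 7 (b ^ 4) _) (cong₂ _*_ (^-*-assoc b 4 7) (^-distribʳ-* 7 n σ)))) ⟩
  A ^ 7 * (b ^ 28 * (n ^ 7 * σ ^ 7))                     ≤⟨ *-monoʳ-≤ (A ^ 7) (*-mono-≤ b-part (*-monoʳ-≤ (n ^ 7) σ-part)) ⟩
  A ^ 7 * (3 ^ 28 * L ^ 28 * (n ^ 7 * (D ^ 4 * (L ^ 4 * μ ^ 4)))) ≡⟨ rearrange (A ^ 7) (3 ^ 28) (L ^ 28) (n ^ 7) (D ^ 4) (L ^ 4) (μ ^ 4) ⟩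
  (A ^ 7 * 3 ^ 28 * D ^ 4) * n ^ 7 * μ ^ 4 * (L ^ 28 * L ^ 4) ≡⟨ cong (((A ^ 7 * 3 ^ 28 * D ^ 4) * n ^ 7 * μ ^ 4) *_) (^-distribˡ-+-* L 28 4) ⟨
  (A ^ 7 * 3 ^ 28 * D ^ 4) * n ^ 7 * μ ^ 4 * L ^ 32      ∎
  where
  open ≤-Reasoning
  rearrange : ∀ a t l n d k m → a * (t * l * (n * (d * (k * m)))) ≡ (a * t * d) * n * m * (l * k)
  rearrange = solve-∀
  b-part : b ^ 28 ≤ 3 ^ 28 * L ^ 28
  b-part = ≤-trans (^-monoˡ-≤ 28 b≤) (≤-reflexive (^-distribʳ-* 28 3 L))
  σ-part : σ ^ 7 ≤ D ^ 4 * (L ^ 4 * μ ^ 4)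
  σ-part = begin
    σ ^ 7                        ≤⟨ m≤n*m (σ ^ 7) σ {{>-nonZero σ>0}} ⟩
    σ ^ 8                        ≡⟨ trans (^-distribˡ-+-* σ 4 4) (sym (^-distribʳ-* 4 σ σ)) ⟩
    (σ * σ) ^ 4                  ≤⟨ ^-monoˡ-≤ 4 σσ≤ ⟩
    (D * (L * μ)) ^ 4            ≡⟨ trans (^-distribʳ-* 4 D _) (cong (D ^ 4 *_) (^-distribʳ-* 4 L μ)) ⟩
    D ^ 4 * (L ^ 4 * μ ^ 4)      ∎

-- From `1 + 16 * b ≤ 17 * b` the factor is `4 * 17 = 68`, tripled on passing from `b` to `L`; the
-- summand 4 is absorbed by the 1 in `ν + 1`.
root-bound : ∀ b L ν σ → 0 < b → b ≤ 3 * L → σ * σ ≤ 4 * ((1 + 2 * (8 * b)) * ν) + 4 → σ * σ ≤ 204 * (L * (ν + 1))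
root-bound b L ν σ b>0 b≤ le = begin
  σ * σ                                      ≤⟨ le ⟩
  4 * ((1 + 2 * (8 * b)) * ν) + 4            ≤⟨ +-mono-≤ (*-monoʳ-≤ 4 (*-monoˡ-≤ ν (+-monoˡ-≤ (2 * (8 * b)) b>0))) (*-monoʳ-≤ 4 (*-mono-≤ {1} {17} (s≤s z≤n) b>0)) ⟩
  4 * ((b + 2 * (8 * b)) * ν) + 4 * (17 * b) ≡⟨ arith b ν ⟩
  68 * (b * (ν + 1))                         ≤⟨ *-monoʳ-≤ 68 (*-monoˡ-≤ (ν + 1) b≤) ⟩
  68 * (3 * L * (ν + 1))                     ≡⟨ arith' L (ν + 1) ⟩
  204 * (L * (ν + 1))                        ∎
  where
  open ≤-Reasoning
  arith : ∀ b ν → 4 * ((b + 2 * (8 * b)) * ν) + 4 * (17 * b) ≡ 68 * (b * (ν + 1))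
  arith = solve-∀
  arith' : ∀ L μ → 68 * (3 * L * μ) ≡ 204 * (L * μ)
  arith' = solve-∀

opaque
  constant : ℕ
  constant = 2692 ^ 7 * 3 ^ 28 * 204 ^ 4

  cost-bound : ∀ n b L ν μ σ X → 0 < n → 0 < b → 0 < σ → b ≤ 3 * L → ν ≤ μ →
    σ * σ ≤ 4 * ((1 + 2 * (8 * b)) * ν) + 4 → X ≤ 2692 * (b ^ 4 * (n * σ)) →
    X ^ 7 ≤ constant * n ^ 7 * (μ + 1) ^ 4 * L ^ 32
  cost-bound n b L ν μ σ X n>0 b>0 σ>0 b≤ ν≤ σσ≤ X≤ = seventh-power 2692 204 n σ b L (μ + 1) X X≤ σ>0 b≤
    (≤-trans (root-bound b L ν σ b>0 b≤ σσ≤) (*-monoʳ-≤ 204 (*-monoʳ-≤ L (+-monoˡ-≤ 1 ν≤))))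

-- Instantiation for a given number of vertices

module Main {m : ℕ} (s t : Fin (suc m)) (s≢t : s ≢ t) where

  n : ℕ
  n = suc m

  -- The extra `suc` makes `b` positive also for a single vertex; `bits-log` is stated for this
  -- successor.
  b : ℕ
  b = suc (proj₁ (bits m))

  n≤2^b : n ≤ 2 ^ b
  n≤2^b = ≤-trans (proj₁ (proj₂ (bits m))) (m≤m+n _ _)

  open Search s t s≢t b (s≤s z≤n) n≤2^b public

  L : ℕ
  L = ⌊log₂ (n + 2) ⌋

  isCutᵇ-true : ∀ {S : VSet n} → S s ≡ true → S t ≡ false → isCutᵇ s t S ≡ true
  isCutᵇ-true = cong₂ (λ a c → a ∧ not c)

  least : ∀ G → ∃ λ S → isCutᵇ s t S ≡ true × (∀ T → isCutᵇ s t T ≡ true → cut ⟪ G ⟫ S ≤ cut ⟪ G ⟫ T)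
  least G = argmin (isCutᵇ s t) (λ h → cong₂ (λ a c → a ∧ not c) (h s) (h t)) (cut ⟪ G ⟫) (cut-cong ⟪ G ⟫)
    (λ v → eqF v s) (isCutᵇ-true {λ v → eqF v s} (eqF-refl s) (dec-false (t ≟ s) λ e → s≢t (sym e)))

  solves : (x y : Graph n) → SimpleGraph x → SimpleGraph y →
    IsMinCut s t (x ∪ᴳ y) (run protocol x y) ×
    (cost protocol x y ^ 7 ≤ constant * n ^ 7 * (minCutValue s t (x ∪ᴳ y) + 1) ^ 4 * L ^ 32)
  solves x y (sym-x , _) (sym-y , _) = with-least (least G)
    where
    G : Graph n
    G = x ∪ᴳ y
    sym-G : Symmetric G
    sym-G u v = cong₂ _∨_ (sym-x u v) (sym-y u v)
    with-least : (∃ λ S → isCutᵇ s t S ≡ true × (∀ T → isCutᵇ s t T ≡ true → cut ⟪ G ⟫ S ≤ cut ⟪ G ⟫ T)) →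
      IsMinCut s t G (run protocol x y) × (cost protocol x y ^ 7 ≤ constant * n ^ 7 * (minCutValue s t G + 1) ^ 4 * L ^ 32)
    with-least (S* , cut* , min*) = with-root (root ((1 + 2 * (8 * b)) * cut ⟪ G ⟫ S*))
      where
      module Co = Correct x y sym-x sym-y S* (proj₁ (∧-true cut*)) (not-true (proj₂ (∧-true {S* s} cut*))) (λ S Ss St → min* S (isCutᵇ-true {S} Ss St))
      with-root : (∃ λ σ → 0 < σ × (1 + 2 * (8 * b)) * cut ⟪ G ⟫ S* ≤ σ * σ × σ * σ ≤ 4 * ((1 + 2 * (8 * b)) * cut ⟪ G ⟫ S*) + 4) →
        IsMinCut s t G (run protocol x y) × (cost protocol x y ^ 7 ≤ constant * n ^ 7 * (minCutValue s t G + 1) ^ 4 * L ^ 32)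
      with-root (σ , σ>0 , low , high) = (((proj₁ correct) , (proj₁ (proj₂ correct))) , smallest) ,
          cost-bound n b L (cut ⟪ G ⟫ S*) (minCutValue s t G) σ (cost protocol x y) (s≤s z≤n) (s≤s z≤n) σ>0
            (bits-log m (proj₁ (bits m)) (proj₂ (proj₂ (bits m)))) ν≤ high
            (≤-trans P.protocol-cost (total-cost b n σ (s≤s z≤n) (s≤s z≤n) σ>0))
        where
        module P = Co.Phases σ σ>0 low
        correct : run protocol x y s ≡ true × run protocol x y t ≡ false × cut ⟪ G ⟫ (run protocol x y) ≤ cut ⟪ G ⟫ S*
        correct = P.protocol-correct
        smallest : ∀ S' → S' s ≡ true × S' t ≡ false → cutValue G (run protocol x y) ≤ cutValue G S'
        smallest S' (S's , S't) = ≤-trans (≤-reflexive (cutValue-≡ G sym-G (run protocol x y))) (≤-trans (proj₂ (proj₂ correct))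
          (≤-trans (min* S' (isCutᵇ-true {S'} S's S't)) (≤-reflexive (sym (cutValue-≡ G sym-G S')))))
        ν≤ : cut ⟪ G ⟫ S* ≤ minCutValue s t G
        ν≤ = minCutValue-≥ s t G _ (≤-trans (∑₂-mono λ u v → ⟦⟧*≤ (S* u ∧ not (S* v)) (⟪ G ⟫ u v)) (∑-≤ _ λ u → ≤-trans (∑-≤ _ {1} λ v → ⟦⟧≤1 (G u v)) (≤-reflexive (*-identityʳ n))))
          λ S e → ≤-trans (min* S e) (≤-reflexive (sym (cutValue-≡ G sym-G S)))

mainTheorem2 : Σ ℕ λ c → Σ ℕ λ k → (n : ℕ) (s t : Fin n) → s ≢ t →
    Σ (Protocol (Graph n) (Graph n) (VSet n)) λ P →
    (EA EB : Graph n) → SimpleGraph EA → SimpleGraph EB →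
    IsMinCut s t (EA ∪ᴳ EB) (run P EA EB)
    × (cost P EA EB ^ 7 ≤ c * n ^ 7 * (minCutValue s t (EA ∪ᴳ EB) + 1) ^ 4 * ⌊log₂ (n + 2) ⌋ ^ k)
mainTheorem2 = constant , 32 , λ { (suc m) s t s≢t → Main.protocol s t s≢t , Main.solves s t s≢t }
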